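{- There exists a constant $C'>0$ such that for every complete $k$-partite graph $H$ on $mk$ vertices with $C'\leq m\leq k^{22}$, and every integer $n\geq 10^{60}mk\log^4 k$, the cycle $C_n$ is $H$-good, i.e. $R(C_n,H)=(\chi(H)-1)(n-1)+\sigma(H)$.
   Context: For graphs $F,H$, $R(F,H)$ is the minimum $N$ such that every $N$-vertex graph $G$ either contains $F$ or its complement contains $H$. $C_n$ is the $n$-vertex cycle, $\chi(H)$ the chromatic number, and $\sigma(H)$ the minimum possible size of a colour class in a proper $\chi(H)$-colouring of $H$. $\log$ is the natural logarithm. -}

module Defs where

open import Data.Nat as ℕ using (ℕ; zero; suc; _+_; _*_; _∸_; _!; _<_)
open import Data.Nat.Properties using (_!≢0)
open import Data.Bool using (Bool; true; false; not; _∧_; _∨_)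
open import Data.Fin using (Fin; toℕ; _≟_)
open import Data.Fin.Properties using ()
open import Data.List using (List; length; filter; allFin)
open import Data.Product using (Σ; ∃; _×_; _,_)
open import Data.Integer using (+_)
open import Data.Rational as ℚ using (ℚ; _/_; 0ℚ; 1ℚ)
open import Data.Sum using (_⊎_)
open import Function.Definitions using (Injective)
open import Relation.Binary.PropositionalEquality using (_≡_; _≢_)
open import Relation.Nullary using (¬_)
open import Relation.Nullary.Decidable using (⌊_⌋)

RawGraph : ℕ → Set
RawGraph v = Fin v → Fin v → Bool

IsSimple : {v : ℕ} → RawGraph v → Set
IsSimple {v} G = (∀ x y → G x y ≡ G y x) × (∀ x → G x x ≡ false)

complement : {v : ℕ} → RawGraph v → RawGraph v
complement G x y = not (G x y) ∧ not ⌊ x ≟ y ⌋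

Contains : {a b : ℕ} → RawGraph b → RawGraph a → Set
Contains {a} {b} G F =
  Σ (Fin a → Fin b) λ f → Injective _≡_ _≡_ f ×
    (∀ x y → F x y ≡ true → G (f x) (f y) ≡ true)

RamseyArrow : {a b : ℕ} → RawGraph a → RawGraph b → ℕ → Set
RamseyArrow F H N =
  (G : RawGraph N) → IsSimple G → Contains G F ⊎ Contains (complement G) H

IsRamseyNumber : {a b : ℕ} → RawGraph a → RawGraph b → ℕ → Set
IsRamseyNumber F H N = RamseyArrow F H N × (∀ N' → N' < N → ¬ RamseyArrow F H N')

ProperColouring : {v : ℕ} → RawGraph v → (r : ℕ) → (Fin v → Fin r) → Set
ProperColouring G r c = ∀ x y → G x y ≡ true → c x ≢ c y

Colourable : {v : ℕ} → RawGraph v → ℕ → Set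
Colourable {v} G r = Σ (Fin v → Fin r) (ProperColouring G r)

IsChromaticNumber : {v : ℕ} → RawGraph v → ℕ → Set
IsChromaticNumber G r = Colourable G r × (∀ r' → r' < r → ¬ Colourable G r')

classSize : {v r : ℕ} → (Fin v → Fin r) → Fin r → ℕ
classSize {v} c i = length (filter (λ x → c x ≟ i) (allFin v))

-- σ(G) = s, where r = χ(G): s is the minimum size of a colour class
-- over all proper r-colourings of G
IsSigma : {v : ℕ} → RawGraph v → (r : ℕ) → ℕ → Set
IsSigma {v} G r s =
  (Σ (Fin v → Fin r) λ c → ProperColouring G r c × ∃ λ i → classSize c i ≡ s)
  × (∀ (c : Fin v → Fin r) → ProperColouring G r c → ∀ i → s ℕ.≤ classSize c i)

cycSucc : (n : ℕ) → Fin n → Fin n → Bool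
cycSucc n x y =
  (suc (toℕ x) ℕ.≡ᵇ toℕ y) ∨ ((suc (toℕ x) ℕ.≡ᵇ n) ∧ (toℕ y ℕ.≡ᵇ 0))

cycleGraph : (n : ℕ) → RawGraph n
cycleGraph n x y = cycSucc n x y ∨ cycSucc n y x

IsCompleteMultipartite : {v : ℕ} → (k : ℕ) → RawGraph v → Set
IsCompleteMultipartite {v} k H =
  Σ (Fin v → Fin k) λ p → (∀ i → ∃ λ x → p x ≡ i) ×
    (∀ x y → H x y ≡ not ⌊ p x ≟ p y ⌋)

ℕtoℚ : ℕ → ℚ
ℕtoℚ k = + k / 1

_^ℚ_ : ℚ → ℕ → ℚ
q ^ℚ zero  = 1ℚ
q ^ℚ suc j = q ℚ.* (q ^ℚ j)

expPartial : ℚ → ℕ → ℚ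
expPartial q zero    = 1ℚ
expPartial q (suc N) =
  expPartial q N ℚ.+ (q ^ℚ suc N) ℚ.* ((+ 1 / (suc N) !) {{suc N !≢0}})

-- for rational q ≥ 0:  q ≤ log k  ⇔  exp q ≤ k  ⇔  ∀ N, expPartial q N ≤ k
BelowLog : ℚ → ℕ → Set
BelowLog q k = 0ℚ ℚ.≤ q × (∀ N → expPartial q N ℚ.≤ ℕtoℚ k)

-- c · (log k)^4 ≤ n, for c, k ≥ 1, expressed through rationals:
-- every rational q with 0 ≤ q ≤ log k satisfies c · q^4 ≤ n
-- (equivalent by density of ℚ, since log k ≥ 0).
LogBound : (c k n : ℕ) → Set
LogBound c k n = ∀ q → BelowLog q k → ℕtoℚ c ℚ.* (q ^ℚ 4) ℚ.≤ ℕtoℚ n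

{-# OPTIONS --safe #-}
module Submission where

-- Upper bound, by induction on the number of parts. Let s be the smallest part other than the one of size at most σ.
-- If some A with |A| ≥ s has |N[A]| < n, use A for that part and delete N[A]. If some set of 3|H| vertices
-- induces only components of size at most s, distribute these components over all parts. Otherwise every set of
-- s vertices expands to n vertices and there is no independent set of B = 3|H| vertices, and C_n is found as follows.
-- Halving the independence number of a ball at most log B times yields a ball Q in which any two typical vertices
-- are joined by a path of length O(log² B) avoiding any prescribed set of O(B log² B) vertices. In Q one builds a cycle
-- out of a path and 2B odd cycles, each of which can be traversed along either of two arcs whose lengths differ by one.
-- The path is lengthened by detours of at most 2B vertices; either the adjustable part hits length n exactly, or
-- almost all of Q gets covered by a cycle of length less than n. In the latter case one vertex at a time is inserted:
-- opening the cycle at two neighbours of an outside vertex gives a path, both of whose ends have many Pósa rotations,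
-- and two of the rotated ends are adjacent because their neighbourhoods contain almost the whole cycle.
-- Lower bound: χ(H) - 1 disjoint cliques on n - 1 vertices and one clique on σ(H) - 1 vertices.

open import Defs
open import Data.Bool using (Bool; true; false; not; _∧_; _∨_; T; if_then_else_)
open import Data.Bool.Properties using (T-≡; ∧-zeroʳ) renaming (_≟_ to _≟ᵇ_)
open import Data.Empty using (⊥; ⊥-elim)
open import Data.Fin using (Fin; inject≤; punchOut; zero; suc; toℕ; fromℕ<)
open import Data.Fin.Properties using (_≟_)
open import Data.List using (List; lookup; tabulate; []; _∷_; _++_; length; reverse; allFin; filter; map; drop)
open import Data.List.Properties using (++-assoc; length-++; length-reverse; reverse-++; length-map; ∷ʳ-injectiveʳ; ∷-injectiveˡ; ∷-injectiveʳ)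
open import Data.Nat using (ℕ; NonZero; nonZero; zero; suc; _+_; _*_; _∸_; _^_; _≤_; _<_; z≤n; s≤s; _≡ᵇ_; _≤ᵇ_; _<ᵇ_; _!)
open import Data.Nat.Properties using (≤-refl; ≤-trans; ≤-reflexive; +-mono-≤; +-monoʳ-≤; +-monoˡ-≤; *-mono-≤; *-monoʳ-≤; *-monoˡ-≤; +-comm; +-assoc; *-comm; *-assoc; *-distribʳ-+; *-distribˡ-+; +-identityʳ; *-identityʳ; *-zeroʳ; m≤m+n; m≤n+m; ≡ᵇ⇒≡; ≡⇒≡ᵇ; ≤ᵇ⇒≤; <ᵇ⇒<; ≰⇒>; <⇒≱; <⇒≤; <-irrefl; <-≤-trans; ≤-<-trans; +-cancelʳ-≤; n≤1+n; n<1+n; <-cmp; suc-injective; m+[n∸m]≡n; m^n>0; _!≢0)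
open import Data.Product using (Σ; ∃; _×_; _,_; proj₁; proj₂; Σ-syntax)
open import Data.Sum using (_⊎_; inj₁; inj₂)
open import Data.Unit using (⊤; tt)
open import Data.Vec using (Vec; []; _∷_)
open import Function using (_∘_; id; case_of_; Equivalence)
open import Relation.Binary.PropositionalEquality using (_≡_; _≢_; refl; sym; trans; cong; cong₂; subst; subst₂)
open import Relation.Nullary using (¬_; Dec; yes; no)
open import Relation.Nullary.Decidable using (_×-dec_; _→-dec_; ⌊_⌋; does)
import Data.Nat.Properties as ℕP
import Data.Fin.Properties as FinP
open import Relation.Binary.Definitions using (tri<; tri≈; tri>)
open import Data.Nat.DivMod using (_/_; _%_; m≡m%n+[m/n]*n; m%n<n; m<n*o⇒m/o<n; m/n*n≤m)
open import Data.Rational as ℚ using (ℚ; 0ℚ; 1ℚ; ½)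
import Data.Rational.Properties as ℚP
import Data.Rational.Unnormalised as ℚᵘ
import Data.Rational.Unnormalised.Properties as ℚᵘP
open import Data.Rational.Solver using (module +-*-Solver)
import Data.Integer as ℤ
import Data.Integer.Properties as ℤP

-- Linear arithmetic over ℕ: the goal follows by adding up the hypotheses, each
-- taken with its multiplicity, and comparing coefficients of monomials.
infixl 8 _:+_
infixl 9 _:*_
infix 7 _≼_ _≺_
infix 3 _⊢_
infixr 6 _⊠_

data Expr : Set where
  var con : ℕ → Expr
  _:+_ _:*_ : Expr → Expr → Expr

record Ineq : Set where
  constructor ineq
  field
    mult : ℕ
    lhs rhs : Expr

_≼_ _≺_ : Expr → Expr → Ineq
a ≼ b = ineq 1 a b
a ≺ b = ineq 1 (con 1 :+ a) b

_⊠_ : ℕ → Ineq → Ineq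
c ⊠ ineq d a b = ineq (c * d) a b

record Problem : Set where
  constructor _⊢_
  field
    hypotheses : List Ineq
    goal : Ineq

Monomial : Set
Monomial = List ℕ

Poly : Set
Poly = List (ℕ × Monomial)

insert : ℕ → Monomial → Monomial
insert i [] = i ∷ []
insert i (j ∷ m) = if i ≤ᵇ j then i ∷ j ∷ m else j ∷ insert i m

mulM : Monomial → Monomial → Monomial
mulM [] m = m
mulM (i ∷ l) m = insert i (mulM l m)

eqM : Monomial → Monomial → Bool
eqM [] [] = true
eqM (i ∷ l) (j ∷ m) = (i ≡ᵇ j) ∧ eqM l m
eqM _ _ = false

addT : ℕ × Monomial → Poly → Poly
addT t [] = t ∷ []
addT (c , m) ((d , l) ∷ p) = if eqM m l then (c + d , l) ∷ p else (d , l) ∷ addT (c , m) p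

addP : Poly → Poly → Poly
addP [] q = q
addP (t ∷ p) q = addT t (addP p q)

mulT : ℕ × Monomial → Poly → Poly
mulT t [] = []
mulT (c , m) ((d , l) ∷ p) = addT (c * d , mulM m l) (mulT (c , m) p)

mulP : Poly → Poly → Poly
mulP [] q = []
mulP (t ∷ p) q = addP (mulT t q) (mulP p q)

norm : Expr → Poly
norm (var i) = (1 , i ∷ []) ∷ []
norm (con c) = (c , []) ∷ []
norm (a :+ b) = addP (norm a) (norm b)
norm (a :* b) = mulP (norm a) (norm b)

coeff : Monomial → Poly → ℕ × Poly
coeff m [] = 0 , []
coeff m ((d , l) ∷ p) = if eqM m l then (d , p) else (proj₁ (coeff m p) , (d , l) ∷ proj₂ (coeff m p))

leP : Poly → Poly → Bool
leP [] q = true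
leP ((c , m) ∷ p) q = (c ≤ᵇ proj₁ (coeff m q)) ∧ leP p (proj₂ (coeff m q))

lowers uppers : List Ineq → Poly
lowers [] = []
lowers (ineq c a b ∷ hs) = addP (mulT (c , []) (norm a)) (lowers hs)
uppers [] = []
uppers (ineq c a b ∷ hs) = addP (mulT (c , []) (norm b)) (uppers hs)

check : Problem → Bool
check (hs ⊢ ineq _ a b) = leP (addP (norm a) (uppers hs)) (addP (norm b) (lowers hs))

lookupℕ : ∀ {n} → Vec ℕ n → ℕ → ℕ
lookupℕ [] _ = 0
lookupℕ (x ∷ ρ) zero = x
lookupℕ (x ∷ ρ) (suc i) = lookupℕ ρ i

module Semantics {n : ℕ} (ρ : Vec ℕ n) where

  ⟦_⟧ : Expr → ℕ
  ⟦ var i ⟧ = lookupℕ ρ i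
  ⟦ con c ⟧ = c
  ⟦ a :+ b ⟧ = ⟦ a ⟧ + ⟦ b ⟧
  ⟦ a :* b ⟧ = ⟦ a ⟧ * ⟦ b ⟧

  ⟦_⟧ᴵ : Ineq → Set
  ⟦ ineq _ a b ⟧ᴵ = ⟦ a ⟧ ≤ ⟦ b ⟧

  ⟦_⟧ᴴ : List Ineq → Set
  ⟦ [] ⟧ᴴ = ⊤
  ⟦ h ∷ hs ⟧ᴴ = ⟦ h ⟧ᴵ × ⟦ hs ⟧ᴴ

  ⟦_⟧ᴹ : Monomial → ℕ
  ⟦ [] ⟧ᴹ = 1
  ⟦ i ∷ m ⟧ᴹ = lookupℕ ρ i * ⟦ m ⟧ᴹ

  ⟦_⟧ᴾ : Poly → ℕ
  ⟦ [] ⟧ᴾ = 0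
  ⟦ (c , m) ∷ p ⟧ᴾ = c * ⟦ m ⟧ᴹ + ⟦ p ⟧ᴾ

  private
    swap* : ∀ a b c → a * (b * c) ≡ b * (a * c)
    swap* a b c = trans (sym (*-assoc a b c)) (trans (cong (_* c) (*-comm a b)) (*-assoc b a c))

    swap+ : ∀ a b c → a + (b + c) ≡ b + (a + c)
    swap+ a b c = trans (sym (+-assoc a b c)) (trans (cong (_+ c) (+-comm a b)) (+-assoc b a c))

  insert-sound : ∀ i m → ⟦ insert i m ⟧ᴹ ≡ lookupℕ ρ i * ⟦ m ⟧ᴹ
  insert-sound i [] = refl
  insert-sound i (j ∷ m) with i ≤ᵇ j
  ... | true = refl
  ... | false = trans (cong (lookupℕ ρ j *_) (insert-sound i m)) (swap* (lookupℕ ρ j) (lookupℕ ρ i) _)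

  mulM-sound : ∀ l m → ⟦ mulM l m ⟧ᴹ ≡ ⟦ l ⟧ᴹ * ⟦ m ⟧ᴹ
  mulM-sound [] m = sym (+-identityʳ _)
  mulM-sound (i ∷ l) m = trans (insert-sound i (mulM l m))
    (trans (cong (lookupℕ ρ i *_) (mulM-sound l m)) (sym (*-assoc (lookupℕ ρ i) _ _)))

  eqM-sound : ∀ l m → T (eqM l m) → l ≡ m
  eqM-sound [] [] _ = refl
  eqM-sound (i ∷ l) (j ∷ m) t with i ≡ᵇ j in e
  ... | true = cong₂ _∷_ (≡ᵇ⇒≡ i j (subst T (sym e) tt)) (eqM-sound l m t)

  addT-sound : ∀ t p → ⟦ addT t p ⟧ᴾ ≡ ⟦ t ∷ p ⟧ᴾ
  addT-sound t [] = refl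
  addT-sound (c , m) ((d , l) ∷ p) with eqM m l in e
  ... | true rewrite eqM-sound m l (subst T (sym e) tt) =
        trans (cong (_+ ⟦ p ⟧ᴾ) (*-distribʳ-+ ⟦ l ⟧ᴹ c d)) (+-assoc (c * ⟦ l ⟧ᴹ) _ _)
  ... | false = trans (cong (d * ⟦ l ⟧ᴹ +_) (addT-sound (c , m) p)) (swap+ (d * ⟦ l ⟧ᴹ) (c * ⟦ m ⟧ᴹ) _)

  addP-sound : ∀ p q → ⟦ addP p q ⟧ᴾ ≡ ⟦ p ⟧ᴾ + ⟦ q ⟧ᴾ
  addP-sound [] q = refl
  addP-sound ((c , m) ∷ p) q = trans (addT-sound (c , m) (addP p q))
    (trans (cong (c * ⟦ m ⟧ᴹ +_) (addP-sound p q)) (sym (+-assoc (c * ⟦ m ⟧ᴹ) _ _)))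

  mulT-sound : ∀ c m p → ⟦ mulT (c , m) p ⟧ᴾ ≡ c * ⟦ m ⟧ᴹ * ⟦ p ⟧ᴾ
  mulT-sound c m [] = sym (*-zeroʳ (c * ⟦ m ⟧ᴹ))
  mulT-sound c m ((d , l) ∷ p) = trans (addT-sound (c * d , mulM m l) (mulT (c , m) p))
    (trans (cong₂ _+_ eq (mulT-sound c m p)) (sym (*-distribˡ-+ (c * ⟦ m ⟧ᴹ) _ _)))
    where
    eq : c * d * ⟦ mulM m l ⟧ᴹ ≡ c * ⟦ m ⟧ᴹ * (d * ⟦ l ⟧ᴹ)
    eq = trans (cong (c * d *_) (mulM-sound m l)) (trans (*-assoc c d _)
      (trans (cong (c *_) (swap* d ⟦ m ⟧ᴹ ⟦ l ⟧ᴹ)) (sym (*-assoc c ⟦ m ⟧ᴹ _))))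

  mulP-sound : ∀ p q → ⟦ mulP p q ⟧ᴾ ≡ ⟦ p ⟧ᴾ * ⟦ q ⟧ᴾ
  mulP-sound [] q = refl
  mulP-sound ((c , m) ∷ p) q = trans (addP-sound (mulT (c , m) q) (mulP p q))
    (trans (cong₂ _+_ (mulT-sound c m q) (mulP-sound p q)) (sym (*-distribʳ-+ ⟦ q ⟧ᴾ (c * ⟦ m ⟧ᴹ) _)))

  norm-sound : ∀ a → ⟦ norm a ⟧ᴾ ≡ ⟦ a ⟧
  norm-sound (var i) = trans (+-identityʳ _) (trans (+-identityʳ _) (*-identityʳ _))
  norm-sound (con c) = trans (+-identityʳ _) (*-identityʳ c)
  norm-sound (a :+ b) = trans (addP-sound (norm a) (norm b)) (cong₂ _+_ (norm-sound a) (norm-sound b))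
  norm-sound (a :* b) = trans (mulP-sound (norm a) (norm b)) (cong₂ _*_ (norm-sound a) (norm-sound b))

  coeff-sound : ∀ m p → ⟦ p ⟧ᴾ ≡ proj₁ (coeff m p) * ⟦ m ⟧ᴹ + ⟦ proj₂ (coeff m p) ⟧ᴾ
  coeff-sound m [] = refl
  coeff-sound m ((d , l) ∷ p) with eqM m l in e
  ... | true rewrite eqM-sound m l (subst T (sym e) tt) = refl
  ... | false = trans (cong (d * ⟦ l ⟧ᴹ +_) (coeff-sound m p)) (swap+ (d * ⟦ l ⟧ᴹ) (proj₁ (coeff m p) * ⟦ m ⟧ᴹ) _)

  leP-sound : ∀ p q → T (leP p q) → ⟦ p ⟧ᴾ ≤ ⟦ q ⟧ᴾ
  leP-sound [] q _ = z≤n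
  leP-sound ((c , m) ∷ p) q t with c ≤ᵇ proj₁ (coeff m q) in e
  ... | true = ≤-trans (+-mono-≤ (*-monoˡ-≤ ⟦ m ⟧ᴹ (≤ᵇ⇒≤ c _ (subst T (sym e) tt))) (leP-sound p _ t))
                 (≤-reflexive (sym (coeff-sound m q)))

  term-sound : ∀ c a → ⟦ mulT (c , []) (norm a) ⟧ᴾ ≡ c * ⟦ a ⟧
  term-sound c a = trans (mulT-sound c [] (norm a)) (cong₂ _*_ (*-identityʳ c) (norm-sound a))

  hypotheses-sound : ∀ hs → ⟦ hs ⟧ᴴ → ⟦ lowers hs ⟧ᴾ ≤ ⟦ uppers hs ⟧ᴾ
  hypotheses-sound [] _ = z≤n
  hypotheses-sound (ineq c a b ∷ hs) (h , p)
    rewrite addP-sound (mulT (c , []) (norm a)) (lowers hs) | addP-sound (mulT (c , []) (norm b)) (uppers hs)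
          | term-sound c a | term-sound c b
    = +-mono-≤ (*-monoʳ-≤ c h) (hypotheses-sound hs p)

  sound : ∀ P → T (check P) → ⟦ Problem.hypotheses P ⟧ᴴ → ⟦ Problem.goal P ⟧ᴵ
  sound (hs ⊢ ineq _ a b) t p = +-cancelʳ-≤ ⟦ uppers hs ⟧ᴾ ⟦ a ⟧ ⟦ b ⟧
    (≤-trans (≤-reflexive (sym (eq a (uppers hs))))
      (≤-trans (leP-sound (addP (norm a) (uppers hs)) (addP (norm b) (lowers hs)) t)
        (≤-trans (≤-reflexive (eq b (lowers hs))) (+-monoʳ-≤ ⟦ b ⟧ (hypotheses-sound hs p)))))
    where
    eq : ∀ a p → ⟦ addP (norm a) p ⟧ᴾ ≡ ⟦ a ⟧ + ⟦ p ⟧ᴾ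
    eq a p = trans (addP-sound (norm a) p) (cong (_+ ⟦ p ⟧ᴾ) (norm-sound a))

Curried : ℕ → Set
Curried zero = Problem
Curried (suc n) = Expr → Curried n

applyVars : ∀ n → ℕ → Curried n → Problem
applyVars zero i P = P
applyVars (suc n) i f = applyVars n (suc i) (f (var i))

lin : ∀ {n} (ρ : Vec ℕ n) (f : Curried n) → let P = applyVars n 0 f in
      {_ : T (check P)} → Semantics.⟦_⟧ᴴ ρ (Problem.hypotheses P) → Semantics.⟦_⟧ᴵ ρ (Problem.goal P)
lin {n} ρ f {t} = Semantics.sound ρ (applyVars n 0 f) t

-- Double negation as a monad: classical reasoning towards a decidable conclusion.
∥_∥ : Set → Set
∥ A ∥ = ¬ ¬ A

return : {A : Set} → A → ∥ A ∥
return a k = k a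

infixl 1 _>>=_
_>>=_ : {A B : Set} → ∥ A ∥ → (A → ∥ B ∥) → ∥ B ∥
(m >>= f) k = m λ a → f a k

lem : (P : Set) → ∥ P ⊎ ¬ P ∥
lem P k = k (inj₂ λ p → k (inj₁ p))

byContra : {A : Set} → (¬ A → ∥ ⊥ ∥) → ∥ A ∥
byContra f k = f k id

≤? : ∀ m n → m ≤ n ⊎ n < m
≤? m n = decide (m ℕP.≤? n)
  where
  decide : Dec (m ≤ n) → m ≤ n ⊎ n < m
  decide (yes p) = inj₁ p
  decide (no p) = inj₂ (≰⇒> p)

-- Finite sets of vertices

FSet : ℕ → Set
FSet N = Fin N → Bool

infix 4 _∈_ _∉_ _⊆_
infixl 6 _∪_
infixl 7 _∩_ _∖_

record _∈_ {N : ℕ} (x : Fin N) (A : FSet N) : Set where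
  constructor mem
  field
    holds : A x ≡ true
open _∈_ public

_∉_ : {N : ℕ} (x : Fin N) (A : FSet N) → Set
x ∉ A = ¬ x ∈ A

_⊆_ : {N : ℕ} (A B : FSet N) → Set
A ⊆ B = ∀ x → x ∈ A → x ∈ B

Disjoint : {N : ℕ} (A B : FSet N) → Set
Disjoint A B = ∀ x → x ∈ A → x ∉ B

opaque

  _∪_ _∩_ _∖_ : {N : ℕ} → FSet N → FSet N → FSet N
  (A ∪ B) x = A x ∨ B x
  (A ∩ B) x = A x ∧ B x
  (A ∖ B) x = A x ∧ not (B x)

  ∁ : {N : ℕ} → FSet N → FSet N
  ∁ A x = not (A x)

  ∅ full : {N : ℕ} → FSet N
  ∅ _ = false
  full _ = true

  ⁅_⁆ : {N : ℕ} → Fin N → FSet N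
  ⁅ v ⁆ x = does (v ≟ x)

∈? : {N : ℕ} {x : Fin N} (A : FSet N) → x ∈ A ⊎ x ∉ A
∈? {x = x} A with A x in e
... | true = inj₁ (mem e)
... | false = inj₂ λ p → case trans (sym e) (holds p) of λ ()

opaque
  unfolding _∪_

  ∪ˡ : {N : ℕ} {x : Fin N} {A B : FSet N} → x ∈ A → x ∈ A ∪ B
  ∪ˡ {x = x} {A} {B} (mem p) = mem (cong (_∨ B x) p)

  ∪ʳ : {N : ℕ} {x : Fin N} {A B : FSet N} → x ∈ B → x ∈ A ∪ B
  ∪ʳ {x = x} {A} {B} (mem p) with A x in e
  ... | true = mem (cong (_∨ B x) e)
  ... | false = mem (trans (cong (_∨ B x) e) p)

  ∪⁻ : {N : ℕ} {x : Fin N} {A B : FSet N} → x ∈ A ∪ B → x ∈ A ⊎ x ∈ B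
  ∪⁻ {x = x} {A} {B} (mem p) with A x in e
  ... | true = inj₁ (mem e)
  ... | false = inj₂ (mem p)

  ∩⁺ : {N : ℕ} {x : Fin N} {A B : FSet N} → x ∈ A → x ∈ B → x ∈ A ∩ B
  ∩⁺ (mem p) (mem q) = mem (cong₂ _∧_ p q)

  ∩ˡ : {N : ℕ} {x : Fin N} {A B : FSet N} → x ∈ A ∩ B → x ∈ A
  ∩ˡ {x = x} {A} {B} (mem p) with A x in e
  ... | true = mem e

  ∩ʳ : {N : ℕ} {x : Fin N} {A B : FSet N} → x ∈ A ∩ B → x ∈ B
  ∩ʳ {x = x} {A} {B} (mem p) with A x
  ... | true = mem p

  ∁⁺ : {N : ℕ} {x : Fin N} {A : FSet N} → x ∉ A → x ∈ ∁ A
  ∁⁺ {x = x} {A} p with A x in e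
  ... | true = ⊥-elim (p (mem e))
  ... | false = mem (cong not e)

  ∁⁻ : {N : ℕ} {x : Fin N} {A : FSet N} → x ∈ ∁ A → x ∉ A
  ∁⁻ {x = x} {A} (mem p) (mem q) with A x
  ∁⁻ {x = x} {A} (mem ()) (mem q) | true

  ∖⁺ : {N : ℕ} {x : Fin N} {A B : FSet N} → x ∈ A → x ∉ B → x ∈ A ∖ B
  ∖⁺ p q = mem (cong₂ _∧_ (holds p) (holds (∁⁺ q)))

  ∖ˡ : {N : ℕ} {x : Fin N} {A B : FSet N} → x ∈ A ∖ B → x ∈ A
  ∖ˡ {x = x} {A} {B} (mem p) with A x in e
  ... | true = mem e

  ∖ʳ : {N : ℕ} {x : Fin N} {A B : FSet N} → x ∈ A ∖ B → x ∉ B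
  ∖ʳ {x = x} {A} {B} (mem p) (mem q) with A x | B x
  ∖ʳ {x = x} {A} {B} (mem ()) (mem q) | true | true
  ∖ʳ {x = x} {A} {B} (mem ()) (mem q) | false | _

  ∈-full : {N : ℕ} {x : Fin N} → x ∈ full
  ∈-full = mem refl

  ∉∅ : {N : ℕ} {x : Fin N} → x ∉ ∅
  ∉∅ (mem ())

  ∈⁅⁆ : {N : ℕ} {x : Fin N} → x ∈ ⁅ x ⁆
  ∈⁅⁆ {x = x} with x ≟ x in e
  ... | yes _ = mem (cong does e)
  ... | no p = ⊥-elim (p refl)

  ∈⁅⁆⁻ : {N : ℕ} {v x : Fin N} → x ∈ ⁅ v ⁆ → v ≡ x
  ∈⁅⁆⁻ {v = v} {x} (mem p) with v ≟ x
  ... | yes e = e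

∪-least : {N : ℕ} {A B C : FSet N} → A ⊆ C → B ⊆ C → A ∪ B ⊆ C
∪-least p q x xi with ∪⁻ xi
... | inj₁ xa = p x xa
... | inj₂ xb = q x xb

Comprehends : {N : ℕ} → FSet N → (Fin N → Set) → Set
Comprehends A P = ∀ x → (x ∈ A → P x) × (P x → x ∈ A)

comprehension : {N : ℕ} (P : Fin N → Set) → ∥ Σ[ A ∈ FSet N ] Comprehends A P ∥
comprehension {zero} P = return ((λ ()) , λ ())
comprehension {suc N} P = do
  A , f ← comprehension (P ∘ suc)
  d ← lem (P zero)
  return (extend A f d)
  where
  extend : ∀ A → Comprehends A (P ∘ suc) → P zero ⊎ ¬ P zero → Σ[ A ∈ FSet (suc N) ] Comprehends A P
  extend A f d = B d , g d
    where
    B : P zero ⊎ ¬ P zero → FSet (suc N)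
    B (inj₁ _) zero = true
    B (inj₂ _) zero = false
    B _ (suc x) = A x
    g : ∀ d → Comprehends (B d) P
    g (inj₁ p) zero = (λ _ → p) , λ _ → mem refl
    g (inj₂ p) zero = (λ ()) , λ q → ⊥-elim (p q)
    g (inj₁ p) (suc x) = (λ q → proj₁ (f x) (mem (holds q))) , λ q → mem (holds (proj₂ (f x) q))
    g (inj₂ p) (suc x) = (λ q → proj₁ (f x) (mem (holds q))) , λ q → mem (holds (proj₂ (f x) q))

bit : Bool → ℕ
bit true = 1
bit false = 0

opaque

  # : {N : ℕ} → FSet N → ℕ
  # {zero} A = 0
  # {suc N} A = bit (A zero) + # (A ∘ suc)

interchange : ∀ a b c d → a + b + (c + d) ≡ a + c + (b + d)
interchange a b c d = trans (+-assoc a b _) (trans (cong (a +_) (trans (sym (+-assoc b c d))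
  (trans (cong (_+ d) (+-comm b c)) (+-assoc c b d)))) (sym (+-assoc a c _)))

opaque
  unfolding #

  #-⊆+ : {N : ℕ} (A B C : FSet N) → (∀ x → x ∈ A → x ∈ B ⊎ x ∈ C) → # A ≤ # B + # C
  #-⊆+ {zero} A B C f = z≤n
  #-⊆+ {suc N} A B C f = ≤-trans (+-mono-≤ head (#-⊆+ (A ∘ suc) (B ∘ suc) (C ∘ suc) tail))
    (≤-reflexive (interchange (bit (B zero)) (bit (C zero)) (# (B ∘ suc)) (# (C ∘ suc))))
    where
    head : bit (A zero) ≤ bit (B zero) + bit (C zero)
    head with A zero in e
    ... | false = z≤n
    ... | true with f zero (mem e)
    ... | inj₁ (mem q) rewrite q = s≤s z≤n
    ... | inj₂ (mem q) rewrite q = m≤n+m 1 (bit (B zero))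
    tail : ∀ x → x ∈ A ∘ suc → x ∈ B ∘ suc ⊎ x ∈ C ∘ suc
    tail x (mem p) with f (suc x) (mem p)
    ... | inj₁ (mem q) = inj₁ (mem q)
    ... | inj₂ (mem q) = inj₂ (mem q)

opaque
  unfolding _∪_ #

  #-∅ : {N : ℕ} → # {N} ∅ ≡ 0
  #-∅ {zero} = refl
  #-∅ {suc N} = #-∅ {N}

opaque
  unfolding _∪_ #

  #-full : {N : ℕ} → # {N} full ≡ N
  #-full {zero} = refl
  #-full {suc N} = cong suc (#-full {N})

#-mono : {N : ℕ} {A B : FSet N} → A ⊆ B → # A ≤ # B
#-mono {N} {A} {B} f = ≤-trans (#-⊆+ A B ∅ λ x p → inj₁ (f x p)) (≤-reflexive (trans (cong (# B +_) (#-∅ {N})) (+-identityʳ _)))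

#-∪ : {N : ℕ} (A B : FSet N) → # (A ∪ B) ≤ # A + # B
#-∪ A B = #-⊆+ (A ∪ B) A B λ x → ∪⁻

#-≤+∖ : {N : ℕ} (A B : FSet N) → # A ≤ # B + # (A ∖ B)
#-≤+∖ A B = #-⊆+ A B (A ∖ B) λ x p → split x p (∈? B)
  where
  split : ∀ x → x ∈ A → x ∈ B ⊎ x ∉ B → x ∈ B ⊎ x ∈ A ∖ B
  split x p (inj₁ q) = inj₁ q
  split x p (inj₂ q) = inj₂ (∖⁺ p q)

opaque
  unfolding #

  #-disjoint : {N : ℕ} (A B C : FSet N) → Disjoint A B → A ⊆ C → B ⊆ C → # A + # B ≤ # C
  #-disjoint {zero} A B C d f g = z≤n
  #-disjoint {suc N} A B C d f g = ≤-trans (≤-reflexive (interchange (bit (A zero)) (# (A ∘ suc)) (bit (B zero)) _))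
    (+-mono-≤ head (#-disjoint (A ∘ suc) (B ∘ suc) (C ∘ suc) (λ x p q → d (suc x) (mem (holds p)) (mem (holds q)))
      (λ x p → mem (holds (f (suc x) (mem (holds p))))) (λ x p → mem (holds (g (suc x) (mem (holds p)))))))
    where
    head : bit (A zero) + bit (B zero) ≤ bit (C zero)
    head with A zero in e | B zero in e′
    ... | true | true = ⊥-elim (d zero (mem e) (mem e′))
    ... | true | false rewrite holds (f zero (mem e)) = s≤s z≤n
    ... | false | true rewrite holds (g zero (mem e′)) = s≤s z≤n
    ... | false | false = z≤n

opaque
  unfolding #

  #-witness : {N : ℕ} (A : FSet N) → 0 < # A → Σ[ x ∈ Fin N ] x ∈ A
  #-witness {suc N} A p with A zero in e
  ... | true = zero , mem e
  ... | false with #-witness (A ∘ suc) p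
  ... | x , mem q = suc x , mem q

opaque
  unfolding #

  #-pos : {N : ℕ} {A : FSet N} {x : Fin N} → x ∈ A → 0 < # A
  #-pos {suc N} {A} {zero} (mem p) rewrite p = s≤s z≤n
  #-pos {suc N} {A} {suc x} (mem p) = ≤-trans (#-pos {N} {A ∘ suc} (mem p)) (m≤n+m _ (bit (A zero)))

#-pick : {N : ℕ} (A B : FSet N) → # B < # A → Σ[ x ∈ Fin N ] x ∈ A × x ∉ B
#-pick A B h with #-witness (A ∖ B) (+-cancel (≤-trans h (#-≤+∖ A B)))
  where
  +-cancel : ∀ {a b} → a < a + b → 0 < b
  +-cancel {zero} p = p
  +-cancel {suc a} (s≤s p) = +-cancel p
... | x , p = x , ∖ˡ p , ∖ʳ p

opaque
  unfolding _∪_ #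

  #-⁅⁆ : {N : ℕ} (v : Fin N) → # ⁅ v ⁆ ≤ 1
  #-⁅⁆ {suc N} zero = s≤s (≤-reflexive (#-∅ {N}))
  #-⁅⁆ {suc N} (suc v) = #-⁅⁆ v

-- Lists of vertices, counted with multiplicity

module _ {N : ℕ} where

  cnt : Fin N → List (Fin N) → ℕ
  cnt x [] = 0
  cnt x (y ∷ ys) = bit (does (y ≟ x)) + cnt x ys

  Uniq : List (Fin N) → Set
  Uniq xs = ∀ x → cnt x xs ≤ 1

  opaque

    ⟪_⟫ : List (Fin N) → FSet N
    ⟪ [] ⟫ = ∅
    ⟪ y ∷ ys ⟫ = ⁅ y ⁆ ∪ ⟪ ys ⟫

    ∉[] : ∀ {x} → x ∉ ⟪ [] ⟫
    ∉[] = ∉∅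

    ∈-head : ∀ {x ys} → x ∈ ⟪ x ∷ ys ⟫
    ∈-head = ∪ˡ ∈⁅⁆

    ∈-tail : ∀ {x y ys} → x ∈ ⟪ ys ⟫ → x ∈ ⟪ y ∷ ys ⟫
    ∈-tail = ∪ʳ

    ∈-∷⁻ : ∀ {x y ys} → x ∈ ⟪ y ∷ ys ⟫ → y ≡ x ⊎ x ∈ ⟪ ys ⟫
    ∈-∷⁻ p with ∪⁻ p
    ... | inj₁ q = inj₁ (∈⁅⁆⁻ q)
    ... | inj₂ q = inj₂ q

  cin : FSet N → List (Fin N) → ℕ
  cin A [] = 0
  cin A (x ∷ xs) = bit (A x) + cin A xs

  cnt-self : ∀ x ys → 1 ≤ cnt x (x ∷ ys)
  cnt-self x ys with x ≟ x
  ... | yes _ = s≤s z≤n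
  ... | no p = ⊥-elim (p refl)

  cnt-++ : ∀ x xs ys → cnt x (xs ++ ys) ≡ cnt x xs + cnt x ys
  cnt-++ x [] ys = refl
  cnt-++ x (y ∷ xs) ys = trans (cong (bit (does (y ≟ x)) +_) (cnt-++ x xs ys)) (sym (+-assoc (bit (does (y ≟ x))) _ _))

  reverse-∷ : ∀ (y : Fin N) ys → reverse (y ∷ ys) ≡ reverse ys ++ y ∷ []
  reverse-∷ y ys = reverse-++ (y ∷ []) ys

  cnt-reverse : ∀ x xs → cnt x (reverse xs) ≡ cnt x xs
  cnt-reverse x [] = refl
  cnt-reverse x (y ∷ xs) = trans (cong (cnt x) (reverse-∷ y xs)) (trans (cnt-++ x (reverse xs) (y ∷ []))
    (trans (cong₂ _+_ (cnt-reverse x xs) (+-identityʳ _)) (+-comm (cnt x xs) _)))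

  cin-++ : ∀ A xs ys → cin A (xs ++ ys) ≡ cin A xs + cin A ys
  cin-++ A [] ys = refl
  cin-++ A (y ∷ xs) ys = trans (cong (bit (A y) +_) (cin-++ A xs ys)) (sym (+-assoc (bit (A y)) _ _))

  cin-reverse : ∀ A xs → cin A (reverse xs) ≡ cin A xs
  cin-reverse A [] = refl
  cin-reverse A (y ∷ xs) = trans (cong (cin A) (reverse-∷ y xs)) (trans (cin-++ A (reverse xs) (y ∷ []))
    (trans (cong₂ _+_ (cin-reverse A xs) (+-identityʳ _)) (+-comm (cin A xs) _)))

  cnt≡cin : ∀ x l → cnt x l ≡ cin (λ y → does (y ≟ x)) l
  cnt≡cin x [] = refl
  cnt≡cin x (y ∷ l) = cong (bit (does (y ≟ x)) +_) (cnt≡cin x l)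

  opaque
    unfolding full

    cin-full : ∀ xs → cin full xs ≡ length xs
    cin-full [] = refl
    cin-full (x ∷ xs) = cong suc (cin-full xs)

  ∈⟪⟫⇒cnt : ∀ {x} xs → x ∈ ⟪ xs ⟫ → 1 ≤ cnt x xs
  ∈⟪⟫⇒cnt [] p = ⊥-elim (∉[] p)
  ∈⟪⟫⇒cnt {x} (y ∷ ys) p with ∈-∷⁻ p
  ... | inj₁ refl = cnt-self x ys
  ... | inj₂ q = ≤-trans (∈⟪⟫⇒cnt ys q) (m≤n+m _ _)

  cnt⇒∈⟪⟫ : ∀ {x} xs → 1 ≤ cnt x xs → x ∈ ⟪ xs ⟫
  cnt⇒∈⟪⟫ {x} (y ∷ ys) p with y ≟ x
  ... | yes refl = ∈-head
  ... | no _ = ∈-tail (cnt⇒∈⟪⟫ ys p)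

  ∈-++ˡ : ∀ {x} xs {ys} → x ∈ ⟪ xs ⟫ → x ∈ ⟪ xs ++ ys ⟫
  ∈-++ˡ {x} xs {ys} p = cnt⇒∈⟪⟫ (xs ++ ys) (≤-trans (≤-trans (∈⟪⟫⇒cnt xs p) (m≤m+n _ _)) (≤-reflexive (sym (cnt-++ x xs ys))))

  ∈-++ʳ : ∀ {x} xs {ys} → x ∈ ⟪ ys ⟫ → x ∈ ⟪ xs ++ ys ⟫
  ∈-++ʳ {x} xs {ys} p = cnt⇒∈⟪⟫ (xs ++ ys) (≤-trans (≤-trans (∈⟪⟫⇒cnt ys p) (m≤n+m _ _)) (≤-reflexive (sym (cnt-++ x xs ys))))

  ∈-++⁻ : ∀ {x} xs {ys} → x ∈ ⟪ xs ++ ys ⟫ → x ∈ ⟪ xs ⟫ ⊎ x ∈ ⟪ ys ⟫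
  ∈-++⁻ [] p = inj₂ p
  ∈-++⁻ (y ∷ xs) p with ∈-∷⁻ p
  ... | inj₁ refl = inj₁ ∈-head
  ... | inj₂ q with ∈-++⁻ xs q
  ... | inj₁ r = inj₁ (∈-tail r)
  ... | inj₂ r = inj₂ r

  ∈-split : ∀ {x} xs → x ∈ ⟪ xs ⟫ → Σ[ as ∈ List (Fin N) ] Σ[ bs ∈ List (Fin N) ] xs ≡ as ++ x ∷ bs
  ∈-split [] p = ⊥-elim (∉[] p)
  ∈-split (y ∷ xs) p with ∈-∷⁻ p
  ... | inj₁ refl = [] , xs , refl
  ... | inj₂ q with ∈-split xs q
  ... | as , bs , e = y ∷ as , bs , cong (y ∷_) e

  opaque
    unfolding ⟪_⟫

    #⟪⟫ : ∀ xs → # ⟪ xs ⟫ ≤ length xs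
    #⟪⟫ [] = ≤-reflexive (#-∅ {N})
    #⟪⟫ (x ∷ xs) = ≤-trans (#-∪ ⁅ x ⁆ ⟪ xs ⟫) (+-mono-≤ (#-⁅⁆ x) (#⟪⟫ xs))

  ∉⇒cnt0 : ∀ {x} xs → x ∉ ⟪ xs ⟫ → cnt x xs ≤ 0
  ∉⇒cnt0 {x} xs p with ≤? (cnt x xs) 0
  ... | inj₁ h = h
  ... | inj₂ h = ⊥-elim (p (cnt⇒∈⟪⟫ xs h))

  uniq-tail : ∀ x xs → Uniq (x ∷ xs) → Uniq xs
  uniq-tail x xs u y = ≤-trans (m≤n+m _ _) (u y)

  uniq-head : ∀ x xs → Uniq (x ∷ xs) → x ∉ ⟪ xs ⟫
  uniq-head x xs u p = case ≤-trans (+-mono-≤ self (∈⟪⟫⇒cnt xs p)) (u x) of λ { (s≤s ()) }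
    where
    self : 1 ≤ bit (does (x ≟ x))
    self = ≤-trans (cnt-self x []) (≤-reflexive (+-identityʳ _))

  uniq-∷ : ∀ x xs → x ∉ ⟪ xs ⟫ → Uniq xs → Uniq (x ∷ xs)
  uniq-∷ x xs p u y with x ≟ y
  ... | yes refl = s≤s (∉⇒cnt0 xs p)
  ... | no _ = u y

  uniq-[] : Uniq []
  uniq-[] x = z≤n

  uniq-[-] : ∀ x → Uniq (x ∷ [])
  uniq-[-] x = uniq-∷ x [] ∉[] uniq-[]

  uniq-++ : ∀ xs ys → Uniq xs → Uniq ys → Disjoint ⟪ xs ⟫ ⟪ ys ⟫ → Uniq (xs ++ ys)
  uniq-++ xs ys u v d x with ∈? {x = x} ⟪ xs ⟫
  ... | inj₁ p = lin (cnt x (xs ++ ys) ∷ cnt x xs ∷ cnt x ys ∷ []) (λ a b c → a ≼ b :+ c ∷ b ≼ con 1 ∷ c ≼ con 0 ∷ [] ⊢ a ≼ con 1)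
        (≤-reflexive (cnt-++ x xs ys) , u x , ∉⇒cnt0 ys (d x p) , tt)
  ... | inj₂ p = lin (cnt x (xs ++ ys) ∷ cnt x xs ∷ cnt x ys ∷ []) (λ a b c → a ≼ b :+ c ∷ b ≼ con 0 ∷ c ≼ con 1 ∷ [] ⊢ a ≼ con 1)
        (≤-reflexive (cnt-++ x xs ys) , ∉⇒cnt0 xs p , v x , tt)

  uniq-++ˡ : ∀ xs ys → Uniq (xs ++ ys) → Uniq xs
  uniq-++ˡ xs ys u x = ≤-trans (≤-trans (m≤m+n _ _) (≤-reflexive (sym (cnt-++ x xs ys)))) (u x)

  uniq-++ʳ : ∀ xs ys → Uniq (xs ++ ys) → Uniq ys
  uniq-++ʳ xs ys u x = ≤-trans (≤-trans (m≤n+m _ _) (≤-reflexive (sym (cnt-++ x xs ys)))) (u x)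

  uniq-disjoint : ∀ xs ys → Uniq (xs ++ ys) → Disjoint ⟪ xs ⟫ ⟪ ys ⟫
  uniq-disjoint xs ys u x p q = case ≤-trans (+-mono-≤ (∈⟪⟫⇒cnt xs p) (∈⟪⟫⇒cnt ys q)) (≤-trans (≤-reflexive (sym (cnt-++ x xs ys))) (u x)) of λ { (s≤s ()) }

  uniq-reverse : ∀ xs → Uniq xs → Uniq (reverse xs)
  uniq-reverse xs u x = ≤-trans (≤-reflexive (cnt-reverse x xs)) (u x)

  ∈-reverse⁻ : ∀ {x} xs → x ∈ ⟪ reverse xs ⟫ → x ∈ ⟪ xs ⟫
  ∈-reverse⁻ {x} xs p = cnt⇒∈⟪⟫ xs (≤-trans (∈⟪⟫⇒cnt (reverse xs) p) (≤-reflexive (cnt-reverse x xs)))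

  cin-mono : ∀ {A B} xs → (∀ x → x ∈ ⟪ xs ⟫ → x ∈ A → x ∈ B) → cin A xs ≤ cin B xs
  cin-mono [] f = z≤n
  cin-mono {A} {B} (x ∷ xs) f = +-mono-≤ head (cin-mono xs λ y p → f y (∈-tail p))
    where
    head : bit (A x) ≤ bit (B x)
    head with A x in e
    ... | false = z≤n
    ... | true rewrite holds (f x ∈-head (mem e)) = ≤-refl

  cin-≤# : ∀ A xs → Uniq xs → cin A xs ≤ # A
  cin-≤# A [] u = z≤n
  cin-≤# A (x ∷ xs) u with A x in e
  ... | false = cin-≤# A xs (uniq-tail x xs u)
  ... | true = ≤-trans (+-mono-≤ (#-pos {x = x} ∈⁅⁆) (≤-trans
          (cin-mono xs λ y p q → ∖⁺ {B = ⁅ x ⁆} q λ r → uniq-head x xs u (subst (_∈ ⟪ xs ⟫) (sym (∈⁅⁆⁻ r)) p))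
          (cin-≤# (A ∖ ⁅ x ⁆) xs (uniq-tail x xs u))))
        (#-disjoint ⁅ x ⁆ (A ∖ ⁅ x ⁆) A (λ y p q → ∖ʳ q p) (λ y p → subst (_∈ A) (∈⁅⁆⁻ p) (mem e)) λ y → ∖ˡ)

  length-≤# : ∀ {A} xs → Uniq xs → ⟪ xs ⟫ ⊆ A → length xs ≤ # A
  length-≤# {A} xs u f = ≤-trans (≤-reflexive (sym (cin-full xs))) (≤-trans (cin-mono xs λ y p _ → f y p) (cin-≤# A xs u))

  #∩⟪⟫ : ∀ A xs → # (A ∩ ⟪ xs ⟫) ≤ cin A xs
  #∩⟪⟫ A [] = ≤-trans (#-mono {B = ∅} λ x p → ⊥-elim (∉[] (∩ʳ p))) (≤-reflexive (#-∅ {N}))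
  #∩⟪⟫ A (x ∷ xs) with ∈? {x = x} A
  ... | inj₁ (mem e) rewrite e = ≤-trans (#-⊆+ (A ∩ ⟪ x ∷ xs ⟫) ⁅ x ⁆ (A ∩ ⟪ xs ⟫) λ y p → sub y p (∈-∷⁻ (∩ʳ {A = A} p)))
        (+-mono-≤ (#-⁅⁆ x) (#∩⟪⟫ A xs))
    where
    sub : ∀ y → y ∈ A ∩ ⟪ x ∷ xs ⟫ → x ≡ y ⊎ y ∈ ⟪ xs ⟫ → y ∈ ⁅ x ⁆ ⊎ y ∈ A ∩ ⟪ xs ⟫
    sub y p (inj₁ refl) = inj₁ ∈⁅⁆
    sub y p (inj₂ q) = inj₂ (∩⁺ {A = A} (∩ˡ p) q)
  ... | inj₂ n = ≤-trans (#-mono λ y p → sub y p (∈-∷⁻ (∩ʳ {A = A} p))) (≤-trans (#∩⟪⟫ A xs) (m≤n+m _ _))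
    where
    sub : ∀ y → y ∈ A ∩ ⟪ x ∷ xs ⟫ → x ≡ y ⊎ y ∈ ⟪ xs ⟫ → y ∈ A ∩ ⟪ xs ⟫
    sub y p (inj₁ refl) = ⊥-elim (n (∩ˡ p))
    sub y p (inj₂ q) = ∩⁺ {A = A} (∩ˡ p) q

-- Paths and balls

module Graph {N : ℕ} (adj : Fin N → Fin N → Bool) (adj-sym : ∀ x y → adj x y ≡ adj y x)
             (adj-irr : ∀ x → adj x x ≡ false) where

  V : Set
  V = Fin N

  infix 4 _~_
  record _~_ (x y : V) : Set where
    constructor edge
    field
      isEdge : adj x y ≡ true
  open _~_ public

  ~-sym : ∀ {x y} → x ~ y → y ~ x
  ~-sym {x} {y} (edge p) = edge (trans (adj-sym y x) p)

  ~-irr : ∀ {x} → ¬ x ~ x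
  ~-irr {x} (edge p) = case trans (sym (adj-irr x)) p of λ ()

  ~-≢ : ∀ {x y} → x ~ y → x ≢ y
  ~-≢ p refl = ~-irr p

  infixr 5 _◂_
  data Path : V → List V → V → Set where
    stop : ∀ {u} → Path u (u ∷ []) u
    _◂_ : ∀ {u w xs v} → u ~ w → Path w xs v → Path u (u ∷ xs) v

  join : ∀ {u xs a b ys v} → Path u xs a → a ~ b → Path b ys v → Path u (xs ++ ys) v
  join stop e q = e ◂ q
  join (d ◂ p) e q = d ◂ join p e q

  path-head : ∀ {u xs v} → Path u xs v → Σ[ ys ∈ List V ] xs ≡ u ∷ ys
  path-head stop = [] , refl
  path-head (_◂_ {xs = xs} d p) = xs , refl

  path-last : ∀ {u xs v} → Path u xs v → Σ[ ys ∈ List V ] xs ≡ ys ++ v ∷ []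
  path-last stop = [] , refl
  path-last (_◂_ {u = u} d p) with path-last p
  ... | ys , refl = u ∷ ys , refl

  start∈ : ∀ {u xs v} → Path u xs v → u ∈ ⟪ xs ⟫
  start∈ p with path-head p
  ... | ys , refl = ∈-head

  end∈ : ∀ {u xs v} → Path u xs v → v ∈ ⟪ xs ⟫
  end∈ p with path-last p
  ... | ys , refl = ∈-++ʳ ys ∈-head

  path-reverse : ∀ {u xs v} → Path u xs v → Path v (reverse xs) u
  path-reverse stop = stop
  path-reverse (_◂_ {u} {w} {xs} {v} d p) = subst (λ l → Path v l u) (sym (reverse-∷ u xs)) (join (path-reverse p) (~-sym d) stop)

  path-split : ∀ {u v y} x xs ys → Path u (x ∷ xs ++ y ∷ ys) v → Σ[ a ∈ V ] Path u (x ∷ xs) a × a ~ y × Path y (y ∷ ys) v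
  path-split x [] ys (d ◂ p) with path-head p
  ... | _ , refl = x , stop , d , p
  path-split x (z ∷ xs) ys (d ◂ p) with path-split z xs ys p
  ... | a , q , e , r = a , d ◂ q , e , r

  path-suffix : ∀ {u v y} xs ys → Path u (xs ++ y ∷ ys) v → Path y (y ∷ ys) v
  path-suffix [] ys p with path-head p
  ... | _ , refl = p
  path-suffix (x ∷ xs) ys p = proj₂ (proj₂ (proj₂ (path-split x xs ys p)))

  path-prefix : ∀ {u v y} xs ys → Path u (xs ++ y ∷ ys) v → Path u (xs ++ y ∷ []) y
  path-prefix [] ys p with path-head p
  ... | _ , refl = stop
  path-prefix (x ∷ xs) ys p with path-split x xs ys p
  ... | a , q , e , _ = join q e stop

  opaque
    unfolding _∩_ #

    nb : FSet N → FSet N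
    nb A x = 0 <ᵇ # (λ y → A y ∧ adj y x)

    nb⁺ : ∀ {A x y} → y ∈ A → y ~ x → x ∈ nb A
    nb⁺ {A} {x} {y} (mem p) (edge q) = mem (Equivalence.to T-≡ (ℕP.<⇒<ᵇ (#-pos {A = λ y → A y ∧ adj y x} {y} (mem (cong₂ _∧_ p q)))))

    nb⁻ : ∀ {A x} → x ∈ nb A → Σ[ y ∈ V ] y ∈ A × y ~ x
    nb⁻ {A} {x} (mem p) with #-witness (λ y → A y ∧ adj y x) (<ᵇ⇒< 0 _ (Equivalence.from T-≡ p))
    ... | y , q = y , ∩ˡ {B = λ y → adj y x} q , edge (holds (∩ʳ {A = A} q))

  N[_] : FSet N → FSet N
  N[ A ] = A ∪ nb A

  nb-mono : ∀ {A B} → A ⊆ B → nb A ⊆ nb B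
  nb-mono f x p with nb⁻ p
  ... | y , q , e = nb⁺ (f y q) e

  opaque

    ball : FSet N → V → ℕ → FSet N
    ball F v zero = ⁅ v ⁆
    ball F v (suc r) = ball F v r ∪ (nb (ball F v r) ∖ F)

    ball-suc : ∀ {F v} r {x} → x ∈ ball F v r → x ∈ ball F v (suc r)
    ball-suc r = ∪ˡ

    ball-step : ∀ {F v} r {x y} → x ∈ ball F v r → x ~ y → y ∉ F → y ∈ ball F v (suc r)
    ball-step {F} {v} r p e n = ∪ʳ {A = ball F v r} (∖⁺ (nb⁺ p e) n)

    ball-pred : ∀ {F v} r {y} → y ∈ ball F v (suc r) → y ∈ ball F v r ⊎ (y ∉ F × Σ[ x ∈ V ] x ∈ ball F v r × x ~ y)
    ball-pred {F} {v} r p with ∪⁻ {A = ball F v r} p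
    ... | inj₁ q = inj₁ q
    ... | inj₂ q = inj₂ (∖ʳ {A = nb (ball F v r)} q , nb⁻ (∖ˡ q))

    ball-zero : ∀ {F v x} → x ∈ ball F v 0 → v ≡ x
    ball-zero = ∈⁅⁆⁻

    ball-zero⁺ : ∀ {F v} → v ∈ ball F v 0
    ball-zero⁺ = ∈⁅⁆

  ball-mono : ∀ {F v} {r q} → r ≤ q → ball F v r ⊆ ball F v q
  ball-mono {F} {v} {q = zero} z≤n x p = p
  ball-mono {F} {v} {r} {suc q} h x p with ≤? r q
  ... | inj₁ h′ = ball-suc q (ball-mono h′ x p)
  ... | inj₂ h′ with ℕP.≤-antisym h h′
  ... | refl = p

  ball-start : ∀ {F v} r → v ∈ ball F v r
  ball-start {F} {v} r = ball-mono {F} {v} {0} {r} z≤n v ball-zero⁺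

  ball-off : ∀ {F v} r {x} → x ∈ ball F v r → v ≡ x ⊎ x ∉ F
  ball-off zero p = inj₁ (ball-zero p)
  ball-off (suc r) p with ball-pred r p
  ... | inj₁ q = ball-off r q
  ... | inj₂ (n , _) = inj₂ n

  ball-anti : ∀ {F G v} → F ⊆ G → ∀ r → ball G v r ⊆ ball F v r
  ball-anti {F} {G} {v} f zero x p = subst (_∈ ball F v 0) (ball-zero p) ball-zero⁺
  ball-anti f (suc r) x p with ball-pred r p
  ... | inj₁ q = ball-suc r (ball-anti f r x q)
  ... | inj₂ (n , y , q , e) = ball-step r (ball-anti f r y q) e λ m → n (f x m)

  ball-trans : ∀ {F v y} r q → y ∈ ball F v r → ball F y q ⊆ ball F v (r + q)
  ball-trans {F} {v} {y} r zero p x m = ball-mono (m≤m+n r 0) x (subst (_∈ ball F v r) (ball-zero m) p)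
  ball-trans {F} {v} {y} r (suc q) p x m with ball-pred q m
  ... | inj₁ k = ball-mono (+-monoʳ-≤ r (n≤1+n q)) x (ball-trans r q p x k)
  ... | inj₂ (n , z , k , e) = subst (λ t → x ∈ ball F v t) (sym (ℕP.+-suc r q)) (ball-step (r + q) (ball-trans r q p z k) e n)

  -- A vertex outside the previous ball is new on a path inside it, so these paths do not repeat vertices.
  ball-path : ∀ {F v} r {y} → y ∈ ball F v r →
    Σ[ xs ∈ List V ] Path v xs y × Uniq xs × length xs ≤ suc r × ⟪ xs ⟫ ⊆ ball F v r
  ball-path {F} {v} zero p with ball-zero p
  ... | refl = v ∷ [] , stop , uniq-[-] v , ≤-refl , λ x m → singleton x (∈-∷⁻ m)
    where
    singleton : ∀ x → v ≡ x ⊎ x ∈ ⟪ [] ⟫ → x ∈ ball F v 0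
    singleton x (inj₁ refl) = ball-zero⁺
    singleton x (inj₂ q) = ⊥-elim (∉[] q)
  ball-path {F} {v} (suc r) {y} p with ∈? {x = y} (ball F v r)
  ... | inj₁ q with ball-path r q
  ... | xs , w , u , l , s = xs , w , u , ≤-trans l (n≤1+n _) , λ x m → ball-suc r (s x m)
  ball-path {F} {v} (suc r) {y} p | inj₂ q with ball-pred r p
  ... | inj₁ q′ = ⊥-elim (q q′)
  ... | inj₂ (n , z , zb , e) with ball-path r zb
  ... | xs , w , u , l , s = xs ++ y ∷ [] , join w e stop ,
        uniq-++ xs (y ∷ []) u (uniq-[-] y) (λ x m m′ → q (new x m (∈-∷⁻ m′))) ,
        ≤-trans (≤-reflexive (trans (length-++ xs) (+-comm (length xs) 1))) (s≤s l) ,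
        λ x m → sub x (∈-++⁻ xs m)
    where
    new : ∀ x → x ∈ ⟪ xs ⟫ → y ≡ x ⊎ x ∈ ⟪ [] ⟫ → y ∈ ball F v r
    new x m (inj₁ refl) = s x m
    new x m (inj₂ k) = ⊥-elim (∉[] k)
    sub : ∀ x → x ∈ ⟪ xs ⟫ ⊎ x ∈ ⟪ y ∷ [] ⟫ → x ∈ ball F v (suc r)
    sub x (inj₁ m) = ball-suc r (s x m)
    sub x (inj₂ m) with ∈-∷⁻ m
    ... | inj₁ refl = p
    ... | inj₂ k = ⊥-elim (∉[] k)

  doubling : ∀ F v R → # (ball F v R) < 2 ^ R → Σ[ r ∈ ℕ ] r < R × # (ball F v (suc r)) ≤ 2 * # (ball F v r)
  doubling F v zero h = ⊥-elim (<⇒≱ h (#-pos (ball-zero⁺ {F} {v})))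
  doubling F v (suc R) h with ≤? (# (ball F v (suc R))) (2 * # (ball F v R))
  ... | inj₁ p = R , ≤-refl , p
  ... | inj₂ p with ≤? (2 ^ R) (# (ball F v R))
  ... | inj₁ q = ⊥-elim (<⇒≱ (<-≤-trans h (*-monoʳ-≤ 2 q)) (<⇒≤ p))
  ... | inj₂ q with doubling F v R q
  ... | r , l , b = r , ≤-trans l (n≤1+n _) , b

  record Cycle (m : ℕ) : Set where
    field
      verts : List V
      first end : V
      path : Path first verts end
      closing : end ~ first
      uniq : Uniq verts
      size : length verts ≡ m

-- The expanding setting

record Setting : Set where
  field
    {N} : ℕ
    adj : Fin N → Fin N → Bool
    adj-sym : ∀ x y → adj x y ≡ adj y x
    adj-irr : ∀ x → adj x x ≡ false
    n s B lam kap f : ℕ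
  open Graph adj adj-sym adj-irr public

  Indep : FSet N → Set
  Indep I = ∀ x y → x ∈ I → y ∈ I → ¬ x ~ y

  field
    s-pos : 1 ≤ s
    s≤B : s ≤ B
    B<2^lam : B < 2 ^ lam
    kap-connect : lam * (lam + 2) * 2 + 10 ≤ kap
    kap-unit : lam * 2 + 10 ≤ kap
    f-big : B * kap * 20 ≤ f
    n-big : lam * f * 200 + f * 200 ≤ n
    n≤N : n ≤ N
    expand : ∀ A → s ≤ # A → n ≤ # N[ A ]
    indep-small : ∀ I → Indep I → # I < B
    component : ∀ U → B ≤ # U → ∥ Σ[ v ∈ V ] v ∈ U × Σ[ D ∈ FSet N ] s < # D × (∀ y → y ∈ D → Σ[ r ∈ ℕ ] y ∈ ball (∁ U) v r) ∥

module Extension {N : ℕ} (s : ℕ) (Closed : FSet N → Set) (Bad : Fin N → Set) (closed-∅ : Closed ∅) (s-pos : 1 ≤ s)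
  (extend : ∀ U v → Closed U → # U < s → Bad v → v ∉ U → ∥ Σ[ U′ ∈ FSet N ] U ⊆ U′ × v ∈ U′ × Closed U′ × # U′ ≤ 2 * s ∥)
  (gap : ∀ U → Closed U → s ≤ # U → # U ≤ 2 * s → ⊥) where

  private
    Collected : List (Fin N) → Set
    Collected vs = Σ[ U ∈ FSet N ] Closed U × # U < s × (∀ v → v ∈ ⟪ vs ⟫ → Bad v → v ∈ U)

    small : ∀ U → Closed U → # U ≤ 2 * s → # U < s
    small U c h with ≤? s (# U)
    ... | inj₁ p = ⊥-elim (gap U c p h)
    ... | inj₂ p = p

    collect : ∀ vs → ∥ Collected vs ∥
    collect [] = return (∅ , closed-∅ , subst (_< s) (sym (#-∅ {N})) s-pos , λ v p _ → ⊥-elim (∉[] p))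
    collect (v ∷ vs) = do
      U , c , h , all ← collect vs
      d ← lem (Bad v)
      add U c h all d (∈? U)
      where
      add : ∀ U → Closed U → # U < s → (∀ v → v ∈ ⟪ vs ⟫ → Bad v → v ∈ U) → Bad v ⊎ ¬ Bad v → v ∈ U ⊎ v ∉ U → ∥ Collected (v ∷ vs) ∥
      add U c h all (inj₁ b) (inj₂ m) = do
        U′ , sub , v∈ , c′ , h′ ← extend U v c h b m
        return (U′ , c′ , small U′ c′ h′ , λ w p bw → case ∈-∷⁻ p of λ
          { (inj₁ refl) → v∈ ; (inj₂ q) → sub w (all w q bw) })
      add U c h all (inj₁ b) (inj₁ m) = return (U , c , h , λ w p bw → case ∈-∷⁻ p of λ
          { (inj₁ refl) → m ; (inj₂ q) → all w q bw })
      add U c h all (inj₂ b) _ = return (U , c , h , λ w p bw → case ∈-∷⁻ p of λ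
          { (inj₁ refl) → ⊥-elim (b bw) ; (inj₂ q) → all w q bw })

  allBad : ∥ Σ[ U ∈ FSet N ] # U < s × (∀ v → Bad v → v ∈ U) ∥
  allBad = do
    U , c , h , all ← collect (allFin N)
    return (U , h , λ v → all v (∈-allFin v))
    where
    ∈-tabulate : ∀ {M} (g : Fin M → Fin N) i → g i ∈ ⟪ tabulate g ⟫
    ∈-tabulate g zero = ∈-head
    ∈-tabulate g (suc i) = ∈-tail (∈-tabulate (g ∘ suc) i)
    ∈-allFin : ∀ v → v ∈ ⟪ allFin N ⟫
    ∈-allFin = ∈-tabulate id

module Alive (S : Setting) where
  open Setting S

  Alive : FSet N → V → Set
  Alive F v = s ≤ # (ball F v lam)

  g : ℕ
  g = lam + 2

  B-pos : 1 ≤ B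
  B-pos = ≤-trans s-pos s≤B

  Bkap-pos : 1 ≤ B * kap
  Bkap-pos = *-mono-≤ B-pos (≤-trans (m≤n+m 1 (lam * 2 + 9)) (≤-trans (≤-reflexive (+-assoc (lam * 2) 9 1)) kap-unit))

  s*kap≤B*kap : s * kap ≤ B * kap
  s*kap≤B*kap = *-monoˡ-≤ kap s≤B

  B≤Bkap : B * 10 ≤ B * kap
  B≤Bkap = *-monoʳ-≤ B (≤-trans (m≤n+m 10 (lam * 2)) kap-unit)

  1≤lam : 1 ≤ lam
  1≤lam with lam | B<2^lam
  ... | zero | h = ⊥-elim (<⇒≱ h B-pos)
  ... | suc _ | _ = s≤s z≤n

  f≤lam*f : f ≤ lam * f
  f≤lam*f = ≤-trans (≤-reflexive (sym (+-identityʳ f))) (*-monoˡ-≤ f 1≤lam)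

  -- A vertex whose small balls avoiding F ∪ X never reach s vertices has a ball that does not double; such
  -- balls are collected one after the other, each avoiding the previous ones, so that their union still does not expand.
  dead-small : ∀ F → # F + f ≤ n → ∥ Σ[ U ∈ FSet N ] # U < s × (∀ v → v ∉ U → ∀ X → # X ≤ kap * 3 → Alive (F ∪ X) v) ∥
  dead-small F hF = do
    U , h , all ← Extension.allBad s Closed Bad closed-∅ s-pos extend gap
    return (U , h , λ v v∉ X hX → alive v X hX (λ b → v∉ (all v b)) (≤? s (# (ball (F ∪ X) v lam))))
    where
    Bad : V → Set
    Bad v = Σ[ X ∈ FSet N ] # X ≤ kap * 3 × # (ball (F ∪ X) v lam) < s
    Closed : FSet N → Set
    Closed U = # (N[ U ] ∖ F) ≤ # U * (2 + kap * 3)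
    alive : ∀ v X → # X ≤ kap * 3 → ¬ Bad v → s ≤ # (ball (F ∪ X) v lam) ⊎ # (ball (F ∪ X) v lam) < s → Alive (F ∪ X) v
    alive v X hX nb (inj₁ a) = a
    alive v X hX nb (inj₂ a) = ⊥-elim (nb (X , hX , a))
    closed-∅ : Closed ∅
    closed-∅ = ≤-trans (≤-trans (#-mono {B = ∅} sub) (≤-reflexive (#-∅ {N}))) z≤n
      where
      sub : (N[ ∅ ] ∖ F) ⊆ ∅
      sub x p with ∪⁻ (∖ˡ p)
      ... | inj₁ q = q
      ... | inj₂ q = ⊥-elim (∉∅ (proj₁ (proj₂ (nb⁻ q))))
    gap : ∀ U → Closed U → s ≤ # U → # U ≤ 2 * s → ⊥
    gap U c h h′ = ℕP.<-irrefl refl (lin (n ∷ # U ∷ kap ∷ s ∷ # F ∷ f ∷ B ∷ # (N[ U ] ∖ F) ∷ # N[ U ] ∷ # U * kap ∷ s * kap ∷ B * kap ∷ [])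
      (λ n u k s F f B c w uk sk Bk →
        n ≼ w ∷ w ≼ F :+ c ∷ c ≼ u :* con 2 :+ uk :* con 3 ∷ u ≼ con 2 :* s ∷ u ≼ con 2 :* s ∷ 3 ⊠ uk ≼ con 2 :* sk ∷ F :+ f ≼ n ∷ Bk :* con 20 ≼ f
        ∷ 4 ⊠ s ≼ B ∷ B :* con 10 ≼ Bk ∷ 6 ⊠ sk ≼ Bk ∷ con 1 ≼ Bk ∷ [] ⊢ n ≺ n)
      (expand U h , #-≤+∖ N[ U ] F , ≤-trans c (≤-reflexive dist) , h′ , h′ , ≤-trans (*-monoˡ-≤ kap h′) (≤-reflexive (*-assoc 2 s kap)) , hF , f-big
      , s≤B , B≤Bkap , s*kap≤B*kap , Bkap-pos , tt))
      where
      dist : # U * (2 + kap * 3) ≡ # U * 2 + # U * kap * 3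
      dist = trans (*-distribˡ-+ (# U) 2 (kap * 3)) (cong (# U * 2 +_) (sym (*-assoc (# U) kap 3)))
    extend : ∀ U v → Closed U → # U < s → Bad v → v ∉ U → ∥ Σ[ U′ ∈ FSet N ] U ⊆ U′ × v ∈ U′ × Closed U′ × # U′ ≤ 2 * s ∥
    extend U v c h (X , hX , b) v∉ = return (U ∪ A , (λ x → ∪ˡ) , ∪ʳ (ball-start r) , closed , bound)
      where
      F′ : FSet N
      F′ = (F ∪ X) ∪ U
      small : # (ball F′ v lam) < s
      small = ≤-<-trans (#-mono (ball-anti (λ x → ∪ˡ) lam)) b
      found : Σ[ r ∈ ℕ ] r < lam × # (ball F′ v (suc r)) ≤ 2 * # (ball F′ v r)
      found = doubling F′ v lam (<-≤-trans small (≤-trans s≤B (<⇒≤ B<2^lam)))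
      r : ℕ
      r = proj₁ found
      A : FSet N
      A = ball F′ v r
      disj : Disjoint U A
      disj x xU xA with ball-off r xA
      ... | inj₁ refl = v∉ xU
      ... | inj₂ q = q (∪ʳ xU)
      sub : ∀ x → x ∈ N[ U ∪ A ] ∖ F → x ∈ ((N[ U ] ∖ F) ∪ X) ⊎ x ∈ ball F′ v (suc r)
      sub x p = go (∪⁻ (∖ˡ p)) (∈? X) (∈? U)
        where
        x∉F : x ∉ F
        x∉F = ∖ʳ p
        go : x ∈ U ∪ A ⊎ x ∈ nb (U ∪ A) → x ∈ X ⊎ x ∉ X → x ∈ U ⊎ x ∉ U → x ∈ ((N[ U ] ∖ F) ∪ X) ⊎ x ∈ ball F′ v (suc r)
        go _ (inj₁ xX) _ = inj₁ (∪ʳ xX)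
        go _ _ (inj₁ xU) = inj₁ (∪ˡ (∖⁺ (∪ˡ xU) x∉F))
        go (inj₁ q) (inj₂ nX) (inj₂ nU) with ∪⁻ q
        ... | inj₁ xU = ⊥-elim (nU xU)
        ... | inj₂ xA = inj₂ (ball-suc r xA)
        go (inj₂ q) (inj₂ nX) (inj₂ nU) with nb⁻ q
        ... | y , yUA , e with ∪⁻ yUA
        ... | inj₁ yU = inj₁ (∪ˡ (∖⁺ (∪ʳ (nb⁺ yU e)) x∉F))
        ... | inj₂ yA = inj₂ (ball-step r yA e λ m → case ∪⁻ m of λ
                { (inj₁ m′) → case ∪⁻ m′ of λ { (inj₁ xF) → x∉F xF ; (inj₂ xX) → nX xX } ; (inj₂ xU) → nU xU })
      closed : Closed (U ∪ A)
      closed = lin (# (N[ U ∪ A ] ∖ F) ∷ # ((N[ U ] ∖ F) ∪ X) ∷ # (N[ U ] ∖ F) ∷ # X ∷ # (ball F′ v (suc r)) ∷ # A ∷ # U ∷ kap ∷ # (U ∪ A) ∷ # (U ∪ A) * (2 + kap * 3) ∷ # A * kap ∷ [])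
        (λ w y c X b A U k UA t Ak → w ≼ y :+ b ∷ y ≼ c :+ X ∷ c ≼ U :* (con 2 :+ k :* con 3) ∷ X ≼ k :* con 3 ∷ b ≼ con 2 :* A ∷ (A :+ U) :* (con 2 :+ k :* con 3) ≼ t ∷ 3 ⊠ k ≼ Ak ∷ 3 ⊠ Ak ≼ A :* k ∷ [] ⊢ w ≼ t)
        (#-⊆+ _ _ _ sub , #-∪ _ _ , c , hX , proj₂ (proj₂ found) , *-monoˡ-≤ (2 + kap * 3) sum , kA , ≤-refl , tt)
        where
        sum : # A + # U ≤ # (U ∪ A)
        sum = #-disjoint A U (U ∪ A) (λ x a u → disj x u a) (λ x → ∪ʳ) (λ x → ∪ˡ)
        kA : kap ≤ # A * kap
        kA = ≤-trans (≤-reflexive (sym (+-identityʳ kap))) (*-monoˡ-≤ kap (#-pos (ball-start {F′} {v} r)))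
      bound : # (U ∪ A) ≤ 2 * s
      bound = lin (# (U ∪ A) ∷ # U ∷ # A ∷ # (ball F′ v lam) ∷ s ∷ []) (λ UA U A b s → UA ≼ U :+ A ∷ U ≺ s ∷ A ≼ b ∷ b ≺ s ∷ [] ⊢ UA ≼ con 2 :* s)
        (#-∪ U A , h , #-mono (ball-mono (<⇒≤ (proj₁ (proj₂ found)))) , small , tt)

  LocallyIndep : FSet N → V → ℕ → ℕ → Set
  LocallyIndep F v r b = ∀ I → Indep I → I ⊆ ball F v r → # I ≤ b

  Region : ℕ → ℕ → Set
  Region t b = Σ[ F ∈ FSet N ] Σ[ v ∈ V ] # F + t * f ≤ lam * f × Alive F v × LocallyIndep F v (t * g) b

  Critical : Set
  Critical = Σ[ t ∈ ℕ ] Σ[ b ∈ ℕ ] Σ[ h ∈ ℕ ] t < lam × b ≤ suc (2 * h) × Region (suc t) b × ¬ Region t h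

  half : ∀ b → Σ[ h ∈ ℕ ] 2 * h ≤ b × b ≤ suc (2 * h)
  half zero = 0 , z≤n , z≤n
  half (suc zero) = 0 , z≤n , ≤-refl
  half (suc (suc b)) with half b
  ... | h , p , q = suc h , ≤-trans (≤-reflexive (ℕP.*-suc 2 h)) (s≤s (s≤s p)) , ≤-trans (s≤s (s≤s q)) (≤-reflexive (cong suc (sym (ℕP.*-suc 2 h))))

  region-zero : ∀ {b} → b < 1 → ¬ Region 0 b
  region-zero {b} b<1 (F , v , _ , _ , loc) = <⇒≱ (<-≤-trans b<1 (#-pos {x = v} ∈⁅⁆))
    (loc ⁅ v ⁆ (λ x y p q e → ~-≢ e (trans (sym (∈⁅⁆⁻ p)) (∈⁅⁆⁻ q))) λ x p → subst (_∈ ball F v 0) (∈⁅⁆⁻ p) ball-zero⁺)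

  descend : ∀ t b → b < 2 ^ t → t ≤ lam → Region t b → ∥ Critical ∥
  descend zero b b<1 _ R = ⊥-elim (region-zero b<1 R)
  descend (suc t) b b< t<lam R = lem (Region t h) >>= step
    where
    h : ℕ
    h = proj₁ (half b)
    h<2^t : h < 2 ^ t
    h<2^t with ≤? (2 ^ t) h
    ... | inj₁ p = ⊥-elim (<⇒≱ b< (≤-trans (*-monoʳ-≤ 2 p) (proj₁ (proj₂ (half b)))))
    ... | inj₂ p = p
    step : Region t h ⊎ ¬ Region t h → ∥ Critical ∥
    step (inj₁ R′) = descend t h h<2^t (<⇒≤ t<lam) R′
    step (inj₂ nR) = return (t , b , h , t<lam , proj₂ (proj₂ (half b)) , R , nR)

  critical : ∥ Critical ∥
  critical = do
    U , hU , alive ← dead-small ∅ hyp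
    let v , _ , v∉ = #-pick full U (U< U hU)
    descend lam B B<2^lam ≤-refl (∅ , v , ≤-reflexive (cong (_+ lam * f) (#-∅ {N})) ,
      ≤-trans (alive v v∉ ∅ (≤-trans (≤-reflexive (#-∅ {N})) z≤n)) (#-mono (ball-anti (λ x p → ⊥-elim (∉∅ p)) lam)) ,
      λ I ind _ → <⇒≤ (indep-small I ind))
    where
    f≤n : f ≤ n
    f≤n = lin (f ∷ n ∷ lam * f ∷ []) (λ f n l → l :* con 200 :+ f :* con 200 ≼ n ∷ [] ⊢ f ≼ n) (n-big , tt)
    hyp : # {N} ∅ + f ≤ n
    hyp rewrite #-∅ {N} = f≤n
    U< : ∀ U → # U < s → # U < # (full {N})
    U< U h = lin (# U ∷ s ∷ # (full {N}) ∷ N ∷ n ∷ B ∷ B * kap ∷ f ∷ []) (λ U s F N n B Bk f → U ≺ s ∷ N ≼ F ∷ n ≼ N ∷ f ≼ n ∷ s ≼ B ∷ B :* con 10 ≼ Bk ∷ Bk :* con 20 ≼ f ∷ [] ⊢ U ≺ F)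
      (h , ≤-reflexive (sym (#-full {N})) , n≤N , f≤n , s≤B , B≤Bkap , f-big , tt)

  Reaches : FSet N → V → V → ℕ → Set
  Reaches F u u′ k = u′ ∈ ball F u k ⊎ Σ[ p ∈ V ] p ∈ ball F u k × p ~ u′

  backtrack : ∀ {F u u′} r q {x} → x ∈ ball F u′ r → x ∈ ball F u q →
    Reaches F u u′ (q + r)
  backtrack zero q m m′ with ball-zero m
  ... | refl = inj₁ (ball-mono (m≤m+n q 0) _ m′)
  backtrack {F} {u} {u′} (suc r) q {x} m m′ with ball-pred r m
  ... | inj₁ k = widen (backtrack r q k m′)
    where
    q+r≤ : q + r ≤ q + suc r
    q+r≤ = +-monoʳ-≤ q (n≤1+n r)
    widen : Reaches F u u′ (q + r) → Reaches F u u′ (q + suc r)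
    widen (inj₁ a) = inj₁ (ball-mono q+r≤ _ a)
    widen (inj₂ (p , a , e)) = inj₂ (p , ball-mono q+r≤ _ a , e)
  ... | inj₂ (x∉ , y , yb , e) with ball-off r yb
  ... | inj₁ refl = inj₂ (x , ball-mono (m≤m+n q _) x m′ , ~-sym e)
  ... | inj₂ y∉ = subst (λ k → Reaches F u u′ k) (sym (ℕP.+-suc q r))
        (backtrack r (suc q) yb (ball-step q m′ (~-sym e) y∉))

  path-ends : ∀ {u v xs} → Path u xs v → u ≢ v → Σ[ ys ∈ List V ] xs ≡ u ∷ ys ++ v ∷ []
  path-ends stop n = ⊥-elim (n refl)
  path-ends (d ◂ p) n with path-last p
  ... | ys , refl = ys , refl

  record Link (F : FSet N) (u u′ : V) (k : ℕ) : Set where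
    field
      inner : List V
      path : Path u (u ∷ inner ++ u′ ∷ []) u′
      uniq : Uniq (u ∷ inner ++ u′ ∷ [])
      short : length inner ≤ k
      avoids : Disjoint ⟪ inner ⟫ F

  ball-link : ∀ {F u u′} K → u ≢ u′ → Reaches F u u′ K → Link F u u′ (suc K)
  ball-link {F} {u} {u′} K u≢ reach = fromPath (path reach (∈? (ball F u K)))
    where
    OffPath : Set
    OffPath = Σ[ xs ∈ List V ] Path u xs u′ × Uniq xs × length xs ≤ suc (suc K) × (∀ x → x ∈ ⟪ xs ⟫ → u ≡ x ⊎ u′ ≡ x ⊎ x ∉ F)
    inside : ∀ {xs} → ⟪ xs ⟫ ⊆ ball F u K → ∀ x → x ∈ ⟪ xs ⟫ → u ≡ x ⊎ u′ ≡ x ⊎ x ∉ F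
    inside sub x m with ball-off K (sub x m)
    ... | inj₁ e = inj₁ e
    ... | inj₂ n = inj₂ (inj₂ n)
    path : Reaches F u u′ K → u′ ∈ ball F u K ⊎ u′ ∉ ball F u K → OffPath
    path _ (inj₁ m) with ball-path K m
    ... | xs , p , q , l , sub = xs , p , q , ≤-trans l (n≤1+n _) , inside sub
    path (inj₁ m) (inj₂ n) = ⊥-elim (n m)
    path (inj₂ (y , m , e)) (inj₂ n) with ball-path K m
    ... | xs , p , q , l , sub = xs ++ u′ ∷ [] , join p e stop ,
          uniq-++ xs (u′ ∷ []) q (uniq-[-] u′) (λ x a b → case ∈-∷⁻ b of λ { (inj₁ refl) → n (sub x a) ; (inj₂ c) → ∉[] c }) ,
          ≤-trans (≤-reflexive (trans (length-++ xs) (+-comm (length xs) 1))) (s≤s l) ,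
          λ x a → case ∈-++⁻ xs a of λ { (inj₁ b) → inside sub x b ; (inj₂ b) → case ∈-∷⁻ b of λ { (inj₁ c) → inj₂ (inj₁ c) ; (inj₂ c) → ⊥-elim (∉[] c) } }
    fromPath : OffPath → Link F u u′ (suc K)
    fromPath (xs , p , q , l , off) with path-ends p u≢
    ... | ys , refl = record { inner = ys ; path = p ; uniq = q
          ; short = ℕP.≤-pred (≤-trans (≤-trans (s≤s (≤-trans (m≤m+n (length ys) 1) (≤-reflexive (sym (length-++ ys))))) l) ≤-refl)
          ; avoids = λ x m xF → case off x (∈-tail (∈-++ˡ ys m)) of λ
            { (inj₁ refl) → uniq-head u (ys ++ u′ ∷ []) q (∈-++ˡ ys m)
            ; (inj₂ (inj₁ refl)) → uniq-disjoint ys (u′ ∷ []) (uniq-tail u (ys ++ u′ ∷ []) q) u′ m ∈-head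
            ; (inj₂ (inj₂ k)) → k xF } }

  module Connect (t b h : ℕ) (t<lam : t < lam) (b≤ : b ≤ suc (2 * h)) (noRegion : ¬ Region t h)
    (F₀ : FSet N) (v₀ : V) (loc : LocallyIndep F₀ v₀ (suc t * g) b) where

    Q : FSet N
    Q = ball F₀ v₀ g

    -- Otherwise the two balls would carry nonadjacent independent sets, with more than b vertices together.
    connect : ∀ F u u′ → F₀ ⊆ F → # F + t * f ≤ lam * f → u ∈ Q → u′ ∈ Q → Alive F u → Alive F u′ → u ≢ u′ → ∥ Link F u u′ kap ∥
    connect F u u′ F₀⊆ hF uQ u′Q au au′ u≢ = do
      I , indI , subI , hI ← big u au
      I′ , indI′ , subI′ , hI′ ← big u′ au′
      x , x′ , xI , x′I , e ← touch I I′ indI indI′ subI subI′ hI hI′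
      return (linkOf (subI x xI) (subI′ x′ x′I) e)
      where
      big : ∀ w → Alive F w → ∥ Σ[ I ∈ FSet N ] Indep I × I ⊆ ball F w (t * g) × h < # I ∥
      big w a = byContra λ none → return (noRegion (F , w , hF , a , λ I ind sub → case ≤? (# I) h of λ
        { (inj₁ p) → p ; (inj₂ p) → ⊥-elim (none (I , ind , sub , p)) }))
      far : ∀ {w} → w ∈ Q → ball F w (t * g) ⊆ ball F₀ v₀ (suc t * g)
      far wQ x m = ball-trans g (t * g) wQ x (ball-anti F₀⊆ (t * g) x m)
      touch : ∀ I I′ → Indep I → Indep I′ → I ⊆ ball F u (t * g) → I′ ⊆ ball F u′ (t * g) → h < # I → h < # I′ →
        ∥ Σ[ x ∈ V ] Σ[ x′ ∈ V ] x ∈ I × x′ ∈ I′ × (x ≡ x′ ⊎ x ~ x′) ∥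
      touch I I′ ind ind′ sub sub′ hI hI′ = byContra λ none → return (ℕP.<-irrefl refl
        (lin (b ∷ h ∷ # I ∷ # I′ ∷ # (I ∪ I′) ∷ []) (λ b h I J U → b ≼ con 1 :+ con 2 :* h ∷ h ≺ I ∷ h ≺ J ∷ I :+ J ≼ U ∷ U ≼ b ∷ [] ⊢ b ≺ b)
          (b≤ , hI , hI′ , #-disjoint I I′ (I ∪ I′) (λ x p q → none (x , x , p , q , inj₁ refl)) (λ x → ∪ˡ) (λ x → ∪ʳ)
          , loc (I ∪ I′) (λ x y p q → indep none x y (∪⁻ p) (∪⁻ q)) (∪-least (λ x p → far uQ x (sub x p)) (λ x p → far u′Q x (sub′ x p))) , tt)))
        where
        indep : ¬ (Σ[ x ∈ V ] Σ[ x′ ∈ V ] x ∈ I × x′ ∈ I′ × (x ≡ x′ ⊎ x ~ x′)) → ∀ x y → x ∈ I ⊎ x ∈ I′ → y ∈ I ⊎ y ∈ I′ → ¬ x ~ y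
        indep none x y (inj₁ p) (inj₁ q) = ind x y p q
        indep none x y (inj₂ p) (inj₂ q) = ind′ x y p q
        indep none x y (inj₁ p) (inj₂ q) e = none (x , y , p , q , inj₂ e)
        indep none x y (inj₂ p) (inj₁ q) e = none (y , x , q , p , inj₂ (~-sym e))
      K : ℕ
      K = suc (t * g) + t * g
      weaken : ∀ {k} → k ≤ K → Link F u u′ (suc k) → Link F u u′ kap
      weaken k≤ l = record { inner = Link.inner l ; path = Link.path l ; uniq = Link.uniq l ; avoids = Link.avoids l
        ; short = ≤-trans (Link.short l) (lin (t * g ∷ lam * g ∷ kap ∷ _ ∷ []) (λ a b k c → c ≼ con 1 :+ a :+ a ∷ 2 ⊠ a ≼ b ∷ b :* con 2 :+ con 10 ≼ k ∷ [] ⊢ con 1 :+ c ≼ k)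
            (k≤ , *-monoˡ-≤ g (<⇒≤ t<lam) , kap-connect , tt)) }
      linkOf : ∀ {x x′} → x ∈ ball F u (t * g) → x′ ∈ ball F u′ (t * g) → x ≡ x′ ⊎ x ~ x′ → Link F u u′ kap
      linkOf m m′ (inj₁ refl) = weaken {t * g + t * g} (n≤1+n _) (ball-link _ u≢ (backtrack (t * g) (t * g) m′ m))
      linkOf {x} {x′} m m′ (inj₂ e) with ball-off (t * g) m′
      ... | inj₁ refl = weaken {t * g} (≤-trans (m≤m+n (t * g) _) (n≤1+n _)) (ball-link (t * g) u≢ (inj₂ (x , m , e)))
      ... | inj₂ n = weaken ≤-refl (ball-link K u≢ (backtrack (t * g) (suc (t * g)) m′ (ball-step (t * g) m e n)))

-- Paths of flexible length

module Units (S : Setting) where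
  open Setting S

  Flex : V → V → ℕ → ℕ → FSet N → Set
  Flex u v lo r X = ∀ j → j ≤ r → Σ[ xs ∈ List V ] Path u xs v × Uniq xs × length xs ≡ lo + j × ⟪ xs ⟫ ⊆ X

  record Unit (W : FSet N) : Set where
    field
      entry exit : V
      lo : ℕ
      verts : FSet N
      flex : Flex entry exit lo 1 verts
      within : verts ⊆ W
      small : # verts ≤ kap

  module Layers (W : FSet N) (v : V) (v∈W : v ∈ W) where

    bal : ℕ → FSet N
    bal = ball (∁ W) v

    bal⊆W : ∀ r → bal r ⊆ W
    bal⊆W r x p with ball-off r p
    ... | inj₁ refl = v∈W
    ... | inj₂ q with ∈? {x = x} W
    ... | inj₁ m = m
    ... | inj₂ m = ⊥-elim (q (∁⁺ m))

    ∉∁W : ∀ {x} → x ∈ W → x ∉ ∁ W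
    ∉∁W m k = ∁⁻ k m

    prev : ℕ → FSet N
    prev zero = ∅
    prev (suc r) = bal r

    record Fork (r : ℕ) (x y : V) : Set where
      field
        base : V
        xs ys : List V
        toX : Path base (base ∷ xs) x
        toY : Path base (base ∷ ys) y
        uniq : Uniq (base ∷ xs ++ ys)
        same : length xs ≡ length ys
        bound : length xs ≤ r
        inside : ⟪ base ∷ xs ++ ys ⟫ ⊆ bal r

    parent : ∀ r {x} → x ∈ bal (suc r) → x ∉ bal r → Σ[ p ∈ V ] p ∈ bal r × p ∉ prev r × p ~ x
    parent r {x} m n with ball-pred r m
    ... | inj₁ k = ⊥-elim (n k)
    ... | inj₂ (x∉ , p , pb , e) = p , pb , notPrev r pb n , e
      where
      notPrev : ∀ r → p ∈ bal r → x ∉ bal r → p ∉ prev r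
      notPrev zero _ _ k = ∉∅ k
      notPrev (suc r) _ n k = n (ball-step r k e x∉)

    fork : ∀ r x y → x ∈ bal r → x ∉ prev r → y ∈ bal r → y ∉ prev r → x ≢ y → Fork r x y
    fork zero x y xm _ ym _ x≢y = ⊥-elim (x≢y (trans (sym (ball-zero xm)) (ball-zero ym)))
    fork (suc r) x y xm xn ym yn x≢y = build (parent r xm xn) (parent r ym yn)
      where
      build : (Σ[ p ∈ V ] p ∈ bal r × p ∉ prev r × p ~ x) → (Σ[ p ∈ V ] p ∈ bal r × p ∉ prev r × p ~ y) → Fork (suc r) x y
      build (p , pm , pn , e) (p′ , pm′ , pn′ , e′) = decide (p ≟ p′)
        where
        decide : Dec (p ≡ p′) → Fork (suc r) x y
        decide (yes refl) = record { base = p ; xs = x ∷ [] ; ys = y ∷ [] ; toX = e ◂ stop ; toY = e′ ◂ stop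
          ; uniq = uniq-∷ p (x ∷ y ∷ []) (λ m → case ∈-∷⁻ m of λ
              { (inj₁ refl) → xn pm ; (inj₂ m′) → case ∈-∷⁻ m′ of λ { (inj₁ refl) → yn pm ; (inj₂ q) → ∉[] q } })
              (uniq-∷ x (y ∷ []) (λ m → case ∈-∷⁻ m of λ { (inj₁ q) → x≢y (sym q) ; (inj₂ q) → ∉[] q }) (uniq-[-] y))
          ; same = refl ; bound = s≤s z≤n
          ; inside = λ z m → case ∈-∷⁻ m of λ { (inj₁ refl) → ball-suc r pm ; (inj₂ m′) → case ∈-∷⁻ m′ of λ
              { (inj₁ refl) → xm ; (inj₂ m″) → case ∈-∷⁻ m″ of λ { (inj₁ refl) → ym ; (inj₂ q) → ⊥-elim (∉[] q) } } } }
        decide (no p≢) = record { base = base ; xs = xs ++ x ∷ [] ; ys = ys ++ y ∷ [] ; toX = join toX e stop ; toY = join toY e′ stop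
          ; uniq = λ w → ≤-trans (≤-reflexive (perm w)) (uniq⁺ w)
          ; same = trans (length-++ xs) (trans (cong (_+ 1) same) (sym (length-++ ys)))
          ; bound = ≤-trans (≤-reflexive (trans (length-++ xs) (+-comm (length xs) 1))) (s≤s bound)
          ; inside = λ w m → inside⁺ w (cnt⇒∈⟪⟫ (x ∷ y ∷ base ∷ xs ++ ys) (≤-trans (∈⟪⟫⇒cnt (base ∷ (xs ++ x ∷ []) ++ ys ++ y ∷ []) m) (≤-reflexive (perm w)))) }
          where
          open Fork (fork r p p′ pm pn pm′ pn′ p≢)
          uniq⁺ : Uniq (x ∷ y ∷ base ∷ xs ++ ys)
          uniq⁺ = uniq-∷ x (y ∷ base ∷ xs ++ ys) (λ m → case ∈-∷⁻ m of λ { (inj₁ q) → x≢y (sym q) ; (inj₂ q) → xn (inside x q) })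
            (uniq-∷ y (base ∷ xs ++ ys) (λ m → yn (inside y m)) uniq)
          inside⁺ : ∀ w → w ∈ ⟪ x ∷ y ∷ base ∷ xs ++ ys ⟫ → w ∈ bal (suc r)
          inside⁺ w m with ∈-∷⁻ m
          ... | inj₁ refl = xm
          ... | inj₂ m′ with ∈-∷⁻ m′
          ... | inj₁ refl = ym
          ... | inj₂ m″ = ball-suc r (inside w m″)
          perm : ∀ w → cnt w (base ∷ (xs ++ x ∷ []) ++ ys ++ y ∷ []) ≡ cnt w (x ∷ y ∷ base ∷ xs ++ ys)
          perm w rewrite cnt-++ w (xs ++ x ∷ []) (ys ++ y ∷ []) | cnt-++ w xs (x ∷ []) | cnt-++ w ys (y ∷ []) | cnt-++ w xs ys =
            ℕP.≤-antisym (lin ρ (λ b x y xs ys → [] ⊢ b :+ ((xs :+ (x :+ con 0)) :+ (ys :+ (y :+ con 0))) ≼ x :+ (y :+ (b :+ (xs :+ ys)))) tt)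
                         (lin ρ (λ b x y xs ys → [] ⊢ x :+ (y :+ (b :+ (xs :+ ys))) ≼ b :+ ((xs :+ (x :+ con 0)) :+ (ys :+ (y :+ con 0)))) tt)
            where
            ρ : Vec ℕ 5
            ρ = bit (does (base ≟ w)) ∷ bit (does (x ≟ w)) ∷ bit (does (y ≟ w)) ∷ cnt w xs ∷ cnt w ys ∷ []

    fork-unit : ∀ r {x y} → r ≤ suc lam → x ~ y → Fork r x y → Unit W
    fork-unit r {x} {y} r≤ e F = record { entry = base ; exit = x ; lo = suc (length xs) ; verts = ⟪ base ∷ xs ++ ys ⟫
      ; flex = flex ; within = λ z m → bal⊆W r z (inside z m)
      ; small = ≤-trans (#⟪⟫ (base ∷ xs ++ ys)) (lin (length (xs ++ ys) ∷ length xs ∷ length ys ∷ r ∷ lam ∷ kap ∷ [])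
          (λ l a b r m k → l ≼ a :+ b ∷ b ≼ a ∷ 2 ⊠ a ≼ r ∷ 2 ⊠ r ≼ con 1 :+ m ∷ m :* con 2 :+ con 10 ≼ k ∷ [] ⊢ con 1 :+ l ≼ k)
          (≤-reflexive (length-++ xs) , ≤-reflexive (sym same) , bound , r≤ , kap-unit , tt)) }
      where
      open Fork F
      flex : Flex base x (suc (length xs)) 1 ⟪ base ∷ xs ++ ys ⟫
      flex zero _ = base ∷ xs , toX , uniq-++ˡ (base ∷ xs) ys uniq , sym (+-identityʳ _) , λ z m → ∈-++ˡ (base ∷ xs) m
      flex (suc zero) _ = base ∷ ys ++ x ∷ [] , join toY (~-sym e) stop ,
        uniq-++ (base ∷ ys) (x ∷ []) uniqY (uniq-[-] x) (λ z m m′ → case ∈-∷⁻ m′ of λ { (inj₁ refl) → new m ; (inj₂ q) → ∉[] q }) ,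
        cong suc (trans (length-++ ys) (cong (_+ 1) (sym same))) ,
        λ z m → case ∈-++⁻ (base ∷ ys) m of λ { (inj₁ a) → incl z (∈-∷⁻ a) ; (inj₂ a) → case ∈-∷⁻ a of λ { (inj₁ refl) → ∈-++ˡ (base ∷ xs) (end∈ toX) ; (inj₂ q) → ⊥-elim (∉[] q) } }
        where
        incl : ∀ z → base ≡ z ⊎ z ∈ ⟪ ys ⟫ → z ∈ ⟪ base ∷ xs ++ ys ⟫
        incl z (inj₁ refl) = ∈-head
        incl z (inj₂ q) = ∈-tail (∈-++ʳ xs q)
        uniqY : Uniq (base ∷ ys)
        uniqY = uniq-∷ base ys (λ m → uniq-head base (xs ++ ys) uniq (∈-++ʳ xs m)) (uniq-++ʳ xs ys (uniq-tail base (xs ++ ys) uniq))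
        new : x ∉ ⟪ base ∷ ys ⟫
        new m = clash xs ys toX toY uniq same m
          where
          -- With no inner vertices both arms would end at the base.
          clash : ∀ xs ys → Path base (base ∷ xs) x → Path base (base ∷ ys) y → Uniq (base ∷ xs ++ ys) → length xs ≡ length ys → x ∈ ⟪ base ∷ ys ⟫ → ⊥
          clash [] [] stop stop _ _ _ = ~-irr e
          clash (z ∷ xs) ys (d ◂ p) q u _ m with ∈-∷⁻ m
          ... | inj₁ refl = uniq-head base (z ∷ xs ++ ys) u (∈-++ˡ (z ∷ xs) (end∈ p))
          ... | inj₂ k = uniq-disjoint (z ∷ xs) ys (uniq-tail base (z ∷ xs ++ ys) u) x (end∈ p) k
      flex (suc (suc _)) (s≤s ())

    record TwoColouring (r : ℕ) : Set where
      field
        even odd : FSet N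
        even-indep : Indep even
        odd-indep : Indep odd
        even⊆ : even ⊆ bal r
        odd⊆ : odd ⊆ prev r
        cover : ∀ x → x ∈ bal r → x ∈ even ⊎ x ∈ odd

    layers : ∀ r → r ≤ suc lam → ∥ Unit W ⊎ TwoColouring r ∥
    layers zero _ = return (inj₂ record { even = ⁅ v ⁆ ; odd = ∅ ; even-indep = λ x y p q e → ~-≢ e (trans (sym (∈⁅⁆⁻ p)) (∈⁅⁆⁻ q))
      ; odd-indep = λ x y p → ⊥-elim (∉∅ p) ; even⊆ = λ x p → subst (_∈ bal 0) (∈⁅⁆⁻ p) ball-zero⁺ ; odd⊆ = λ x p → p
      ; cover = λ x p → inj₁ (subst (_∈ ⁅ v ⁆) (ball-zero p) ∈⁅⁆) })
    layers (suc r) r≤ = do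
      inj₂ C ← layers r (≤-trans (n≤1+n r) r≤)
        where inj₁ U → return (inj₁ U)
      d ← lem (Σ[ x ∈ V ] Σ[ y ∈ V ] x ∈ layer × y ∈ layer × x ~ y)
      return (step C d)
      where
      layer : FSet N
      layer = bal (suc r) ∖ bal r
      step : TwoColouring r → (Σ[ x ∈ V ] Σ[ y ∈ V ] x ∈ layer × y ∈ layer × x ~ y) ⊎ ¬ (Σ[ x ∈ V ] Σ[ y ∈ V ] x ∈ layer × y ∈ layer × x ~ y) → Unit W ⊎ TwoColouring (suc r)
      step C (inj₁ (x , y , xm , ym , e)) = inj₁ (fork-unit (suc r) r≤ e (fork (suc r) x y (∖ˡ xm) (∖ʳ xm) (∖ˡ ym) (∖ʳ ym) (~-≢ e)))
      step C (inj₂ none) = inj₂ record { even = odd ∪ layer ; odd = even ; even-indep = λ x y p q → ind x y (∪⁻ p) (∪⁻ q) ; odd-indep = even-indep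
        ; even⊆ = ∪-least (λ x p → ball-suc r (prev⊆ r x (odd⊆ x p))) (λ x p → ∖ˡ p) ; odd⊆ = even⊆
        ; cover = λ x p → cov x p (∈? (bal r)) }
        where
        open TwoColouring C
        prev⊆ : ∀ r → prev r ⊆ bal r
        prev⊆ zero x p = ⊥-elim (∉∅ p)
        prev⊆ (suc r) x p = ball-suc r p
        apart : ∀ r {x y} → x ∈ prev r → y ∈ bal (suc r) → y ∉ bal r → ¬ x ~ y
        apart zero p _ _ _ = ∉∅ p
        apart (suc r) p m n e = n (ball-step r p e (∉∁W (bal⊆W (suc (suc r)) _ m)))
        ind : ∀ x y → x ∈ odd ⊎ x ∈ layer → y ∈ odd ⊎ y ∈ layer → ¬ x ~ y
        ind x y (inj₁ p) (inj₁ q) = odd-indep x y p q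
        ind x y (inj₁ p) (inj₂ q) = apart r (odd⊆ x p) (∖ˡ q) (∖ʳ q)
        ind x y (inj₂ p) (inj₁ q) e = apart r (odd⊆ y q) (∖ˡ p) (∖ʳ p) (~-sym e)
        ind x y (inj₂ p) (inj₂ q) e = none (x , y , p , q , e)
        cov : ∀ x → x ∈ bal (suc r) → x ∈ bal r ⊎ x ∉ bal r → x ∈ odd ∪ layer ⊎ x ∈ even
        cov x p (inj₁ m) with cover x m
        ... | inj₁ q = inj₂ q
        ... | inj₂ q = inj₁ (∪ˡ q)
        cov x p (inj₂ m) = inj₁ (∪ʳ (∖⁺ p m))

    half-indep : ∀ r → r ≤ suc lam → ∥ Unit W ⊎ Σ[ I ∈ FSet N ] Indep I × I ⊆ bal r × # (bal r) ≤ 2 * # I ∥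
    half-indep r r≤ = do
      inj₂ C ← layers r r≤
        where inj₁ U → return (inj₁ U)
      return (inj₂ (choose C))
      where
      choose : TwoColouring r → Σ[ I ∈ FSet N ] Indep I × I ⊆ bal r × # (bal r) ≤ 2 * # I
      choose C with ≤? (# (TwoColouring.odd C)) (# (TwoColouring.even C))
      ... | inj₁ h = even , even-indep , even⊆ , lin (# (bal r) ∷ # even ∷ # odd ∷ []) (λ b e o → b ≼ e :+ o ∷ o ≼ e ∷ [] ⊢ b ≼ con 2 :* e) (#-⊆+ _ _ _ cover , h , tt)
        where open TwoColouring C
      ... | inj₂ h = odd , odd-indep , (λ x p → sub r x (odd⊆ x p)) , lin (# (bal r) ∷ # even ∷ # odd ∷ []) (λ b e o → b ≼ e :+ o ∷ e ≺ o ∷ [] ⊢ b ≼ con 2 :* o) (#-⊆+ _ _ _ cover , h , tt)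
        where
        open TwoColouring C
        sub : ∀ r → prev r ⊆ bal r
        sub zero x p = ⊥-elim (∉∅ p)
        sub (suc r) x p = ball-suc r p

  unit-mono : ∀ {W W′} → W ⊆ W′ → Unit W → Unit W′
  unit-mono sub U = record { Unit U ; within = λ x p → sub x (Unit.within U x p) }

  -- Balls that stop doubling are pairwise nonadjacent after deleting their boundaries; if none contains
  -- a unit they are bipartite, and a quarter of W is independent.
  unit-or-indep : ∀ m W → # W ≤ m → ∥ Unit W ⊎ Σ[ I ∈ FSet N ] Indep I × I ⊆ W × # W ≤ 4 * # I ∥
  unit-or-indep zero W h = return (inj₂ (∅ , (λ x y p → ⊥-elim (∉∅ p)) , (λ x p → ⊥-elim (∉∅ p)) , ≤-trans h z≤n))
  unit-or-indep (suc m) W h = go (≤? 1 (# W))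
    where
    Result : Set
    Result = Unit W ⊎ Σ[ I ∈ FSet N ] Indep I × I ⊆ W × # W ≤ 4 * # I
    go : 1 ≤ # W ⊎ # W < 1 → ∥ Result ∥
    go (inj₂ p) = return (inj₂ (∅ , (λ x y p → ⊥-elim (∉∅ p)) , (λ x p → ⊥-elim (∉∅ p)) , ≤-trans (ℕP.≤-pred p) z≤n))
    go (inj₁ p) = do
      inj₂ (I , ind , sub , b) ← half-indep (suc lam) ≤-refl
        where inj₁ U → return (inj₁ U)
      let r , r< , d = doubling (∁ W) v (suc lam) (≤-<-trans b (ℕP.*-monoʳ-< 2 (ℕP.<-trans (indep-small I ind) B<2^lam)))
      inj₂ (J , indJ , subJ , bJ) ← half-indep r (<⇒≤ r<)
        where inj₁ U → return (inj₁ U)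
      inj₂ (J′ , indJ′ , subJ′ , bJ′) ← unit-or-indep m (W ∖ bal (suc r)) (smaller r)
        where inj₁ U → return (inj₁ (unit-mono (λ x → ∖ˡ) U))
      return (inj₂ (J ∪ J′ , (λ x y p q → indep r J J′ indJ indJ′ subJ subJ′ x y (∪⁻ p) (∪⁻ q)) ,
        ∪-least (λ x q → bal⊆W r x (subJ x q)) (λ x q → ∖ˡ (subJ′ x q)) ,
        lin (# W ∷ # (bal (suc r)) ∷ # (W ∖ bal (suc r)) ∷ # (bal r) ∷ # J ∷ # J′ ∷ # (J ∪ J′) ∷ [])
          (λ w b′ w′ b j j′ u → w ≼ b′ :+ w′ ∷ b′ ≼ con 2 :* b ∷ 2 ⊠ b ≼ con 2 :* j ∷ w′ ≼ con 4 :* j′ ∷ 4 ⊠ j :+ j′ ≼ u ∷ [] ⊢ w ≼ con 4 :* u)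
          (#-≤+∖ W (bal (suc r)) , d , bJ , bJ′ , #-disjoint J J′ (J ∪ J′) (λ x p q → ∖ʳ (subJ′ x q) (ball-suc r (subJ x p))) (λ x → ∪ˡ) (λ x → ∪ʳ) , tt)))
      where
      v : V
      v = proj₁ (#-witness W p)
      v∈W : v ∈ W
      v∈W = proj₂ (#-witness W p)
      open Layers W v v∈W
      smaller : ∀ r → # (W ∖ bal (suc r)) ≤ m
      smaller r = lin (# W ∷ m ∷ # ⁅ v ⁆ ∷ # (W ∖ bal (suc r)) ∷ []) (λ w m o d → o :+ d ≼ w ∷ w ≼ con 1 :+ m ∷ con 1 ≼ o ∷ [] ⊢ d ≼ m)
        (#-disjoint ⁅ v ⁆ (W ∖ bal (suc r)) W (λ x p q → ∖ʳ q (subst (_∈ bal (suc r)) (∈⁅⁆⁻ p) (ball-start (suc r))))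
          (λ x p → subst (_∈ W) (∈⁅⁆⁻ p) v∈W) (λ x → ∖ˡ) , h , #-pos {x = v} ∈⁅⁆ , tt)
      indep : ∀ r J J′ → Indep J → Indep J′ → J ⊆ bal r → J′ ⊆ W ∖ bal (suc r) → ∀ x y → x ∈ J ⊎ x ∈ J′ → y ∈ J ⊎ y ∈ J′ → ¬ x ~ y
      indep r J J′ i i′ s s′ x y (inj₁ p) (inj₁ q) = i x y p q
      indep r J J′ i i′ s s′ x y (inj₂ p) (inj₂ q) = i′ x y p q
      indep r J J′ i i′ s s′ x y (inj₁ p) (inj₂ q) e = ∖ʳ (s′ y q) (ball-step r (s x p) e (∉∁W (∖ˡ (s′ y q))))
      indep r J J′ i i′ s s′ x y (inj₂ p) (inj₁ q) e = ∖ʳ (s′ x p) (ball-step r (s y q) (~-sym e) (∉∁W (∖ˡ (s′ x p))))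

  unit : ∀ W → 4 * B ≤ # W → ∥ Unit W ∥
  unit W h = do
    inj₂ (I , ind , _ , b) ← unit-or-indep (# W) W ≤-refl
      where inj₁ U → return U
    ⊥-elim (<⇒≱ (ℕP.*-monoʳ-< 4 (indep-small I ind)) (≤-trans h b))

-- A long cycle through Q with adjustable length

module Loops (S : Setting) (C : Alive.Critical S) where
  open Setting S
  open Alive S hiding (module Connect)
  open Units S

  t b h : ℕ
  t = proj₁ C
  b = proj₁ (proj₂ C)
  h = proj₁ (proj₂ (proj₂ C))

  t<lam : t < lam
  t<lam = proj₁ (proj₂ (proj₂ (proj₂ C)))

  private
    region : Region (suc t) b
    region = proj₁ (proj₂ (proj₂ (proj₂ (proj₂ (proj₂ C)))))

  F₀ : FSet N
  F₀ = proj₁ region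

  v₀ : V
  v₀ = proj₁ (proj₂ region)

  F₀-small : # F₀ + suc t * f ≤ lam * f
  F₀-small = proj₁ (proj₂ (proj₂ region))

  open Alive.Connect S t b h t<lam (proj₁ (proj₂ (proj₂ (proj₂ (proj₂ C))))) (proj₂ (proj₂ (proj₂ (proj₂ (proj₂ (proj₂ C))))))
    F₀ v₀ (proj₂ (proj₂ (proj₂ (proj₂ region)))) public

  J : FSet N
  J = ball F₀ v₀ (suc lam)

  J⊆Q : J ⊆ Q
  J⊆Q = ball-mono (≤-trans (≤-reflexive (+-comm 1 lam)) (+-monoʳ-≤ lam (s≤s z≤n)))

  nb-J : ∀ x → x ∈ nb J → x ∈ Q ⊎ x ∈ F₀
  nb-J x m with ∈? F₀
  ... | inj₁ k = inj₂ k
  ... | inj₂ k with nb⁻ m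
  ... | y , yJ , e = inj₁ (subst (λ r → x ∈ ball F₀ v₀ r) (+-comm 2 lam) (ball-step (suc lam) yJ e k))

  J-big : n ≤ # J + # F₀
  J-big = ≤-trans (expand (ball F₀ v₀ lam) (proj₁ (proj₂ (proj₂ (proj₂ region))))) (#-⊆+ _ J F₀ sub)
    where
    sub : ∀ x → x ∈ N[ ball F₀ v₀ lam ] → x ∈ J ⊎ x ∈ F₀
    sub x m with ∪⁻ m
    ... | inj₁ k = inj₁ (ball-suc lam k)
    ... | inj₂ k with ∈? F₀
    ... | inj₁ i = inj₂ i
    ... | inj₂ i with nb⁻ k
    ... | y , yb , e = inj₁ (ball-step lam yb e i)

  alive-anti : ∀ {F F′ v} → F ⊆ F′ → Alive F′ v → Alive F v
  alive-anti sub a = ≤-trans a (#-mono (ball-anti sub lam))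

  path-append : ∀ {u xs e ys v} → Path u xs e → Path e (e ∷ ys) v → Path u (xs ++ ys) v
  path-append stop q = q
  path-append (d ◂ p) q = d ◂ path-append p q

  link-tail : ∀ {e a ys v} inner → Path e (e ∷ inner ++ a ∷ []) a → Path a ys v → Path e (e ∷ inner ++ ys) v
  link-tail {e} inner p q with path-split e inner [] p
  ... | z , p′ , d , _ = join p′ d q

  Ready : FSet N → V → Set
  Ready Y e = ∀ X → # X ≤ kap → Alive (F₀ ∪ Y ∪ X) e

  budget : ∀ {Y k} → # Y + k ≤ f → # (F₀ ∪ Y) + k + t * f ≤ lam * f
  budget {Y} {k} hY = lin (# (F₀ ∪ Y) ∷ # F₀ ∷ # Y ∷ k ∷ t * f ∷ f ∷ lam * f ∷ []) (λ u a y k t f l →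
    u ≼ a :+ y ∷ y :+ k ≼ f ∷ a :+ (f :+ t) ≼ l ∷ [] ⊢ u :+ k :+ t ≼ l) (#-∪ F₀ Y , hY , F₀-small , tt)

  Fresh : FSet N → FSet N → Set
  Fresh Y W = W ⊆ Q × Disjoint W (F₀ ∪ Y) × 4 * B ≤ # W × (∀ v → v ∈ W → ∀ X → # X ≤ kap * 3 → Alive (F₀ ∪ Y ∪ X) v)

  fresh : ∀ Y → # Y ≤ f → ∥ Σ[ W ∈ FSet N ] Fresh Y W ∥
  fresh Y hY = do
    U , hU , alive ← dead-small (F₀ ∪ Y) (lin (# (F₀ ∪ Y) ∷ # F₀ ∷ # Y ∷ t * f ∷ f ∷ lam * f ∷ n ∷ []) (λ u a y t f l n →
      u ≼ a :+ y ∷ y ≼ f ∷ a :+ (f :+ t) ≼ l ∷ l :* con 200 :+ f :* con 200 ≼ n ∷ [] ⊢ u :+ f ≼ n) (#-∪ F₀ Y , hY , F₀-small , n-big , tt))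
    return ((Q ∖ (F₀ ∪ Y)) ∖ U , (λ x p → ∖ˡ (∖ˡ p)) , (λ x p → ∖ʳ (∖ˡ p)) , size U hU , λ v m → alive v (∖ʳ m))
    where
    size : ∀ U → # U < s → 4 * B ≤ # ((Q ∖ (F₀ ∪ Y)) ∖ U)
    size U hU = lin (# J ∷ # Q ∷ # F₀ ∷ # Y ∷ # (F₀ ∪ Y) ∷ # U ∷ # (Q ∖ (F₀ ∪ Y)) ∷ # ((Q ∖ (F₀ ∪ Y)) ∖ U) ∷ t * f ∷ f ∷ lam * f ∷ n ∷ B ∷ s ∷ B * kap ∷ [])
      (λ J Q F Y FY U A W t f l n B s Bk → n ≼ J :+ F ∷ J ≼ Q ∷ Q ≼ FY :+ A ∷ A ≼ U :+ W ∷ FY ≼ F :+ Y ∷ Y ≼ f ∷ 2 ⊠ F :+ (f :+ t) ≼ l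
        ∷ l :* con 200 :+ f :* con 200 ≼ n ∷ U ≺ s ∷ s ≼ B ∷ 5 ⊠ B :* con 10 ≼ Bk ∷ Bk :* con 20 ≼ f ∷ [] ⊢ con 4 :* B ≼ W)
      (J-big , #-mono J⊆Q , #-≤+∖ Q (F₀ ∪ Y) , #-≤+∖ _ U , #-∪ F₀ Y , hY , F₀-small , n-big , hU , s≤B , B≤Bkap , f-big , tt)

  attach : ∀ {Y W e G a z} → Fresh Y W → # Y + kap ≤ f → e ∈ Q → e ∈ Y → Ready Y e → G ⊆ W → # G ≤ kap → a ∈ G → z ∈ G →
    ∥ Σ[ L ∈ Link (F₀ ∪ (Y ∪ G)) e a kap ] Ready (Y ∪ (⟪ Link.inner L ⟫ ∪ G)) z ∥
  attach {Y} {W} {e} {G} {a} {z} (W⊆Q , disj , _ , alive) hY eQ eY ready G⊆ hG aG zG = do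
    L ← connect (F₀ ∪ (Y ∪ G)) e a (λ x → ∪ˡ) size eQ (W⊆Q a (G⊆ a aG)) (alive-anti assoc (ready G hG))
      (alive-anti assoc (alive a (G⊆ a aG) G (≤-trans hG (≤-trans (m≤m+n kap (kap + (kap + 0))) (≤-reflexive (*-comm 3 kap)))))) λ { refl → disj e (G⊆ e aG) (∪ʳ eY) }
    return (L , λ X hX → alive-anti (assoc′ ⟪ Link.inner L ⟫ X) (alive z (G⊆ z zG) (⟪ Link.inner L ⟫ ∪ G ∪ X) (three L X hX)))
    where
    assoc : (F₀ ∪ (Y ∪ G)) ⊆ (F₀ ∪ Y ∪ G)
    assoc = ∪-least (λ x p → ∪ˡ (∪ˡ p)) (∪-least (λ x p → ∪ˡ (∪ʳ p)) (λ x p → ∪ʳ p))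
    assoc′ : ∀ I X → (F₀ ∪ (Y ∪ (I ∪ G)) ∪ X) ⊆ (F₀ ∪ Y ∪ (I ∪ G ∪ X))
    assoc′ I X = ∪-least (∪-least (λ x p → ∪ˡ (∪ˡ p)) (∪-least (λ x p → ∪ˡ (∪ʳ p)) (λ x p → ∪ʳ (∪ˡ p)))) (λ x p → ∪ʳ (∪ʳ p))
    size : # (F₀ ∪ (Y ∪ G)) + t * f ≤ lam * f
    size = lin (# (F₀ ∪ (Y ∪ G)) ∷ # F₀ ∷ # (Y ∪ G) ∷ # Y ∷ # G ∷ kap ∷ t * f ∷ f ∷ lam * f ∷ []) (λ u a yg y g k t f l →
      u ≼ a :+ yg ∷ yg ≼ y :+ g ∷ g ≼ k ∷ y :+ k ≼ f ∷ a :+ (f :+ t) ≼ l ∷ [] ⊢ u :+ t ≼ l) (#-∪ _ _ , #-∪ _ _ , hG , hY , F₀-small , tt)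
    three : (L : Link (F₀ ∪ (Y ∪ G)) e a kap) → ∀ X → # X ≤ kap → # (⟪ Link.inner L ⟫ ∪ G ∪ X) ≤ kap * 3
    three L X hX = lin (# (⟪ Link.inner L ⟫ ∪ G ∪ X) ∷ # (⟪ Link.inner L ⟫ ∪ G) ∷ # ⟪ Link.inner L ⟫ ∷ length (Link.inner L) ∷ # G ∷ # X ∷ kap ∷ [])
      (λ u v i l g x k → u ≼ v :+ x ∷ v ≼ i :+ g ∷ i ≼ l ∷ l ≼ k ∷ g ≼ k ∷ x ≼ k ∷ [] ⊢ u ≼ k :* con 3) (#-∪ _ _ , #-∪ _ _ , #⟪⟫ _ , Link.short L , hG , hX , tt)

  ready-anti : ∀ {Y Y′ e} → Y ⊆ Y′ → Ready Y′ e → Ready Y e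
  ready-anti sub r X hX = alive-anti (∪-least (∪-least (λ x p → ∪ˡ (∪ˡ p)) (λ x p → ∪ˡ (∪ʳ (sub x p)))) (λ x p → ∪ʳ p)) (r X hX)

  record Trail (j : ℕ) : Set where
    field
      first end : V
      verts : List V
      path : Path first verts end
      uniq : Uniq verts
      end∈Q : end ∈ Q
      ready : Ready ⟪ verts ⟫ end
      visits : j ≤ cin Q verts
      short : length verts ≤ suc j * (kap * 2)

  kap-pos : 1 ≤ kap
  kap-pos = ≤-trans (m≤n+m 1 (lam * 2 + 9)) (≤-trans (≤-reflexive (+-assoc (lam * 2) 9 1)) kap-unit)

  kap≤Bkap : kap ≤ B * kap
  kap≤Bkap = ≤-trans (≤-reflexive (sym (+-identityʳ kap))) (*-monoˡ-≤ kap B-pos)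

  #⁅⁆≤kap : ∀ (v : V) → # ⁅ v ⁆ ≤ kap
  #⁅⁆≤kap v = ≤-trans (#-⁅⁆ v) kap-pos

  cin-∈ : ∀ {A : FSet N} {x} xs → x ∈ A → cin A (xs ++ x ∷ []) ≡ cin A xs + 1
  cin-∈ {A} {x} xs m = trans (cin-++ A xs (x ∷ [])) (cong (λ y → cin A xs + (bit y + 0)) (holds m))

  some-trail : ∥ Trail 0 ∥
  some-trail = do
    W , W⊆Q , _ , hW , alive ← fresh ∅ (≤-trans (≤-reflexive (#-∅ {N})) z≤n)
    let x , xW = #-witness W (≤-trans (≤-trans B-pos (m≤m+n B _)) hW)
    return record { first = x ; end = x ; verts = x ∷ [] ; path = stop ; uniq = uniq-[-] x ; end∈Q = W⊆Q x xW
      ; ready = λ X hX → alive-anti (∪-least (∪-least (λ y p → ∪ˡ (∪ˡ p)) (λ y p → ∪ʳ (∪ˡ p))) (λ y p → ∪ʳ (∪ʳ p)))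
          (alive x xW (⟪ x ∷ [] ⟫ ∪ X) (lin (# (⟪ x ∷ [] ⟫ ∪ X) ∷ # ⟪ x ∷ [] ⟫ ∷ # X ∷ kap ∷ []) (λ u o X k → u ≼ o :+ X ∷ o ≼ con 1 ∷ X ≼ k ∷ con 1 ≼ k ∷ [] ⊢ u ≼ k :* con 3)
            (#-∪ _ _ , #⟪⟫ (x ∷ []) , hX , kap-pos , tt)))
      ; visits = z≤n ; short = lin (kap ∷ []) (λ k → con 1 ≼ k ∷ [] ⊢ con 1 ≼ k :* con 2 :+ con 0) (kap-pos , tt) }

  extend-trail : ∀ j → j ≤ 3 * B → Trail j → ∥ Trail (suc j) ∥
  extend-trail j hj T = do
    W , F@(W⊆Q , disj , hW , _) ← fresh ⟪ verts ⟫ (≤-trans (m≤m+n _ kap) room)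
    let x , xW = #-witness W (≤-trans (≤-trans B-pos (m≤m+n B _)) hW)
    L , rdy ← attach {G = ⁅ x ⁆} {x} {x} F room end∈Q (end∈ path) ready (λ y p → subst (_∈ W) (∈⁅⁆⁻ p) xW) (#⁅⁆≤kap x) ∈⁅⁆ ∈⁅⁆
    return (grow x L (λ m → disj x xW (∪ʳ m)) (W⊆Q x xW) rdy)
    where
    open Trail T
    room : # ⟪ verts ⟫ + kap ≤ f
    room = lin (# ⟪ verts ⟫ ∷ length verts ∷ kap ∷ j * (kap * 2) ∷ 3 * B * (kap * 2) ∷ B * kap ∷ f ∷ []) (λ y l k jk bk Bk f →
      y ≼ l ∷ l ≼ k :* con 2 :+ jk ∷ jk ≼ bk ∷ bk ≼ Bk :* con 6 ∷ 3 ⊠ k ≼ Bk ∷ Bk :* con 20 ≼ f ∷ [] ⊢ y :+ k ≼ f)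
      (#⟪⟫ verts , short , *-monoˡ-≤ (kap * 2) hj , lin (B ∷ kap ∷ []) (λ b k → [] ⊢ con 3 :* b :* (k :* con 2) ≼ b :* k :* con 6) tt , kap≤Bkap , f-big , tt)
    grow : ∀ x (L : Link (F₀ ∪ (⟪ verts ⟫ ∪ ⁅ x ⁆)) end x kap) → x ∉ ⟪ verts ⟫ → x ∈ Q → Ready (⟪ verts ⟫ ∪ (⟪ Link.inner L ⟫ ∪ ⁅ x ⁆)) x → Trail (suc j)
    grow x L x∉ xQ rdy = record { first = first ; end = x ; verts = verts ++ (L.inner ++ x ∷ []) ; path = path-append path L.path
      ; uniq = uniq-++ verts (L.inner ++ x ∷ []) uniq (uniq-tail end (L.inner ++ x ∷ []) L.uniq) (λ y p q → case ∈-++⁻ L.inner q of λ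
          { (inj₁ r) → L.avoids y r (∪ʳ (∪ˡ p)) ; (inj₂ r) → case ∈-∷⁻ r of λ { (inj₁ refl) → x∉ p ; (inj₂ r′) → ∉[] r′ } })
      ; end∈Q = xQ
      ; ready = ready-anti (λ y p → case ∈-++⁻ verts p of λ { (inj₁ q) → ∪ˡ q ; (inj₂ q) → ∪ʳ (case ∈-++⁻ L.inner q of λ
          { (inj₁ r) → ∪ˡ r ; (inj₂ r) → ∪ʳ (case ∈-∷⁻ r of λ { (inj₁ refl) → ∈⁅⁆ ; (inj₂ r′) → ⊥-elim (∉[] r′) }) }) }) rdy
      ; visits = lin (j ∷ cin Q verts ∷ cin Q (L.inner ++ x ∷ []) ∷ cin Q L.inner ∷ cin Q (verts ++ (L.inner ++ x ∷ [])) ∷ []) (λ j v i l a →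
          j ≼ v ∷ v :+ i ≼ a ∷ l :+ con 1 ≼ i ∷ [] ⊢ con 1 :+ j ≼ a) (visits , ≤-reflexive (sym (cin-++ Q verts _)) , ≤-reflexive (sym (cin-∈ L.inner xQ)) , tt)
      ; short = lin (length verts ∷ length L.inner ∷ length (L.inner ++ x ∷ []) ∷ length (verts ++ (L.inner ++ x ∷ [])) ∷ kap ∷ j * (kap * 2) ∷ []) (λ v i ix a k jk →
          a ≼ v :+ ix ∷ ix ≼ i :+ con 1 ∷ i ≼ k ∷ v ≼ k :* con 2 :+ jk ∷ con 1 ≼ k ∷ [] ⊢ a ≼ k :* con 2 :+ (k :* con 2 :+ jk))
          (≤-reflexive (length-++ verts) , ≤-reflexive (length-++ L.inner) , L.short , short , kap-pos , tt) }
      where module L = Link L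

  trail : ∀ j → j ≤ suc (3 * B) → ∥ Trail j ∥
  trail zero _ = some-trail
  trail (suc j) (s≤s h) = trail j (≤-trans h (n≤1+n _)) >>= extend-trail j h

module Chains (S : Setting) (C : Alive.Critical S) where
  open Setting S
  open Alive S hiding (module Connect)
  open Units S
  open Loops S C

  flex-start : ∀ {u v lo r X} → Flex u v lo r X → u ∈ X
  flex-start fl with fl 0 z≤n
  ... | xs , p , _ , _ , sub = sub _ (start∈ p)

  flex-end : ∀ {u v lo r X} → Flex u v lo r X → v ∈ X
  flex-end fl with fl 0 z≤n
  ... | xs , p , _ , _ , sub = sub _ (end∈ p)

  flex-lo : ∀ {u v lo r X} → Flex u v lo r X → lo ≤ # X
  flex-lo {lo = lo} fl with fl 0 z≤n
  ... | xs , _ , u , l , sub = ≤-trans (≤-reflexive (trans (sym (+-identityʳ lo)) (sym l))) (length-≤# xs u sub)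

  flex-join : ∀ {u v a z lo lo′ r X Y F k} → Flex u v lo r X → (L : Link F v a k) → Flex a z lo′ 1 Y → X ⊆ F → Y ⊆ F → Disjoint X Y →
    Flex u z (lo + length (Link.inner L) + lo′) (suc r) (X ∪ (⟪ Link.inner L ⟫ ∪ Y))
  flex-join {u} {v} {a} {z} {lo} {lo′} {r} {X} {Y} fl L gl X⊆ Y⊆ disj j h = pick (≤? j r)
    where
    open Link L
    Goal : ℕ → Set
    Goal j = Σ[ xs ∈ List V ] Path u xs z × Uniq xs × length xs ≡ lo + length inner + lo′ + j × ⟪ xs ⟫ ⊆ X ∪ (⟪ inner ⟫ ∪ Y)
    glue : ∀ i i′ → i ≤ r → i′ ≤ 1 → Goal (i + i′)
    glue i i′ hi hi′ with fl i hi | gl i′ hi′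
    ... | xs , p , ux , lx , sx | ys , q , uy , ly , sy = xs ++ (inner ++ ys) , path-append p (link-tail inner path q) ,
          uniq-++ xs (inner ++ ys) ux (uniq-++ inner ys (uniq-++ˡ inner (a ∷ []) (uniq-tail v (inner ++ a ∷ []) uniq)) uy
            (λ x m m′ → avoids x m (Y⊆ x (sy x m′))))
            (λ x m m′ → case ∈-++⁻ inner m′ of λ { (inj₁ k) → avoids x k (X⊆ x (sx x m)) ; (inj₂ k) → disj x (sx x m) (sy x k) }) ,
          trans (length-++ xs) (trans (cong₂ _+_ lx (trans (length-++ inner) (cong (length inner +_) ly))) (arith lo i (length inner) lo′ i′)) ,
          λ x m → case ∈-++⁻ xs m of λ { (inj₁ k) → ∪ˡ (sx x k) ; (inj₂ k) → ∪ʳ (case ∈-++⁻ inner k of λ { (inj₁ k′) → ∪ˡ k′ ; (inj₂ k′) → ∪ʳ (sy x k′) }) }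
      where
      arith : ∀ a b c d e → a + b + (c + (d + e)) ≡ a + c + d + (b + e)
      arith a b c d e = ℕP.≤-antisym (lin (a ∷ b ∷ c ∷ d ∷ e ∷ []) (λ a b c d e → [] ⊢ a :+ b :+ (c :+ (d :+ e)) ≼ a :+ c :+ d :+ (b :+ e)) tt)
                                     (lin (a ∷ b ∷ c ∷ d ∷ e ∷ []) (λ a b c d e → [] ⊢ a :+ c :+ d :+ (b :+ e) ≼ a :+ b :+ (c :+ (d :+ e))) tt)
    pick : j ≤ r ⊎ r < j → Goal j
    pick (inj₁ p) = subst Goal (+-identityʳ j) (glue j 0 p z≤n)
    pick (inj₂ p) = subst Goal (trans (+-comm r 1) (ℕP.≤-antisym p h)) (glue r 1 ≤-refl ≤-refl)

  record Chain (T : Trail (3 * B)) (r : ℕ) : Set where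
    open Trail T using (first; verts)
    field
      lead : List V
      l e₀ e₁ : V
      lo : ℕ
      X : FSet N
      leadPath : Path first (verts ++ lead) l
      uniq : Uniq (verts ++ lead)
      l~e₀ : l ~ e₀
      flex : Flex e₀ e₁ lo r X
      disj : Disjoint ⟪ verts ++ lead ⟫ X
      e₁∈Q : e₁ ∈ Q
      ready : Ready (⟪ verts ++ lead ⟫ ∪ X) e₁
      X-small : # X ≤ r * (kap * 2)
      lead-short : length lead ≤ kap

  module _ (T : Trail (3 * B)) where
    open Trail T using (first; end; verts; path; end∈Q) renaming (uniq to uniqT; ready to readyT; short to shortT)

    verts-room : # ⟪ verts ⟫ ≤ B * kap * 8
    verts-room = lin (# ⟪ verts ⟫ ∷ length verts ∷ kap ∷ B ∷ B * kap ∷ []) (λ y l k b Bk →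
      y ≼ l ∷ l ≼ (con 1 :+ con 3 :* b) :* (k :* con 2) ∷ 6 ⊠ b :* k ≼ Bk ∷ 2 ⊠ k ≼ Bk ∷ [] ⊢ y ≼ Bk :* con 8)
      (#⟪⟫ verts , shortT , ≤-refl , kap≤Bkap , tt)

    first-unit : ∥ Chain T 1 ∥
    first-unit = do
      W , F@(W⊆Q , disj , hW , _) ← fresh ⟪ verts ⟫ (≤-trans (m≤m+n _ kap) room)
      U ← unit W hW
      let module U = Unit U
      L , rdy ← attach F room end∈Q (end∈ path) readyT U.within U.small (flex-start U.flex) (flex-end U.flex)
      return (start W⊆Q disj U L rdy)
      where
      room : # ⟪ verts ⟫ + kap ≤ f
      room = lin (# ⟪ verts ⟫ ∷ kap ∷ B * kap ∷ f ∷ []) (λ y k Bk f → y ≼ Bk :* con 8 ∷ k ≼ Bk ∷ Bk :* con 20 ≼ f ∷ [] ⊢ y :+ k ≼ f) (verts-room , kap≤Bkap , f-big , tt)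
      start : ∀ {W} → W ⊆ Q → Disjoint W (F₀ ∪ ⟪ verts ⟫) → (U : Unit W) (L : Link (F₀ ∪ (⟪ verts ⟫ ∪ Unit.verts U)) end (Unit.entry U) kap) →
        Ready (⟪ verts ⟫ ∪ (⟪ Link.inner L ⟫ ∪ Unit.verts U)) (Unit.exit U) → Chain T 1
      start W⊆Q disj U L rdy with path-split end (Link.inner L) [] (Link.path L)
      ... | z , p , d , _ = record { lead = L.inner ; l = z ; e₀ = U.entry ; e₁ = U.exit ; lo = U.lo ; X = U.verts
          ; leadPath = path-append path p
          ; uniq = uniq-++ verts L.inner uniqT (uniq-++ˡ L.inner (U.entry ∷ []) (uniq-tail end (L.inner ++ U.entry ∷ []) L.uniq)) (λ x m m′ → L.avoids x m′ (∪ʳ (∪ˡ m)))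
          ; l~e₀ = d ; flex = U.flex
          ; disj = λ x m m′ → case ∈-++⁻ verts m of λ { (inj₁ k) → disj x (U.within x m′) (∪ʳ k) ; (inj₂ k) → L.avoids x k (∪ʳ (∪ʳ m′)) }
          ; e₁∈Q = W⊆Q U.exit (U.within U.exit (flex-end U.flex))
          ; ready = ready-anti (∪-least (λ x m → case ∈-++⁻ verts m of λ { (inj₁ k) → ∪ˡ k ; (inj₂ k) → ∪ʳ (∪ˡ k) }) (λ x m → ∪ʳ (∪ʳ m))) rdy
          ; X-small = lin (# U.verts ∷ kap ∷ []) (λ u k → u ≼ k ∷ [] ⊢ u ≼ k :* con 2 :+ con 0) (U.small , tt)
          ; lead-short = L.short }
        where
        module L = Link L
        module U = Unit U

    chain-room : ∀ {r} → r ≤ 2 * B → (K : Chain T r) → # (⟪ verts ++ Chain.lead K ⟫ ∪ Chain.X K) + kap ≤ f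
    chain-room {r} hr K = lin (# (⟪ verts ++ lead ⟫ ∪ X) ∷ # ⟪ verts ++ lead ⟫ ∷ # X ∷ # ⟪ verts ⟫ ∷ # ⟪ lead ⟫ ∷ length lead ∷ kap ∷ B * kap ∷ f ∷ r * (kap * 2) ∷ B ∷ []) (λ y vl x v l ll k Bk f rk B →
        y ≼ vl :+ x ∷ vl ≼ v :+ l ∷ v ≼ Bk :* con 8 ∷ l ≼ ll ∷ ll ≼ k ∷ x ≼ rk ∷ rk ≼ con 2 :* B :* (k :* con 2) ∷ 4 ⊠ B :* k ≼ Bk ∷ 2 ⊠ k ≼ Bk ∷ Bk :* con 20 ≼ f ∷ [] ⊢ y :+ k ≼ f)
      (#-∪ _ _ , #-⊆+ _ _ _ (λ x → ∈-++⁻ verts) , verts-room , #⟪⟫ lead , lead-short , X-small , *-monoˡ-≤ (kap * 2) hr , ≤-refl , kap≤Bkap , f-big , tt)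
      where open Chain K

    add-unit : ∀ r → r ≤ 2 * B → Chain T r → ∥ Chain T (suc r) ∥
    add-unit r hr K = do
      W , F@(W⊆Q , disjW , hW , _) ← fresh (⟪ verts ++ lead ⟫ ∪ X) (≤-trans (m≤m+n _ kap) (chain-room hr K))
      U ← unit W hW
      let module U = Unit U
      L , rdy ← attach F (chain-room hr K) e₁∈Q (∪ʳ (flex-end flex)) ready U.within U.small (flex-start U.flex) (flex-end U.flex)
      return (longer W⊆Q disjW U L rdy)
      where
      open Chain K
      longer : ∀ {W} → W ⊆ Q → Disjoint W (F₀ ∪ (⟪ verts ++ lead ⟫ ∪ X)) → (U : Unit W) (L : Link (F₀ ∪ ((⟪ verts ++ lead ⟫ ∪ X) ∪ Unit.verts U)) e₁ (Unit.entry U) kap) →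
        Ready ((⟪ verts ++ lead ⟫ ∪ X) ∪ (⟪ Link.inner L ⟫ ∪ Unit.verts U)) (Unit.exit U) → Chain T (suc r)
      longer W⊆Q disjW U L rdy = record { lead = lead ; l = l ; e₀ = e₀ ; e₁ = U.exit ; lo = lo + length L.inner + U.lo ; X = X ∪ (⟪ L.inner ⟫ ∪ U.verts)
          ; leadPath = leadPath ; uniq = uniq ; l~e₀ = l~e₀
          ; flex = flex-join flex L U.flex (λ x m → ∪ʳ (∪ˡ (∪ʳ m))) (λ x m → ∪ʳ (∪ʳ m)) (λ x m m′ → disjW x (U.within x m′) (∪ʳ (∪ʳ m)))
          ; disj = λ x m m′ → case ∪⁻ m′ of λ { (inj₁ k) → disj x m k ; (inj₂ k) → case ∪⁻ k of λ
              { (inj₁ k′) → L.avoids x k′ (∪ʳ (∪ˡ (∪ˡ m))) ; (inj₂ k′) → disjW x (U.within x k′) (∪ʳ (∪ˡ m)) } }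
          ; e₁∈Q = W⊆Q U.exit (U.within U.exit (flex-end U.flex))
          ; ready = ready-anti (∪-least (λ x m → ∪ˡ (∪ˡ m)) (∪-least (λ x m → ∪ˡ (∪ʳ m)) (λ x m → ∪ʳ m))) rdy
          ; X-small = lin (# (X ∪ (⟪ L.inner ⟫ ∪ U.verts)) ∷ # X ∷ # (⟪ L.inner ⟫ ∪ U.verts) ∷ # ⟪ L.inner ⟫ ∷ length L.inner ∷ # U.verts ∷ kap ∷ r * (kap * 2) ∷ []) (λ a x b i li u k rk →
              a ≼ x :+ b ∷ b ≼ i :+ u ∷ i ≼ li ∷ li ≼ k ∷ u ≼ k ∷ x ≼ rk ∷ [] ⊢ a ≼ k :* con 2 :+ rk) (#-∪ _ _ , #-∪ _ _ , #⟪⟫ _ , L.short , U.small , X-small , tt)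
          ; lead-short = lead-short }
        where
        module L = Link L
        module U = Unit U

    chain : ∀ r → suc r ≤ 2 * B → ∥ Chain T (suc r) ∥
    chain zero _ = first-unit
    chain (suc r) h = chain r (<⇒≤ h) >>= add-unit (suc r) (<⇒≤ h)

  record Frame : Set where
    field
      e₀ e₁ hd tl : V
      lo : ℕ
      X : FSet N
      flex : Flex e₀ e₁ lo (2 * B) X
      e₁~hd : e₁ ~ hd
      tl~e₀ : tl ~ e₀
      X-small : # X + B ≤ f

  record Arc (Fr : Frame) : Set where
    open Frame Fr
    field
      arc : List V
      path : Path hd arc tl
      uniq : Uniq arc
      disj : Disjoint ⟪ arc ⟫ X
      visits : 2 * B ≤ cin Q arc

  FirstOutside : FSet N → List V → Set
  FirstOutside U xs = Σ[ as ∈ List V ] Σ[ a ∈ V ] Σ[ bs ∈ List V ] xs ≡ as ++ a ∷ bs × a ∈ Q × a ∉ U × cin Q xs ≤ cin U as + cin Q (a ∷ bs)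

  first-outside : ∀ U xs → cin Q xs ≤ cin U xs ⊎ FirstOutside U xs
  first-outside U [] = inj₁ z≤n
  first-outside U (x ∷ xs) = go (∈? Q) (∈? U)
    where
    skip : bit (Q x) ≤ bit (U x) → cin Q xs ≤ cin U xs ⊎ FirstOutside U xs → cin Q (x ∷ xs) ≤ cin U (x ∷ xs) ⊎ FirstOutside U (x ∷ xs)
    skip le (inj₁ h) = inj₁ (+-mono-≤ le h)
    skip le (inj₂ (as , a , bs , refl , aQ , aU , h)) = inj₂ (x ∷ as , a , bs , refl , aQ , aU ,
      ≤-trans (+-mono-≤ le h) (≤-reflexive (sym (+-assoc (bit (U x)) _ _))))
    zeroBit : x ∉ Q → bit (Q x) ≤ 0
    zeroBit n with Q x in e
    ... | true = ⊥-elim (n (mem e))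
    ... | false = z≤n
    go : x ∈ Q ⊎ x ∉ Q → x ∈ U ⊎ x ∉ U → cin Q (x ∷ xs) ≤ cin U (x ∷ xs) ⊎ FirstOutside U (x ∷ xs)
    go (inj₁ q) (inj₂ u) = inj₂ ([] , x , xs , refl , q , u , ≤-refl)
    go (inj₁ (mem q)) (inj₁ (mem u)) = skip (≤-reflexive (trans (cong bit q) (cong bit (sym u)))) (first-outside U xs)
    go (inj₂ q) _ = skip (≤-trans (zeroBit q) z≤n) (first-outside U xs)

  Closed : Set
  Closed = Σ[ Fr ∈ Frame ] Σ[ A ∈ Arc Fr ] Frame.lo Fr + length (Arc.arc A) ≤ n

  loop : ∥ Closed ∥
  loop = do
    T ← trail (3 * B) (n≤1+n _)
    let r , e = pred2B B-pos
    K ← chain T r (≤-reflexive e)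
    U , hU , alive ← dead-small (F₀ ∪ (⟪ Trail.verts T ++ Chain.lead K ⟫ ∪ Chain.X K)) (room′ T r e K)
    close T r e K U hU alive (first-outside U (Trail.verts T))
    where
    pred2B : ∀ {B} → 1 ≤ B → Σ[ r ∈ ℕ ] suc r ≡ 2 * B
    pred2B {suc B} _ = _ , refl
    module _ (T : Trail (3 * B)) (r : ℕ) (sucr : suc r ≡ 2 * B) (K : Chain T (suc r)) where
      open Trail T using (verts) renaming (uniq to uniqT; visits to visitsT)
      open Chain K
      hr : suc r ≤ 2 * B
      hr = ≤-reflexive sucr
      F : FSet N
      F = F₀ ∪ (⟪ verts ++ lead ⟫ ∪ X)
      room′ : # F + f ≤ n
      room′ = lin (# F ∷ # F₀ ∷ # (⟪ verts ++ lead ⟫ ∪ X) ∷ kap ∷ f ∷ t * f ∷ lam * f ∷ n ∷ []) (λ F a y k f t l n →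
        F ≼ a :+ y ∷ y :+ k ≼ f ∷ a :+ (f :+ t) ≼ l ∷ l :* con 200 :+ f :* con 200 ≼ n ∷ [] ⊢ F :+ f ≼ n) (#-∪ _ _ , chain-room T hr K , F₀-small , n-big , tt)
      close : (U : FSet N) → # U < s → (∀ v → v ∉ U → ∀ X → # X ≤ kap * 3 → Alive (F ∪ X) v) →
        cin Q verts ≤ cin U verts ⊎ FirstOutside U verts →
        ∥ Closed ∥
      close U hU alive (inj₁ le) = ⊥-elim (ℕP.<-irrefl refl (lin (cin Q verts ∷ cin U verts ∷ # U ∷ s ∷ B ∷ []) (λ q u U s B →
        con 3 :* B ≼ q ∷ q ≼ u ∷ u ≼ U ∷ U ≺ s ∷ s ≼ B ∷ [] ⊢ q ≺ q) (visitsT , le , cin-≤# U verts uniqT , hU , s≤B , tt)))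
      close U hU alive (inj₂ (as , a , bs , eq , aQ , a∉U , cnts)) = do
        L ← connect F e₁ a (λ x → ∪ˡ) (≤-trans (+-monoˡ-≤ (t * f) (m≤m+n (# F) kap)) (budget (chain-room T hr K))) e₁∈Q aQ
          (alive-anti (λ x → ∪ˡ) (ready ∅ (≤-trans (≤-reflexive (#-∅ {N})) z≤n)))
          (alive-anti (λ x → ∪ˡ) (alive a a∉U ∅ (≤-trans (≤-reflexive (#-∅ {N})) z≤n))) e₁≢a
        return (finish L (link-tail (Link.inner L) (Link.path L) suffix))
        where
        whole : verts ++ lead ≡ as ++ a ∷ (bs ++ lead)
        whole = trans (cong (_++ lead) eq) (++-assoc as (a ∷ bs) lead)
        suffix : Path a (a ∷ bs ++ lead) l
        suffix = path-suffix as (bs ++ lead) (subst (λ xs → Path _ xs l) whole leadPath)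
        suffix⊆ : ⟪ a ∷ bs ++ lead ⟫ ⊆ ⟪ verts ++ lead ⟫
        suffix⊆ x m = subst (λ xs → x ∈ ⟪ xs ⟫) (sym whole) (∈-++ʳ as m)
        e₁≢a : e₁ ≢ a
        e₁≢a refl = disj a (suffix⊆ a ∈-head) (flex-end flex)
        finish : (L : Link F e₁ a kap) → Path e₁ (e₁ ∷ Link.inner L ++ a ∷ bs ++ lead) l → Closed
        finish L q = split q refl
          where
          module L = Link L
          list : List V
          list = L.inner ++ a ∷ bs ++ lead
          total : lo + length list ≤ n
          total = lin (lo ∷ length list ∷ length L.inner ∷ length (a ∷ bs ++ lead) ∷ kap ∷ # X ∷ # (⟪ verts ++ lead ⟫ ∪ X) ∷ f ∷ n ∷ lam * f ∷ []) (λ lo a i b k X y f n l →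
            lo ≼ X ∷ a ≼ i :+ b ∷ i ≼ k ∷ b :+ X ≼ y ∷ y :+ k ≼ f ∷ l :* con 200 :+ f :* con 200 ≼ n ∷ [] ⊢ lo :+ a ≼ n)
            (flex-lo flex , ≤-reflexive (length-++ L.inner) , L.short ,
             ≤-trans (+-monoˡ-≤ (# X) (length-≤# (a ∷ bs ++ lead) (uniq-++ʳ as (a ∷ bs ++ lead) (subst Uniq whole uniq)) suffix⊆))
               (#-disjoint ⟪ verts ++ lead ⟫ X _ disj (λ x → ∪ˡ) (λ x → ∪ʳ)) , chain-room T hr K , n-big , tt)
          split : ∀ {zs} → Path e₁ zs l → zs ≡ e₁ ∷ list → Closed
          split stop e = ⊥-elim (nonempty L.inner (cong (drop 1) e))
            where
            nonempty : ∀ xs → [] ≡ xs ++ a ∷ bs ++ lead → ⊥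
            nonempty [] ()
            nonempty (_ ∷ _) ()
          split (_◂_ {w = w} d p) refl = record { e₀ = e₀ ; e₁ = e₁ ; hd = w ; tl = l ; lo = lo ; X = X
              ; flex = λ j hj → flex j (≤-trans hj (≤-reflexive (sym sucr)))
              ; e₁~hd = d ; tl~e₀ = l~e₀ ; X-small = X-small′ } ,
            record { arc = list ; path = p
              ; uniq = uniq-++ L.inner (a ∷ bs ++ lead) (uniq-++ˡ L.inner (a ∷ []) (uniq-tail e₁ (L.inner ++ a ∷ []) L.uniq))
                  (uniq-++ʳ as (a ∷ bs ++ lead) (subst Uniq whole uniq)) (λ x m m′ → L.avoids x m (∪ʳ (∪ˡ (suffix⊆ x m′))))
              ; disj = λ x m m′ → case ∈-++⁻ L.inner m of λ { (inj₁ k) → L.avoids x k (∪ʳ (∪ʳ m′)) ; (inj₂ k) → disj x (suffix⊆ x k) m′ }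
              ; visits = lin (B ∷ s ∷ cin Q verts ∷ # U ∷ cin U as ∷ cin Q (a ∷ bs) ∷ cin Q list ∷ cin Q L.inner ∷ cin Q (a ∷ bs ++ lead) ∷ cin Q lead ∷ []) (λ B s v U u ab tot i abl l →
                  con 3 :* B ≼ v ∷ v ≼ u :+ ab ∷ u ≼ U ∷ U ≺ s ∷ s ≼ B ∷ i :+ abl ≼ tot ∷ ab :+ l ≼ abl ∷ [] ⊢ con 2 :* B ≼ tot)
                  (visitsT , cnts , cin-≤# U as (uniq-++ˡ as (a ∷ bs) (subst Uniq eq uniqT)) , hU , s≤B , ≤-reflexive (sym (cin-++ Q L.inner _)) , ≤-reflexive (sym (cin-++ Q (a ∷ bs) lead)) , tt) } ,
            total
            where
            X-small′ : # X + B ≤ f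
            X-small′ = lin (# X ∷ B ∷ kap ∷ suc r * (kap * 2) ∷ B * kap ∷ f ∷ []) (λ x B k rk Bk f → x ≼ rk ∷ rk ≼ con 2 :* B :* (k :* con 2) ∷ 4 ⊠ B :* k ≼ Bk ∷ B :* con 10 ≼ Bk ∷ Bk :* con 20 ≼ f ∷ [] ⊢ x :+ B ≼ f)
              (X-small , *-monoˡ-≤ (kap * 2) hr , ≤-refl , B≤Bkap , f-big , tt)

-- Chords

module Chords (S : Setting) where
  open Setting S

  ~? : ∀ x y → x ~ y ⊎ ¬ x ~ y
  ~? x y with adj x y in e
  ... | true = inj₁ (edge e)
  ... | false = inj₂ λ p → case trans (sym e) (isEdge p) of λ ()

  findNb : ∀ x l → (∀ y → y ∈ ⟪ l ⟫ → ¬ x ~ y) ⊎ Σ[ y ∈ V ] y ∈ ⟪ l ⟫ × x ~ y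
  findNb x [] = inj₁ λ y m → ⊥-elim (∉[] m)
  findNb x (z ∷ l) with ~? x z | findNb x l
  ... | inj₁ e | _ = inj₂ (z , ∈-head , e)
  ... | inj₂ n | inj₂ (y , m , e) = inj₂ (y , ∈-tail m , e)
  ... | inj₂ n | inj₁ none = inj₁ λ y m → case ∈-∷⁻ m of λ { (inj₁ refl) → n ; (inj₂ k) → none y k }

  Scattered : List V → Set
  Scattered l = ∀ x y → x ∈ ⟪ l ⟫ → y ∈ ⟪ l ⟫ → ¬ x ~ y

  scattered-∷ : ∀ {z l} → (∀ y → y ∈ ⟪ l ⟫ → ¬ z ~ y) → Scattered l → Scattered (z ∷ l)
  scattered-∷ f g x y p q with ∈-∷⁻ p | ∈-∷⁻ q
  ... | inj₁ refl | inj₁ refl = ~-irr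
  ... | inj₁ refl | inj₂ k = f y k
  ... | inj₂ k | inj₁ refl = λ e → f x k (~-sym e)
  ... | inj₂ k | inj₂ k′ = g x y k k′

  scattered-short : ∀ l → Uniq l → Scattered l → length l < B
  scattered-short l u sc = ≤-<-trans (length-≤# l u (λ x m → m)) (indep-small ⟪ l ⟫ sc)

  alternate : List V → List V
  alternate [] = []
  alternate (z ∷ []) = z ∷ []
  alternate (z ∷ w ∷ l) = z ∷ alternate l

  cnt-alternate : ∀ x l → cnt x (alternate l) ≤ cnt x l
  cnt-alternate x [] = z≤n
  cnt-alternate x (z ∷ []) = ≤-refl
  cnt-alternate x (z ∷ w ∷ l) = +-monoʳ-≤ (bit (does (z ≟ x))) (≤-trans (cnt-alternate x l) (m≤n+m _ _))

  length-alternate : ∀ l → length l ≤ 2 * length (alternate l)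
  length-alternate [] = z≤n
  length-alternate (z ∷ []) = s≤s z≤n
  length-alternate (z ∷ w ∷ l) = ≤-trans (s≤s (s≤s (length-alternate l))) (≤-reflexive (sym (ℕP.*-suc 2 _)))

  record AltChord (l : List V) : Set where
    field
      as bs cs : List V
      x w y : V
      split : l ≡ as ++ x ∷ w ∷ bs ++ y ∷ cs
      x~y : x ~ y

  alt-chord : ∀ l → Scattered (alternate l) ⊎ AltChord l
  alt-chord [] = inj₁ λ x y m → ⊥-elim (∉[] m)
  alt-chord (z ∷ []) = inj₁ (scattered-∷ (λ y m → ⊥-elim (∉[] m)) λ x y m → ⊥-elim (∉[] m))
  alt-chord (z ∷ w ∷ l) with findNb z (alternate l) | alt-chord l
  ... | inj₁ f | inj₁ sc = inj₁ (scattered-∷ f sc)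
  ... | inj₁ f | inj₂ c = inj₂ record { AltChord c ; as = z ∷ w ∷ AltChord.as c ; split = cong (λ l → z ∷ w ∷ l) (AltChord.split c) }
  ... | inj₂ (y , m , e) | _ with ∈-split l (cnt⇒∈⟪⟫ l (≤-trans (∈⟪⟫⇒cnt (alternate l) m) (cnt-alternate y l)))
  ... | bs , cs , refl = inj₂ record { as = [] ; bs = bs ; cs = cs ; x = z ; w = w ; y = y ; split = refl ; x~y = e }

  shorten : ∀ {u v} m xs → length xs ≤ m → Path u xs v → Uniq xs → Σ[ ys ∈ List V ] Path u ys v × Uniq ys × ⟪ ys ⟫ ⊆ ⟪ xs ⟫ × length ys ≤ 2 * B
  shorten {u} {v} m xs h p q with ≤? (length xs) (2 * B)
  ... | inj₁ le = xs , p , q , (λ x k → k) , le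
  shorten {u} {v} zero xs h p q | inj₂ gt = ⊥-elim (<⇒≱ gt (≤-trans h z≤n))
  shorten {u} {v} (suc m) xs h p q | inj₂ gt with alt-chord xs
  ... | inj₁ sc = ⊥-elim (<⇒≱ gt (≤-trans (length-alternate xs) (*-monoʳ-≤ 2 (<⇒≤ (scattered-short (alternate xs) (λ x → ≤-trans (cnt-alternate x xs) (q x)) sc)))))
  ... | inj₂ record { as = as ; bs = bs ; cs = cs ; x = x ; w = w ; y = y ; split = refl ; x~y = e }
    = widen (shorten m short (ℕP.≤-pred (≤-trans shorter h)) path (λ z → ≤-trans (cnt≤ z) (q z)))
    where
    short : List V
    short = (as ++ x ∷ []) ++ y ∷ cs
    path : Path u short v
    path = join (path-prefix as _ p) e (path-suffix (as ++ x ∷ w ∷ bs) cs (subst (λ l → Path u l v) (sym (++-assoc as (x ∷ w ∷ bs) (y ∷ cs))) p))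
    cnt≤ : ∀ z → cnt z short ≤ cnt z xs
    cnt≤ z rewrite cnt-++ z (as ++ x ∷ []) (y ∷ cs) | cnt-++ z as (x ∷ []) | cnt-++ z as (x ∷ w ∷ bs ++ y ∷ cs) | cnt-++ z bs (y ∷ cs) =
      lin (cnt z as ∷ bit (does (x ≟ z)) ∷ bit (does (w ≟ z)) ∷ cnt z bs ∷ bit (does (y ≟ z)) ∷ cnt z cs ∷ [])
        (λ a x w b y c → [] ⊢ a :+ (x :+ con 0) :+ (y :+ c) ≼ a :+ (x :+ (w :+ (b :+ (y :+ c))))) tt
    shorter : suc (length short) ≤ length xs
    shorter rewrite length-++ (as ++ x ∷ []) {y ∷ cs} | length-++ as {x ∷ []} | length-++ as {x ∷ w ∷ bs ++ y ∷ cs} | length-++ bs {y ∷ cs} =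
      lin (length as ∷ length bs ∷ length cs ∷ []) (λ a b c → [] ⊢ con 1 :+ (a :+ con 1 :+ (con 1 :+ c)) ≼ a :+ (con 1 :+ (con 1 :+ (b :+ (con 1 :+ c))))) tt
    widen : (Σ[ ys ∈ List V ] Path u ys v × Uniq ys × ⟪ ys ⟫ ⊆ ⟪ short ⟫ × length ys ≤ 2 * B) → Σ[ ys ∈ List V ] Path u ys v × Uniq ys × ⟪ ys ⟫ ⊆ ⟪ xs ⟫ × length ys ≤ 2 * B
    widen (ys , p , u , sub , l) = ys , p , u , (λ z m → cnt⇒∈⟪⟫ xs (≤-trans (∈⟪⟫⇒cnt short (sub z m)) (cnt≤ z))) , l

  module Successors (P : FSet N) where

    succs : V → List V → List V
    succs x [] = []
    succs x (y ∷ zs) = if P x then y ∷ succs y zs else succs y zs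

    cnt-succs : ∀ w x zs → cnt w (succs x zs) ≤ cnt w zs
    cnt-succs w x [] = z≤n
    cnt-succs w x (y ∷ zs) with P x
    ... | true = +-monoʳ-≤ _ (cnt-succs w y zs)
    ... | false = ≤-trans (cnt-succs w y zs) (m≤n+m _ _)

    length-succs : ∀ x zs → cin P (x ∷ zs) ≤ suc (length (succs x zs))
    length-succs x [] with P x
    ... | true = s≤s z≤n
    ... | false = z≤n
    length-succs x (y ∷ zs) with P x
    ... | true = s≤s (length-succs y zs)
    ... | false = length-succs y zs

    ∈-succs : ∀ {c} x zs → c ∈ ⟪ succs x zs ⟫ → Σ[ ms ∈ List V ] Σ[ a ∈ V ] Σ[ cs ∈ List V ] x ∷ zs ≡ ms ++ a ∷ c ∷ cs × a ∈ P
    ∈-succs x [] m = ⊥-elim (∉[] m)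
    ∈-succs {c} x (y ∷ zs) m with P x in e
    ... | false with ∈-succs y zs m
    ... | ms , a , cs , eq , aP = x ∷ ms , a , cs , cong (x ∷_) eq , aP
    ∈-succs {c} x (y ∷ zs) m | true with ∈-∷⁻ m
    ... | inj₁ refl = [] , x , zs , refl , mem e
    ... | inj₂ k with ∈-succs y zs k
    ... | ms , a , cs , eq , aP = x ∷ ms , a , cs , cong (x ∷_) eq , aP

    record SuccChord (l : List V) : Set where
      field
        as ws ms cs : List V
        a c a′ c′ : V
        split : l ≡ as ++ a ∷ c ∷ ws
        split′ : c ∷ ws ≡ ms ++ a′ ∷ c′ ∷ cs
        a∈P : a ∈ P
        a′∈P : a′ ∈ P
        c~c′ : c ~ c′

    succ-chord : ∀ x zs → Scattered (succs x zs) ⊎ SuccChord (x ∷ zs)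
    succ-chord x [] = inj₁ λ x y m → ⊥-elim (∉[] m)
    succ-chord x (y ∷ zs) with P x in e | succ-chord y zs
    ... | _ | inj₂ c = inj₂ record { SuccChord c ; as = x ∷ SuccChord.as c ; split = cong (x ∷_) (SuccChord.split c) }
    ... | false | inj₁ sc = inj₁ sc
    ... | true | inj₁ sc with findNb y (succs y zs)
    ... | inj₁ f = inj₁ (scattered-∷ f sc)
    ... | inj₂ (c′ , m , d) with ∈-succs y zs m
    ... | ms , a′ , cs , eq , a′P = inj₂ record { as = [] ; ws = zs ; ms = ms ; cs = cs ; a = x ; c = y ; a′ = a′ ; c′ = c′
          ; split = refl ; split′ = eq ; a∈P = mem e ; a′∈P = a′P ; c~c′ = d }

-- Growing the arc

module Growth (S : Setting) (C : Alive.Critical S) where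
  open Setting S
  open Alive S hiding (module Connect)
  open Units S
  open Loops S C
  open Chains S C
  open Chords S

  module _ (Fr : Frame) where
    open Frame Fr

    close : (A : Arc Fr) → ∀ j → j ≤ 2 * B → Cycle (lo + j + length (Arc.arc A))
    close A j hj with flex j hj
    ... | xs , p , u , l , sub = record { verts = xs ++ arc ; first = e₀ ; end = tl ; path = join p e₁~hd path ; closing = tl~e₀
          ; uniq = uniq-++ xs arc u uniq (λ x m m′ → disj x m′ (sub x m)) ; size = trans (length-++ xs) (cong (_+ length arc) l) }
      where open Arc A

    module Step (A : Arc Fr) where
      open Arc A

      Z : FSet N
      Z = X ∪ ⟪ arc ⟫

      Longer : Set
      Longer = Σ[ A′ ∈ Arc Fr ] length arc < length (Arc.arc A′) × length (Arc.arc A′) ≤ length arc + 2 * B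

      module _ (v : V) (v∉Z : v ∉ Z) (D : FSet N) (comp : Comprehends D (λ y → Σ[ r ∈ ℕ ] y ∈ ball Z v r)) where

        D-off : ∀ {y} → y ∈ D → y ∉ Z
        D-off {y} m with proj₁ (comp y) m
        ... | r , k with ball-off r k
        ... | inj₁ refl = v∉Z
        ... | inj₂ n = n

        D-closed : ∀ {y w} → y ∈ D → y ~ w → w ∉ Z → w ∈ D
        D-closed {y} {w} m e n with proj₁ (comp y) m
        ... | r , k = proj₂ (comp w) (suc r , ball-step r k e n)

        detour : ∀ {d d′} → d ∈ D → d′ ∈ D → Σ[ ds ∈ List V ] Path d ds d′ × Uniq ds × Disjoint ⟪ ds ⟫ Z × length ds ≤ 2 * B
        detour {d} {d′} m m′ with proj₁ (comp d) m | proj₁ (comp d′) m′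
        ... | r , k | r′ , k′ = cut (ball-path (suc r + r′) (ball-trans (suc r) r′ back d′ k′))
          where
          back : v ∈ ball Z d (suc r)
          back with backtrack r 0 {d} k ball-zero⁺
          ... | inj₁ i = ball-suc r i
          ... | inj₂ (p , i , e) = ball-step r i e v∉Z
          off : ∀ x → x ∈ ball Z d (suc r + r′) → x ∉ Z
          off x i with ball-off (suc r + r′) i
          ... | inj₁ refl = D-off m
          ... | inj₂ n = n
          cut : (Σ[ xs ∈ List V ] Path d xs d′ × Uniq xs × length xs ≤ suc (suc r + r′) × ⟪ xs ⟫ ⊆ ball Z d (suc r + r′)) →
            Σ[ ds ∈ List V ] Path d ds d′ × Uniq ds × Disjoint ⟪ ds ⟫ Z × length ds ≤ 2 * B
          cut (xs , p , u , _ , sub) with shorten (length xs) xs ≤-refl p u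
          ... | ys , p′ , u′ , sub′ , l = ys , p′ , u′ , (λ x i → off x (sub x (sub′ x i))) , l

        open Successors (nb D)

        reroute : SuccChord arc → Longer
        reroute ch with nb⁻ (SuccChord.a∈P ch) | nb⁻ (SuccChord.a′∈P ch)
        ... | d , dD , d~a | d′ , d′D , d′~a′ with detour dD d′D
        ... | ds , p , u , off , short = record { arc = new ; path = newPath ; uniq = λ x → ≤-trans (≤-reflexive (cnt-new x)) (uniq⁺ x)
              ; disj = λ x m m′ → case ∈-++⁻ ds (cnt⇒∈⟪⟫ (ds ++ arc) (≤-trans (∈⟪⟫⇒cnt new m) (≤-reflexive (cnt-new x)))) of λ
                  { (inj₁ k) → off x k (∪ˡ m′) ; (inj₂ k) → disj x k m′ }
              ; visits = ≤-trans visits (≤-trans (m≤n+m _ (cin Q ds)) (≤-reflexive (sym (cin-new Q)))) } ,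
            ≤-trans (+-monoˡ-≤ (length arc) (nonempty p)) (≤-reflexive (sym length-new)) ,
            ≤-trans (≤-reflexive (trans length-new (+-comm (length ds) _))) (+-monoʳ-≤ (length arc) short)
          where
          open SuccChord ch
          nonempty : ∀ {u xs v} → Path u xs v → 1 ≤ length xs
          nonempty stop = s≤s z≤n
          nonempty (_ ◂ _) = s≤s z≤n
          new : List V
          new = (as ++ a ∷ []) ++ (ds ++ (reverse (ms ++ a′ ∷ []) ++ c′ ∷ cs))
          whole : arc ≡ as ++ a ∷ (ms ++ a′ ∷ c′ ∷ cs)
          whole = trans split (cong (λ l → as ++ a ∷ l) split′)
          later : Path c (ms ++ a′ ∷ c′ ∷ cs) tl
          later = subst (λ l → Path c l tl) split′ (path-suffix (as ++ a ∷ []) ws (subst (λ l → Path hd l tl) (trans split (sym (++-assoc as (a ∷ []) (c ∷ ws)))) path))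
          newPath : Path hd new tl
          newPath = join (path-prefix as (c ∷ ws) (subst (λ l → Path hd l tl) split path)) (~-sym d~a)
            (join p d′~a′ (join (path-reverse (path-prefix ms (c′ ∷ cs) later)) c~c′
              (path-suffix (ms ++ a′ ∷ []) cs (subst (λ l → Path c l tl) (sym (++-assoc ms (a′ ∷ []) (c′ ∷ cs))) later))))
          uniq⁺ : Uniq (ds ++ arc)
          uniq⁺ = uniq-++ ds arc u uniq (λ x m m′ → off x m (∪ʳ m′))
          cin-new : ∀ T → cin T new ≡ cin T ds + cin T arc
          cin-new T = ℕP.≤-antisym (lin ρ (λ as a ds ms a′ c′ cs → [] ⊢ lhs as a ds ms a′ c′ cs ≼ rhs as a ds ms a′ c′ cs) tt ⟨ eqˡ , eqʳ ⟩) (lin ρ (λ as a ds ms a′ c′ cs → [] ⊢ rhs as a ds ms a′ c′ cs ≼ lhs as a ds ms a′ c′ cs) tt ⟨ eqʳ , eqˡ ⟩)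
            where
            ρ : Vec ℕ 7
            ρ = cin T as ∷ bit (T a) ∷ cin T ds ∷ cin T ms ∷ bit (T a′) ∷ bit (T c′) ∷ cin T cs ∷ []
            lhs rhs : (as a ds ms a′ c′ cs : Expr) → Expr
            lhs as a ds ms a′ c′ cs = as :+ (a :+ con 0) :+ (ds :+ (ms :+ (a′ :+ con 0) :+ (c′ :+ cs)))
            rhs as a ds ms a′ c′ cs = ds :+ (as :+ (a :+ (ms :+ (a′ :+ (c′ :+ cs)))))
            eqˡ : cin T new ≡ cin T as + (bit (T a) + 0) + (cin T ds + (cin T ms + (bit (T a′) + 0) + (bit (T c′) + cin T cs)))
            eqˡ rewrite cin-++ T (as ++ a ∷ []) (ds ++ (reverse (ms ++ a′ ∷ []) ++ c′ ∷ cs)) | cin-++ T as (a ∷ []) | cin-++ T ds (reverse (ms ++ a′ ∷ []) ++ c′ ∷ cs)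
              | cin-++ T (reverse (ms ++ a′ ∷ [])) (c′ ∷ cs) | cin-reverse T (ms ++ a′ ∷ []) | cin-++ T ms (a′ ∷ []) = refl
            eqʳ : cin T ds + cin T arc ≡ cin T ds + (cin T as + (bit (T a) + (cin T ms + (bit (T a′) + (bit (T c′) + cin T cs)))))
            eqʳ = cong (cin T ds +_) (trans (cong (cin T) whole) (trans (cin-++ T as (a ∷ ms ++ a′ ∷ c′ ∷ cs)) (cong (λ z → cin T as + (bit (T a) + z)) (cin-++ T ms (a′ ∷ c′ ∷ cs)))))
            _⟨_,_⟩ : ∀ {x y x′ y′} → x ≤ y → x′ ≡ x → y′ ≡ y → x′ ≤ y′
            h ⟨ e , e′ ⟩ = ≤-trans (≤-reflexive e) (≤-trans h (≤-reflexive (sym e′)))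
          cnt-new : ∀ x → cnt x new ≡ cnt x (ds ++ arc)
          cnt-new x = trans (cnt≡cin x new) (trans (cin-new _) (sym (trans (cnt≡cin x (ds ++ arc)) (cin-++ _ ds arc))))
          length-new : length new ≡ length ds + length arc
          length-new = trans (sym (cin-full new)) (trans (cin-new full) (cong₂ _+_ (cin-full ds) (cin-full arc)))

        -- A component of the rest with few attachments to the arc would be separated by them from the arc inside Q.
        separated : (D′ : FSet N) → s < # D′ → D′ ⊆ D → D′ ⊆ Q → cin (nb D) arc ≤ B → ∥ ⊥ ∥
        separated D′ big D′⊆D D′⊆Q few = do
          U , hU , alive ← dead-small F room
          let d , dD′ , d∉U = #-pick D′ U (ℕP.<-trans hU big)
          let z , zA , z∉ = #-pick (Q ∩ ⟪ arc ⟫) (P ∪ U) (count U hU)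
          L ← connect F d z (λ x → ∪ˡ) budgetF (D′⊆Q d dD′) (∩ˡ zA)
            (alive-anti (λ x → ∪ˡ) (alive d d∉U ∅ (≤-trans (≤-reflexive (#-∅ {N})) z≤n)))
            (alive-anti (λ x → ∪ˡ) (alive z (λ m → z∉ (∪ʳ m)) ∅ (≤-trans (≤-reflexive (#-∅ {N})) z≤n)))
            (λ e → D-off (D′⊆D d dD′) (∪ʳ (subst (_∈ ⟪ arc ⟫) (sym e) (∩ʳ zA))))
          return (D-off (stay (Link.path L) (D′⊆D d dD′) (ok d z L (D′⊆D d dD′) (∩ʳ zA) (λ m → z∉ (∪ˡ m)))) (∪ʳ (∩ʳ zA)))
          where
          P : FSet N
          P = nb D ∩ ⟪ arc ⟫
          F : FSet N
          F = F₀ ∪ (X ∪ P)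
          P-small : # P ≤ B
          P-small = ≤-trans (#∩⟪⟫ (nb D) arc) few
          XP-small : # (X ∪ P) ≤ f
          XP-small = ≤-trans (#-∪ X P) (≤-trans (+-monoʳ-≤ (# X) P-small) X-small)
          room : # F + f ≤ n
          room = lin (# F ∷ # F₀ ∷ # (X ∪ P) ∷ f ∷ t * f ∷ lam * f ∷ n ∷ []) (λ F a y f t l n →
            F ≼ a :+ y ∷ y ≼ f ∷ a :+ (f :+ t) ≼ l ∷ l :* con 200 :+ f :* con 200 ≼ n ∷ [] ⊢ F :+ f ≼ n) (#-∪ _ _ , XP-small , F₀-small , n-big , tt)
          budgetF : # F + t * f ≤ lam * f
          budgetF = ≤-trans (≤-reflexive (cong (_+ t * f) (sym (+-identityʳ (# F))))) (budget (≤-trans (≤-reflexive (+-identityʳ _)) XP-small))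
          count : ∀ U → # U < s → # (P ∪ U) < # (Q ∩ ⟪ arc ⟫)
          count U hU = lin (# (P ∪ U) ∷ # P ∷ # U ∷ B ∷ s ∷ cin Q arc ∷ # (Q ∩ ⟪ arc ⟫) ∷ []) (λ pu p u B s c q →
            pu ≼ p :+ u ∷ p ≼ B ∷ u ≺ s ∷ s ≼ B ∷ con 2 :* B ≼ c ∷ c ≼ q ∷ [] ⊢ pu ≺ q)
            (#-∪ P U , P-small , hU , s≤B , visits , ≤-trans (cin-mono arc (λ x m q → ∩⁺ q m)) (cin-≤# (Q ∩ ⟪ arc ⟫) arc uniq) , tt)
          Ok : V → Set
          Ok x = x ∈ D ⊎ (x ∉ X × (x ∈ ⟪ arc ⟫ → x ∉ nb D))
          ok : ∀ d z (L : Link F d z kap) → d ∈ D → z ∈ ⟪ arc ⟫ → z ∉ P → ∀ x → x ∈ ⟪ d ∷ Link.inner L ++ z ∷ [] ⟫ → Ok x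
          ok d z L dD zA z∉P x m with ∈-∷⁻ m
          ... | inj₁ refl = inj₁ dD
          ... | inj₂ m′ with ∈-++⁻ (Link.inner L) m′
          ... | inj₁ k = inj₂ ((λ xX → Link.avoids L x k (∪ʳ (∪ˡ xX))) , λ xA xD → Link.avoids L x k (∪ʳ (∪ʳ (∩⁺ xD xA))))
          ... | inj₂ k with ∈-∷⁻ k
          ... | inj₁ refl = inj₂ ((λ xX → disj x zA xX) , λ xA xD → z∉P (∩⁺ xD xA))
          ... | inj₂ k′ = ⊥-elim (∉[] k′)
          stay : ∀ {y zs z} → Path y zs z → y ∈ D → (∀ x → x ∈ ⟪ zs ⟫ → Ok x) → z ∈ D
          stay stop m f = m
          stay {y} (_◂_ {w = w} e p) m f = stay p (next (f w (∈-tail (start∈ p)))) (λ x k → f x (∈-tail k))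
            where
            next : Ok w → w ∈ D
            next (inj₁ k) = k
            next (inj₂ (nX , nA)) = D-closed m e λ k → case ∪⁻ k of λ { (inj₁ i) → nX i ; (inj₂ i) → nA i (nb⁺ m e) }

      enlarge : B ≤ # (Q ∖ Z) → ∥ Longer ∥
      enlarge hU = do
        v , vU , D′ , big , reach ← component (Q ∖ Z) hU
        D , comp ← comprehension (λ y → Σ[ r ∈ ℕ ] y ∈ ball Z v r)
        choose v vU D′ big reach D comp
        where
        choose : ∀ v → v ∈ Q ∖ Z → (D′ : FSet N) → s < # D′ → (∀ y → y ∈ D′ → Σ[ r ∈ ℕ ] y ∈ ball (∁ (Q ∖ Z)) v r) → (D : FSet N) → Comprehends D (λ y → Σ[ r ∈ ℕ ] y ∈ ball Z v r) →
          ∥ Longer ∥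
        choose v vU D′ big reach D comp = decide (≤? (cin (nb D) arc) B)
          where
          D′⊆D : D′ ⊆ D
          D′⊆D y m with reach y m
          ... | r , k = proj₂ (comp y) (r , ball-anti (λ x xZ → ∁⁺ (λ i → ∖ʳ i xZ)) r y k)
          D′⊆Q : D′ ⊆ Q
          D′⊆Q y m with reach y m
          ... | r , k with ball-off r k
          ... | inj₁ refl = ∖ˡ vU
          ... | inj₂ n with ∈? (Q ∖ Z)
          ... | inj₁ i = ∖ˡ i
          ... | inj₂ i = ⊥-elim (n (∁⁺ i))
          open Successors (nb D)
          decide : cin (nb D) arc ≤ B ⊎ B < cin (nb D) arc → ∥ Longer ∥
          decide (inj₁ few) = separated v (∖ʳ vU) D comp D′ big D′⊆D D′⊆Q few >>= λ ()
          decide (inj₂ many) = rotate (path-head path)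
            where
            rotate : Σ[ ys ∈ List V ] arc ≡ hd ∷ ys → ∥ Longer ∥
            rotate (ys , e) with succ-chord hd ys
            ... | inj₁ sc = ⊥-elim (<⇒≱ many (≤-trans (≤-reflexive (cong (cin (nb D)) e)) (≤-trans (length-succs hd ys)
                    (scattered-short (succs hd ys) (λ x → ≤-trans (cnt-succs x hd ys) (≤-trans (m≤n+m _ _) (subst Uniq e uniq x))) sc))))
            ... | inj₂ ch = return (reroute v (∖ʳ vU) D comp (subst SuccChord (sym e) ch))

    Grown : Set
    Grown = Cycle n ⊎ Σ[ A′ ∈ Arc Fr ] lo + length (Arc.arc A′) < n × # (Q ∖ (X ∪ ⟪ Arc.arc A′ ⟫)) < B

    grow : ∀ m (A : Arc Fr) → n ≤ m + (lo + length (Arc.arc A)) → lo + length (Arc.arc A) ≤ n →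
      ∥ Grown ∥
    grow m A hm hn = decide (≤? n (lo + length arc + 2 * B)) (≤? B (# (Q ∖ (X ∪ ⟪ arc ⟫))))
      where
      open Arc A
      decide : n ≤ lo + length arc + 2 * B ⊎ lo + length arc + 2 * B < n → B ≤ # (Q ∖ (X ∪ ⟪ arc ⟫)) ⊎ # (Q ∖ (X ∪ ⟪ arc ⟫)) < B →
        ∥ Grown ∥
      decide (inj₁ near) _ = return (inj₁ (subst Cycle eq (close A j j≤)))
        where
        j : ℕ
        j = n ∸ (lo + length arc)
        n≡ : lo + length arc + j ≡ n
        n≡ = m+[n∸m]≡n hn
        j≤ : j ≤ 2 * B
        j≤ = ℕP.+-cancelˡ-≤ (lo + length arc) j (2 * B) (≤-trans (≤-reflexive n≡) near)
        eq : lo + j + length arc ≡ n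
        eq = trans (trans (+-assoc lo j _) (trans (cong (lo +_) (+-comm j _)) (sym (+-assoc lo _ j)))) n≡
      decide (inj₂ far) (inj₂ small) = return (inj₂ (A , ≤-<-trans (m≤m+n _ (2 * B)) far , small))
      decide (inj₂ far) (inj₁ large) = do
        A′ , longer , short ← Step.enlarge A large
        again m hm A′ longer short
        where
        again : ∀ m → n ≤ m + (lo + length arc) → (A′ : Arc Fr) → length arc < length (Arc.arc A′) → length (Arc.arc A′) ≤ length arc + 2 * B → 
          ∥ Grown ∥
        again zero h _ _ _ = ⊥-elim (<⇒≱ (≤-<-trans (m≤m+n _ (2 * B)) far) h)
        again (suc m) h A′ longer short = grow m A′
          (lin (n ∷ m ∷ lo ∷ length arc ∷ length (Arc.arc A′) ∷ []) (λ n m l a a′ → n ≼ con 1 :+ (m :+ (l :+ a)) ∷ a ≺ a′ ∷ [] ⊢ n ≼ m :+ (l :+ a′)) (h , longer , tt))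
          (lin (n ∷ B ∷ lo ∷ length arc ∷ length (Arc.arc A′) ∷ []) (λ n B l a a′ → l :+ a :+ con 2 :* B ≺ n ∷ a′ ≼ a :+ con 2 :* B ∷ [] ⊢ l :+ a′ ≼ n) (far , short , tt))

  Start : Set
  Start = Σ[ m ∈ ℕ ] Σ[ Z ∈ Cycle m ] m < n × # (Q ∖ ⟪ Cycle.verts Z ⟫) ≤ f

  start : ∥ Cycle n ⊎ Start ∥
  start = do
    Fr , A , short ← loop
    inj₂ (A′ , short′ , small) ← grow Fr n A (m≤m+n n _) short
      where inj₁ Z → return (inj₁ Z)
    return (inj₂ (begin Fr A′ short′ small))
    where
    begin : (Fr : Frame) (A : Arc Fr) → Frame.lo Fr + length (Arc.arc A) < n → # (Q ∖ (Frame.X Fr ∪ ⟪ Arc.arc A ⟫)) < B → Start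
    begin Fr A short small = lo + 0 + length arc , Z , subst (λ l → l + length arc < n) (sym (+-identityʳ lo)) short ,
      lin (# (Q ∖ ⟪ Cycle.verts Z ⟫) ∷ # (Q ∖ (X ∪ ⟪ arc ⟫)) ∷ # X ∷ B ∷ f ∷ []) (λ q r x B f → q ≼ r :+ x ∷ r ≺ B ∷ x :+ B ≼ f ∷ [] ⊢ q ≼ f)
        (#-⊆+ _ _ _ (λ x m → split x m (∈? X)) , small , X-small , tt)
      where
      open Frame Fr
      open Arc A
      Z : Cycle (lo + 0 + length arc)
      Z = close Fr A 0 z≤n
      split : ∀ x → x ∈ Q ∖ ⟪ Cycle.verts Z ⟫ → x ∈ X ⊎ x ∉ X → x ∈ Q ∖ (X ∪ ⟪ arc ⟫) ⊎ x ∈ X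
      split x m (inj₁ k) = inj₂ k
      split x m (inj₂ k) = inj₁ (∖⁺ (∖ˡ m) λ i → case ∪⁻ i of λ { (inj₁ j) → k j ; (inj₂ j) → ∖ʳ m (∈-++ʳ (proj₁ (flex 0 z≤n)) j) })

-- Pósa rotations

module Rotations (S : Setting) (J : FSet (Setting.N S)) where
  open Setting S

  data Block : List V → V → V → V → Set where
    now : ∀ {a y b l} → Block (a ∷ y ∷ b ∷ l) a y b
    later : ∀ {p q r l a y b} → Block l a y b → Block (p ∷ q ∷ r ∷ l) a y b

  block-split : ∀ {L a y b} → Block L a y b → Σ[ as ∈ List V ] Σ[ bs ∈ List V ] L ≡ as ++ a ∷ y ∷ b ∷ bs
  block-split (now {l = l}) = [] , l , refl
  block-split (later {p} {q} {r} B) with block-split B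
  ... | as , bs , e = p ∷ q ∷ r ∷ as , bs , cong (λ l → p ∷ q ∷ r ∷ l) e

  Closed : List V → FSet N → Set
  Closed L A = A ⊆ J × (∀ {a y b} → Block L a y b → a ∈ J → b ∈ J → ∀ x → x ∈ A → x ~ y → a ∈ A ⊎ y ∈ A ⊎ b ∈ A)

  closed-∅ : ∀ L → Closed L ∅
  closed-∅ L = (λ x m → ⊥-elim (∉∅ m)) , λ _ _ _ x m → ⊥-elim (∉∅ m)

  closed-∪ : ∀ {L A A′} → Closed L A → Closed L A′ → Closed L (A ∪ A′)
  closed-∪ {L} {A} {A′} (sub , c) (sub′ , c′) = ∪-least sub sub′ , λ B aJ bJ x m e → case ∪⁻ m of λ
    { (inj₁ k) → lift ∪ˡ (c B aJ bJ x k e) ; (inj₂ k) → lift ∪ʳ (c′ B aJ bJ x k e) }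
    where
    lift : ∀ {D a y b} → (∀ {x} → x ∈ D → x ∈ A ∪ A′) → a ∈ D ⊎ y ∈ D ⊎ b ∈ D → a ∈ A ∪ A′ ⊎ y ∈ A ∪ A′ ⊎ b ∈ A ∪ A′
    lift i (inj₁ k) = inj₁ (i k)
    lift i (inj₂ (inj₁ k)) = inj₂ (inj₁ (i k))
    lift i (inj₂ (inj₂ k)) = inj₂ (inj₂ (i k))

  Exceptional : FSet N → FSet N
  Exceptional A = (∁ J ∪ ∁ N[ A ]) ∪ A

  cin-∋ : ∀ {E : FSet N} {x} → x ∈ E → bit (E x) ≡ 1
  cin-∋ (mem p) = cong bit p

  closed-count : ∀ L A → Closed L A → length L ≤ 3 * cin (Exceptional A) L + 2
  closed-count [] A c = z≤n
  closed-count (a ∷ []) A c = ≤-trans (s≤s z≤n) (m≤n+m 2 _)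
  closed-count (a ∷ y ∷ []) A c = m≤n+m 2 _
  closed-count (a ∷ y ∷ b ∷ L) A (sub , c) = lin (length L ∷ cin E L ∷ bit (E a) ∷ bit (E y) ∷ bit (E b) ∷ [])
    (λ l e p q r → l ≼ con 3 :* e :+ con 2 ∷ 3 ⊠ con 1 ≼ p :+ (q :+ r) ∷ [] ⊢ con 3 :+ l ≼ con 3 :* (p :+ (q :+ (r :+ e))) :+ con 2)
    (closed-count L A (sub , λ B → c (later B)) , one (∈? J) (∈? J) (∈? N[ A ]) , tt)
    where
    E : FSet N
    E = Exceptional A
    inA : a ∈ A ⊎ y ∈ A ⊎ b ∈ A → 1 ≤ bit (E a) + (bit (E y) + bit (E b))
    hitA : a ∈ E → 1 ≤ bit (E a) + (bit (E y) + bit (E b))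
    hitA m rewrite cin-∋ m = s≤s z≤n
    hitY : y ∈ E → 1 ≤ bit (E a) + (bit (E y) + bit (E b))
    hitY m rewrite cin-∋ m = ≤-trans (m≤n+m 1 (bit (E a))) (+-monoʳ-≤ (bit (E a)) (s≤s z≤n))
    hitB : b ∈ E → 1 ≤ bit (E a) + (bit (E y) + bit (E b))
    hitB m rewrite cin-∋ m = ≤-trans (m≤n+m 1 (bit (E y))) (m≤n+m _ (bit (E a)))
    inA (inj₁ m) = hitA (∪ʳ m)
    inA (inj₂ (inj₁ m)) = hitY (∪ʳ m)
    inA (inj₂ (inj₂ m)) = hitB (∪ʳ m)
    one : a ∈ J ⊎ a ∉ J → b ∈ J ⊎ b ∉ J → y ∈ N[ A ] ⊎ y ∉ N[ A ] → 1 ≤ bit (E a) + (bit (E y) + bit (E b))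
    one (inj₂ n) _ _ = hitA (∪ˡ (∪ˡ (∁⁺ n)))
    one _ (inj₂ n) _ = hitB (∪ˡ (∪ˡ (∁⁺ n)))
    one _ _ (inj₂ n) = hitY (∪ˡ (∪ʳ (∁⁺ n)))
    one (inj₁ aJ) (inj₁ bJ) (inj₁ m) with ∪⁻ m
    ... | inj₁ k = inA (inj₂ (inj₁ k))
    ... | inj₂ k with nb⁻ k
    ... | x , xA , e = inA (c now aJ bJ x xA e)

  Consecutive : List V → V → V → Set
  Consecutive X u v = Σ[ as ∈ List V ] Σ[ bs ∈ List V ] X ≡ as ++ u ∷ v ∷ bs

  consecutive-++ˡ : ∀ {X u v} Y → Consecutive X u v → Consecutive (X ++ Y) u v
  consecutive-++ˡ Y (as , bs , refl) = as , bs ++ Y , ++-assoc as _ Y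

  consecutive-++ʳ : ∀ {X u v} Y → Consecutive X u v → Consecutive (Y ++ X) u v
  consecutive-++ʳ Y (as , bs , refl) = Y ++ as , bs , sym (++-assoc Y as _)

  consecutive-reverse : ∀ {X u v} → Consecutive X u v → Consecutive (reverse X) v u
  consecutive-reverse {u = u} {v} (as , bs , refl) = reverse bs , reverse as ,
    trans (reverse-++ as (u ∷ v ∷ bs)) (trans (cong (_++ reverse as) (trans (reverse-∷ u (v ∷ bs)) (cong (_++ u ∷ []) (reverse-∷ v bs))))
      (trans (++-assoc (reverse bs ++ v ∷ []) (u ∷ []) (reverse as)) (++-assoc (reverse bs) (v ∷ []) (u ∷ reverse as))))

  consecutive-away : ∀ {u v z rest} ws → Consecutive (ws ++ z ∷ rest) u v → u ≢ z → v ≢ z → Consecutive ws u v ⊎ Consecutive rest u v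
  consecutive-away [] ([] , bs , refl) u≢ v≢ = ⊥-elim (u≢ refl)
  consecutive-away [] (_ ∷ as , bs , refl) u≢ v≢ = inj₂ (as , bs , refl)
  consecutive-away (w ∷ []) ([] , bs , refl) u≢ v≢ = ⊥-elim (v≢ refl)
  consecutive-away (w ∷ x ∷ ws) ([] , bs , refl) u≢ v≢ = inj₁ ([] , ws , refl)
  consecutive-away (w ∷ ws) (_ ∷ as , bs , e) u≢ v≢ with consecutive-away ws (as , bs , ∷-injectiveʳ e) u≢ v≢
  ... | inj₁ (as′ , bs′ , refl) = inj₁ (w ∷ as′ , bs′ , refl)
  ... | inj₂ c = inj₂ c

  split-unique : ∀ {y : V} (as as′ : List V) {bs bs′ : List V} → Uniq (as ++ y ∷ bs) → as ++ y ∷ bs ≡ as′ ++ y ∷ bs′ → as ≡ as′ × bs ≡ bs′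
  split-unique [] [] u refl = refl , refl
  split-unique {y} [] (x ∷ as′) {bs} u refl = ⊥-elim (uniq-head y bs u (∈-++ʳ as′ ∈-head))
  split-unique {y} (x ∷ as) [] {bs} u refl = ⊥-elim (uniq-head y (as ++ y ∷ bs) u (∈-++ʳ as ∈-head))
  split-unique {y} (x ∷ as) (x′ ∷ as′) {bs} u e with ∷-injectiveˡ e | split-unique as as′ (uniq-tail x (as ++ y ∷ bs) u) (∷-injectiveʳ e)
  ... | refl | refl , refl = refl , refl

  before : ∀ {a y z} ws bs → Uniq (ws ++ z ∷ y ∷ bs) → Consecutive (ws ++ z ∷ y ∷ bs) a y → a ≡ z
  before {a} {y} {z} ws bs u (as , cs , e) = sym (∷ʳ-injectiveʳ ws as (proj₁ (split-unique (ws ++ z ∷ []) (as ++ a ∷ [])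
    (subst Uniq (sym (++-assoc ws (z ∷ []) (y ∷ bs))) u) (trans (++-assoc ws (z ∷ []) (y ∷ bs)) (trans e (sym (++-assoc as (a ∷ []) (y ∷ cs))))))))

  after : ∀ {a y} as bs → Uniq (as ++ y ∷ bs) → Consecutive (as ++ y ∷ bs) y a → Σ[ cs ∈ List V ] bs ≡ a ∷ cs
  after as bs u (as′ , cs , e) = cs , proj₂ (split-unique as as′ u e)

  module _ (p ℓ : V) (P₁ L : List V) (path : Path p (P₁ ++ L) ℓ) (uniq : Uniq (P₁ ++ L)) (p∈J : p ∈ J) where

    data Rotated : V → List V → Set where
      unrotated : Rotated p (P₁ ++ L)
      rotate : ∀ {x z y} ws bs → Rotated x (ws ++ z ∷ y ∷ bs) → x ~ y → z ∈ J → Rotated z ((z ∷ reverse ws) ++ y ∷ bs)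

    rotated-path : ∀ {x X} → Rotated x X → Path x X ℓ
    rotated-path unrotated = path
    rotated-path (rotate {x} {z} {y} ws bs R e _) = join (subst (λ l → Path z l x) (reverse-++ ws (z ∷ [])) (path-reverse (path-prefix ws (y ∷ bs) q))) e
        (path-suffix (ws ++ z ∷ []) bs (subst (λ l → Path x l ℓ) (sym (++-assoc ws (z ∷ []) (y ∷ bs))) q))
      where
      q : Path x (ws ++ z ∷ y ∷ bs) ℓ
      q = rotated-path R

    rotated-cin : ∀ {x X} T → Rotated x X → cin T X ≡ cin T (P₁ ++ L)
    rotated-cin T unrotated = refl
    rotated-cin T (rotate {z = z} {y} ws bs R e _) = trans (cong (bit (T z) +_) (trans (cin-++ T (reverse ws) (y ∷ bs)) (cong (_+ cin T (y ∷ bs)) (cin-reverse T ws))))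
      (trans (swap (bit (T z)) (cin T ws) (cin T (y ∷ bs))) (trans (sym (cin-++ T ws (z ∷ y ∷ bs))) (rotated-cin T R)))
      where
      swap : ∀ a b c → a + (b + c) ≡ b + (a + c)
      swap a b c = trans (sym (+-assoc a b c)) (trans (cong (_+ c) (+-comm a b)) (+-assoc b a c))

    rotated-cnt : ∀ {x X} w → Rotated x X → cnt w X ≡ cnt w (P₁ ++ L)
    rotated-cnt {X = X} w R = trans (cnt≡cin w X) (trans (rotated-cin (λ y → does (y ≟ w)) R) (sym (cnt≡cin w (P₁ ++ L))))

    rotated-uniq : ∀ {x X} → Rotated x X → Uniq X
    rotated-uniq R w = ≤-trans (≤-reflexive (rotated-cnt w R)) (uniq w)

    rotated-∈J : ∀ {x X} → Rotated x X → x ∈ J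
    rotated-∈J unrotated = p∈J
    rotated-∈J (rotate _ _ _ _ m) = m

    module _ (H : FSet N) (heads : Comprehends H (λ x → Σ[ X ∈ List V ] Rotated x X)) where

      -- Rotations only break edges at new heads.
      kept : ∀ {x X u v} → Rotated x X → Consecutive (P₁ ++ L) u v → u ∉ H → v ∉ H → Consecutive X u v ⊎ Consecutive X v u
      kept unrotated c _ _ = inj₁ c
      kept {u = u} {v} R′@(rotate {z = z} {y} ws bs R e _) c u∉ v∉ = go (kept R c u∉ v∉)
        where
        z∈H : z ∈ H
        z∈H = proj₂ (heads z) (_ , R′)
        u≢ : u ≢ z
        u≢ refl = u∉ z∈H
        v≢ : v ≢ z
        v≢ refl = v∉ z∈H
        move : ∀ {u v} → Consecutive ws u v ⊎ Consecutive (y ∷ bs) u v → Consecutive ((z ∷ reverse ws) ++ y ∷ bs) v u ⊎ Consecutive ((z ∷ reverse ws) ++ y ∷ bs) u v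
        move (inj₁ k) = inj₁ (consecutive-++ˡ (y ∷ bs) (consecutive-++ʳ (z ∷ []) (consecutive-reverse k)))
        move (inj₂ k) = inj₂ (consecutive-++ʳ (z ∷ reverse ws) k)
        flip : ∀ {A B : Set} → A ⊎ B → B ⊎ A
        flip (inj₁ a) = inj₂ a
        flip (inj₂ b) = inj₁ b
        go : Consecutive (ws ++ z ∷ y ∷ bs) u v ⊎ Consecutive (ws ++ z ∷ y ∷ bs) v u → Consecutive ((z ∷ reverse ws) ++ y ∷ bs) u v ⊎ Consecutive ((z ∷ reverse ws) ++ y ∷ bs) v u
        go (inj₁ k) = flip (move (consecutive-away ws k u≢ v≢))
        go (inj₂ k) = move (consecutive-away ws k v≢ u≢)

      heads-closed : Closed L H
      heads-closed = (λ x m → rotated-∈J (proj₂ (proj₁ (heads x) m))) , closed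
        where
        closed : ∀ {a y b} → Block L a y b → a ∈ J → b ∈ J → ∀ x → x ∈ H → x ~ y → a ∈ H ⊎ y ∈ H ⊎ b ∈ H
        closed {a} {y} {b} Bl aJ bJ x xH e = decide (∈? H) (∈? H) (∈? H)
          where
          as bs : List V
          as = proj₁ (block-split Bl)
          bs = proj₁ (proj₂ (block-split Bl))
          L≡ : L ≡ as ++ a ∷ y ∷ b ∷ bs
          L≡ = proj₂ (proj₂ (block-split Bl))
          ay : Consecutive (P₁ ++ L) a y
          ay = consecutive-++ʳ P₁ (as , b ∷ bs , L≡)
          yb : Consecutive (P₁ ++ L) y b
          yb = consecutive-++ʳ P₁ (as ++ a ∷ [] , bs , trans L≡ (sym (++-assoc as (a ∷ []) _)))
          y∈ : y ∈ ⟪ P₁ ++ L ⟫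
          y∈ = ∈-++ʳ P₁ (subst (λ l → y ∈ ⟪ l ⟫) (sym L≡) (∈-++ʳ as (∈-tail ∈-head)))
          a≢b : a ≢ b
          a≢b refl = uniq-head a (y ∷ a ∷ bs) (uniq-++ʳ as (a ∷ y ∷ a ∷ bs) (subst Uniq L≡ (uniq-++ʳ P₁ L uniq))) (∈-tail ∈-head)
          decide : a ∈ H ⊎ a ∉ H → y ∈ H ⊎ y ∉ H → b ∈ H ⊎ b ∉ H → a ∈ H ⊎ y ∈ H ⊎ b ∈ H
          decide (inj₁ m) _ _ = inj₁ m
          decide _ (inj₁ m) _ = inj₂ (inj₁ m)
          decide _ _ (inj₁ m) = inj₂ (inj₂ m)
          decide (inj₂ a∉) (inj₂ y∉) (inj₂ b∉) = ⊥-elim (clash (proj₁ (heads x) xH))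
            where
            clash : (Σ[ X ∈ List V ] Rotated x X) → ⊥
            clash (X , R) = split (∈-split X (cnt⇒∈⟪⟫ X (≤-trans (∈⟪⟫⇒cnt (P₁ ++ L) y∈) (≤-reflexive (sym (rotated-cnt y R))))))
              where
              turn : ∀ ws z cs → X ≡ ws ++ z ∷ y ∷ cs → z ∈ J → z ∈ H
              turn ws z cs refl zJ = proj₂ (heads z) (_ , rotate ws cs R e zJ)
              local : ∀ ws z cs → X ≡ ws ++ z ∷ y ∷ cs → ⊥
              local ws z cs eq = cases (kept R ay a∉ y∉) (kept R yb y∉ b∉)
                where
                u : Uniq (ws ++ z ∷ y ∷ cs)
                u = subst Uniq eq (rotated-uniq R)
                isBefore : ∀ {c} → Consecutive X c y → c ≡ z
                isBefore k = before ws cs u (subst (λ l → Consecutive l _ y) eq k)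
                isAfter : ∀ {c} → Consecutive X y c → Σ[ ds ∈ List V ] cs ≡ c ∷ ds
                isAfter k = after (ws ++ z ∷ []) cs (subst Uniq (sym (++-assoc ws (z ∷ []) (y ∷ cs))) u)
                  (subst (λ l → Consecutive l y _) (trans eq (sym (++-assoc ws (z ∷ []) (y ∷ cs)))) k)
                atZ : ∀ {c} → c ≡ z → c ∈ J → c ∉ H → ⊥
                atZ refl cJ c∉ = c∉ (turn ws z cs eq cJ)
                cases : Consecutive X a y ⊎ Consecutive X y a → Consecutive X y b ⊎ Consecutive X b y → ⊥
                cases (inj₁ k) _ = atZ (isBefore k) aJ a∉
                cases (inj₂ k) (inj₂ k′) = atZ (isBefore k′) bJ b∉
                cases (inj₂ k) (inj₁ k′) = a≢b (∷-injectiveˡ (trans (sym (proj₂ (isAfter k))) (proj₂ (isAfter k′))))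
              split : (Σ[ us ∈ List V ] Σ[ cs ∈ List V ] X ≡ us ++ y ∷ cs) → ⊥
              split ([] , cs , refl) = y∉ (subst (_∈ H) (sym (∷-injectiveˡ (proj₂ (path-head (rotated-path R))))) xH)
              split (w ∷ us , cs , eq) = local _ _ cs (trans eq (lastOf w us))
                where
                initOf : V → List V → List V
                initOf w [] = []
                initOf w (v ∷ us) = w ∷ initOf v us
                endOf : V → List V → V
                endOf w [] = w
                endOf w (v ∷ us) = endOf v us
                lastOf : ∀ w us → w ∷ us ++ y ∷ cs ≡ initOf w us ++ endOf w us ∷ y ∷ cs
                lastOf w [] = refl
                lastOf w (v ∷ us) = cong (w ∷_) (lastOf v us)

-- Inserting one vertex into a cycle that covers most of Q

module Tight (S : Setting) (C : Alive.Critical S) where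
  open Setting S
  open Alive S hiding (module Connect)
  open Loops S C
  open Growth S C
  open Rotations S J

  M : ℕ
  M = lam * f

  F₀+f≤M : # F₀ + f ≤ M
  F₀+f≤M = lin (# F₀ ∷ f ∷ t * f ∷ M ∷ []) (λ a f t M → a :+ (f :+ t) ≼ M ∷ [] ⊢ a :+ f ≼ M) (F₀-small , tt)

  s≤M : s * 200 ≤ M
  s≤M = lin (s ∷ B ∷ B * kap ∷ f ∷ M ∷ []) (λ s B Bk f M → 200 ⊠ s ≼ B ∷ 20 ⊠ B :* con 10 ≼ Bk ∷ Bk :* con 20 ≼ f ∷ f ≼ M ∷ [] ⊢ s :* con 200 ≼ M)
    (s≤B , B≤Bkap , f-big , f≤lam*f , tt)

  200M≤n : M * 200 ≤ n
  200M≤n = ≤-trans (m≤m+n _ _) n-big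

  split-at : ∀ i (xs : List V) → i ≤ length xs → Σ[ as ∈ List V ] Σ[ bs ∈ List V ] xs ≡ as ++ bs × length as ≡ i
  split-at zero xs h = [] , xs , refl , refl
  split-at (suc i) (x ∷ xs) (s≤s h) with split-at i xs h
  ... | as , bs , refl , e = x ∷ as , bs , refl , cong suc e

  module _ {m : ℕ} (Z : Cycle m) (m<n : m < n) (rest : # (Q ∖ ⟪ Cycle.verts Z ⟫) ≤ f) where
    open Cycle Z

    Zs : FSet N
    Zs = ⟪ verts ⟫

    #Zs≤m : # Zs ≤ m
    #Zs≤m = ≤-trans (#⟪⟫ verts) (≤-reflexive size)

    few-missed : ∀ K c → (∀ x → x ∈ K → x ∈ Q ⊎ x ∈ F₀) → n ≤ # K + c → # (Zs ∖ K) ≤ M + c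
    few-missed K c out big = lin (# (Zs ∖ K) ∷ # (K ∩ Zs) ∷ # Zs ∷ # K ∷ # (K ∖ Zs) ∷ # (Q ∖ Zs) ∷ # F₀ ∷ m ∷ n ∷ f ∷ M ∷ c ∷ [])
        (λ a b z k d q F m n f M c → a :+ b ≼ z ∷ z ≼ m ∷ m ≺ n ∷ n ≼ k :+ c ∷ k ≼ b :+ d ∷ d ≼ q :+ F ∷ q ≼ f ∷ F :+ f ≼ M ∷ [] ⊢ a ≼ M :+ c)
        (#-disjoint (Zs ∖ K) (K ∩ Zs) Zs (λ x p q → ∖ʳ p (∩ˡ q)) (λ x → ∖ˡ) (λ x → ∩ʳ) , #Zs≤m , m<n , big ,
         #-⊆+ K (K ∩ Zs) (K ∖ Zs) (λ x p → meet x p (∈? Zs)) , #-⊆+ _ _ _ (λ x p → miss x p (out x (∖ˡ p))) , rest , F₀+f≤M , tt)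
      where
      meet : ∀ x → x ∈ K → x ∈ Zs ⊎ x ∉ Zs → x ∈ K ∩ Zs ⊎ x ∈ K ∖ Zs
      meet x p (inj₁ q) = inj₁ (∩⁺ p q)
      meet x p (inj₂ q) = inj₂ (∖⁺ p q)
      miss : ∀ x → x ∈ K ∖ Zs → x ∈ Q ⊎ x ∈ F₀ → x ∈ Q ∖ Zs ⊎ x ∈ F₀
      miss x p (inj₁ q) = inj₁ (∖⁺ q (∖ʳ p))
      miss x p (inj₂ q) = inj₂ q

    missed-J : # (Zs ∖ J) ≤ M + M
    missed-J = ≤-trans (few-missed J (# F₀) (λ x p → inj₁ (J⊆Q x p)) J-big) (+-monoʳ-≤ M (≤-trans (m≤m+n (# F₀) f) F₀+f≤M))

    missed-N : ∀ A → A ⊆ J → s ≤ # A → # (Zs ∖ N[ A ]) ≤ M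
    missed-N A A⊆J h = ≤-trans (few-missed N[ A ] 0 (λ x p → near x (∪⁻ p)) (≤-trans (expand A h) (m≤m+n _ 0))) (≤-reflexive (+-identityʳ M))
      where
      near : ∀ x → x ∈ A ⊎ x ∈ nb A → x ∈ Q ⊎ x ∈ F₀
      near x (inj₁ p) = inj₁ (J⊆Q x (A⊆J x p))
      near x (inj₂ p) = nb-J x (nb-mono A⊆J x p)

    long : M * 199 ≤ m
    long = lin (# J ∷ # Zs ∷ # (J ∖ Zs) ∷ # (Q ∖ Zs) ∷ # F₀ ∷ m ∷ n ∷ f ∷ M ∷ []) (λ J z d q F m n f M → n ≼ J :+ F ∷ J ≼ z :+ d ∷ d ≼ q ∷ q ≼ f ∷ z ≼ m ∷ F :+ f ≼ M ∷ M :* con 200 ≼ n ∷ [] ⊢ M :* con 199 ≼ m)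
      (J-big , #-≤+∖ J Zs , #-mono (λ x p → ∖⁺ (J⊆Q x (∖ˡ p)) (∖ʳ p)) , rest , #Zs≤m , F₀+f≤M , 200M≤n , tt)

    cin-≤∩ : ∀ E L → Uniq L → ⟪ L ⟫ ⊆ Zs → cin E L ≤ # (E ∩ Zs)
    cin-≤∩ E L u sub = ≤-trans (cin-mono L λ x p q → ∩⁺ q (sub x p)) (cin-≤# (E ∩ Zs) L u)

    closed-big : ∀ L A → Uniq L → ⟪ L ⟫ ⊆ Zs → M * 15 ≤ length L → Closed L A → s ≤ # A → M < # A
    closed-big L A u sub hL c@(A⊆J , _) h = decide (≤? (# A) M)
      where
      E : FSet N
      E = Exceptional A
      split : ∀ x → x ∈ E ∩ Zs → x ∈ (Zs ∖ J) ∪ (Zs ∖ N[ A ]) ⊎ x ∈ A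
      split x p with ∪⁻ (∩ˡ p)
      ... | inj₂ q = inj₂ q
      ... | inj₁ q with ∪⁻ q
      ... | inj₁ r = inj₁ (∪ˡ (∖⁺ (∩ʳ p) (∁⁻ r)))
      ... | inj₂ r = inj₁ (∪ʳ (∖⁺ (∩ʳ p) (∁⁻ r)))
      decide : # A ≤ M ⊎ M < # A → M < # A
      decide (inj₂ p) = p
      decide (inj₁ p) = ⊥-elim (ℕP.<-irrefl refl (lin (M ∷ s ∷ length L ∷ cin E L ∷ # (E ∩ Zs) ∷ # ((Zs ∖ J) ∪ (Zs ∖ N[ A ])) ∷ # (Zs ∖ J) ∷ # (Zs ∖ N[ A ]) ∷ # A ∷ [])
        (λ M s l e z u j k a → M :* con 15 ≼ l ∷ l ≼ con 3 :* e :+ con 2 ∷ 3 ⊠ e ≼ z ∷ 3 ⊠ z ≼ u :+ a ∷ 3 ⊠ u ≼ j :+ k ∷ 3 ⊠ j ≼ M :+ M ∷ 3 ⊠ k ≼ M ∷ 3 ⊠ a ≼ M ∷ s :* con 200 ≼ M ∷ 200 ⊠ con 1 ≼ s ∷ [] ⊢ l ≺ l)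
        (hL , closed-count L A c , cin-≤∩ E L u sub , #-⊆+ _ _ _ split , #-∪ _ _ , missed-J , missed-N A A⊆J h , p , s≤M , s-pos , tt)))

    BadHead : List V → V → Set
    BadHead L v = Σ[ A ∈ FSet N ] Closed L A × v ∈ A × # A < s

    bad-heads : ∀ L → Uniq L → ⟪ L ⟫ ⊆ Zs → M * 15 ≤ length L → ∥ Σ[ U ∈ FSet N ] # U < s × (∀ v → BadHead L v → v ∈ U) ∥
    bad-heads L u sub hL = Extension.allBad s (Closed L) (BadHead L) (closed-∅ L) s-pos
      (λ U v c h (A , cA , vA , hA) _ → return (U ∪ A , (λ x → ∪ˡ) , ∪ʳ vA , closed-∪ c cA ,
        lin (# (U ∪ A) ∷ # U ∷ # A ∷ s ∷ []) (λ w u a s → w ≼ u :+ a ∷ u ≺ s ∷ a ≺ s ∷ [] ⊢ w ≼ con 2 :* s) (#-∪ U A , h , hA , tt)))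
      (λ U c h h′ → ℕP.<-irrefl refl (lin (M ∷ # U ∷ s ∷ []) (λ M u s → M ≺ u ∷ u ≼ con 2 :* s ∷ s :* con 200 ≼ M ∷ [] ⊢ M ≺ M)
        (closed-big L U u sub hL c h , h′ , s≤M , tt)))

    record Reachable (p ℓ : V) (X : List V) : Set where
      field
        heads : FSet N
        many : M < # heads
        heads⊆J : heads ⊆ J
        reach : ∀ x → x ∈ heads → Σ[ Y ∈ List V ] Path x Y ℓ × (∀ T → cin T Y ≡ cin T X)

    reachable : ∀ {p ℓ} P₁ L U → Path p (P₁ ++ L) ℓ → Uniq (P₁ ++ L) → p ∈ J → p ∉ U → (∀ v → BadHead L v → v ∈ U) →
      ⟪ L ⟫ ⊆ Zs → M * 15 ≤ length L → ∥ Reachable p ℓ (P₁ ++ L) ∥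
    reachable {p} {ℓ} P₁ L U path u pJ p∉U bad sub hL = do
      H , heads ← comprehension (λ x → Σ[ X ∈ List V ] Rotated p ℓ P₁ L path u pJ x X)
      let c = heads-closed p ℓ P₁ L path u pJ H heads
      return record { heads = H ; heads⊆J = proj₁ c
        ; many = closed-big L H (uniq-++ʳ P₁ L u) sub hL c (large H c (proj₂ (heads p) (_ , unrotated)) (≤? s (# H)))
        ; reach = λ x m → let Y , R = proj₁ (heads x) m in Y , rotated-path p ℓ P₁ L path u pJ R , λ T → rotated-cin p ℓ P₁ L path u pJ T R }
      where
      large : ∀ H → Closed L H → p ∈ H → s ≤ # H ⊎ # H < s → s ≤ # H
      large H c pH (inj₁ h) = h
      large H c pH (inj₂ h) = ⊥-elim (p∉U (bad p (H , c , pH , h)))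

    module Twins (U : FSet N) where

      record Pair (w : V) (l : List V) : Set where
        field
          ms cs : List V
          a c : V
          split : l ≡ ms ++ a ∷ c ∷ cs
          a~w : a ~ w
          c∈J : c ∈ J
          c∉U : c ∉ U

      record Twin (l : List V) : Set where
        field
          as rest′ : List V
          a c w : V
          split : l ≡ as ++ a ∷ c ∷ rest′
          a~w : a ~ w
          c∈J : c ∈ J
          c∉U : c ∉ U
          w∉Zs : w ∉ Zs
          partner : Pair w rest′

      Useless : FSet N
      Useless = (∁ J ∪ U) ∪ ∁ (nb (∁ Zs))

      Collected : List V → Set
      Collected l = Σ[ W ∈ FSet N ] W ⊆ ((Q ∖ Zs) ∪ F₀) × (∀ w → w ∈ W → Pair w l) × length l ≤ 2 * (# W + cin Useless l) + 1

      pair-later : ∀ {w l} x y → Pair w l → Pair w (x ∷ y ∷ l)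
      pair-later x y p = record { Pair p ; ms = x ∷ y ∷ Pair.ms p ; split = cong (λ l → x ∷ y ∷ l) (Pair.split p) }

      collect : ∀ l → Twin l ⊎ Collected l
      collect [] = inj₂ (∅ , (λ x m → ⊥-elim (∉∅ m)) , (λ x m → ⊥-elim (∉∅ m)) , z≤n)
      collect (x ∷ []) = inj₂ (∅ , (λ x m → ⊥-elim (∉∅ m)) , (λ x m → ⊥-elim (∉∅ m)) , m≤n+m 1 _)
      collect (a ∷ c ∷ l) with collect l
      ... | inj₁ T = inj₁ record { Twin T ; as = a ∷ c ∷ Twin.as T ; split = cong (λ l → a ∷ c ∷ l) (Twin.split T) }
      ... | inj₂ (W , W⊆ , pairs , count) = decide (∈? Useless) (∈? Useless)
        where
        skip : 1 ≤ bit (Useless a) + bit (Useless c) → Twin (a ∷ c ∷ l) ⊎ Collected (a ∷ c ∷ l)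
        skip h = inj₂ (W , W⊆ , (λ w m → pair-later a c (pairs w m)) ,
          lin (length l ∷ # W ∷ cin Useless l ∷ bit (Useless a) ∷ bit (Useless c) ∷ []) (λ l w u p q → l ≼ con 2 :* (w :+ u) :+ con 1 ∷ 2 ⊠ con 1 ≼ p :+ q ∷ [] ⊢ con 2 :+ l ≼ con 2 :* (w :+ (p :+ (q :+ u))) :+ con 1) (count , h , tt))
        useful : ∀ {x} → x ∉ Useless → x ∈ J × x ∉ U × x ∈ nb (∁ Zs)
        useful {x} n = in₁ (∈? J) , (λ m → n (∪ˡ (∪ʳ m))) , in₂ (∈? (nb (∁ Zs)))
          where
          in₁ : x ∈ J ⊎ x ∉ J → x ∈ J
          in₁ (inj₁ m) = m
          in₁ (inj₂ k) = ⊥-elim (n (∪ˡ (∪ˡ (∁⁺ k))))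
          in₂ : x ∈ nb (∁ Zs) ⊎ x ∉ nb (∁ Zs) → x ∈ nb (∁ Zs)
          in₂ (inj₁ m) = m
          in₂ (inj₂ k) = ⊥-elim (n (∪ʳ (∁⁺ k)))
        decide : a ∈ Useless ⊎ a ∉ Useless → c ∈ Useless ⊎ c ∉ Useless → Twin (a ∷ c ∷ l) ⊎ Collected (a ∷ c ∷ l)
        decide (inj₁ m) _ = skip (≤-trans (≤-reflexive (sym (cin-∋ m))) (m≤m+n _ _))
        decide _ (inj₁ m) = skip (≤-trans (≤-reflexive (sym (cin-∋ m))) (m≤n+m _ _))
        decide (inj₂ a∉) (inj₂ c∉) = use (useful a∉) (useful c∉)
          where
          use : a ∈ J × a ∉ U × a ∈ nb (∁ Zs) → c ∈ J × c ∉ U × c ∈ nb (∁ Zs) → Twin (a ∷ c ∷ l) ⊎ Collected (a ∷ c ∷ l)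
          use (aJ , _ , aOut) (cJ , cU , _) with nb⁻ aOut
          ... | w , w∉ , e with ∈? {x = w} W
          ... | inj₁ m = inj₁ record { as = [] ; rest′ = l ; a = a ; c = c ; w = w ; split = refl ; a~w = ~-sym e ; c∈J = cJ ; c∉U = cU ; w∉Zs = ∁⁻ w∉ ; partner = pairs w m }
          ... | inj₂ n = inj₂ (W ∪ ⁅ w ⁆ , ∪-least W⊆ (λ x m → subst (_∈ ((Q ∖ Zs) ∪ F₀)) (∈⁅⁆⁻ m) new) ,
                (λ v m → case ∪⁻ m of λ { (inj₁ k) → pair-later a c (pairs v k) ; (inj₂ k) → here v (∈⁅⁆⁻ k) }) ,
                lin (length l ∷ # W ∷ cin Useless l ∷ bit (Useless a) ∷ bit (Useless c) ∷ # (W ∪ ⁅ w ⁆) ∷ # ⁅ w ⁆ ∷ []) (λ l w u p q w′ o →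
                  l ≼ con 2 :* (w :+ u) :+ con 1 ∷ 2 ⊠ w :+ o ≼ w′ ∷ 2 ⊠ con 1 ≼ o ∷ [] ⊢ con 2 :+ l ≼ con 2 :* (w′ :+ (p :+ (q :+ u))) :+ con 1)
                  (count , #-disjoint W ⁅ w ⁆ (W ∪ ⁅ w ⁆) (λ x p q → n (subst (_∈ W) (sym (∈⁅⁆⁻ q)) p)) (λ x → ∪ˡ) (λ x → ∪ʳ) , #-pos {x = w} ∈⁅⁆ , tt))
            where
            new : w ∈ (Q ∖ Zs) ∪ F₀
            new with nb-J w (nb⁺ aJ (~-sym e))
            ... | inj₁ q = ∪ˡ (∖⁺ q (∁⁻ w∉))
            ... | inj₂ q = ∪ʳ q
            here : ∀ v → w ≡ v → Pair v (a ∷ c ∷ l)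
            here v refl = record { ms = [] ; cs = l ; a = a ; c = c ; split = refl ; a~w = ~-sym e ; c∈J = cJ ; c∉U = cU }

      twin : ∀ l → Uniq l → ⟪ l ⟫ ⊆ Zs → # U ≤ 2 * s → M * 50 ≤ length l → Twin l
      twin l u sub hU hl with collect l
      ... | inj₁ T = T
      ... | inj₂ (W , W⊆ , _ , count) = ⊥-elim (ℕP.<-irrefl refl (lin (M ∷ s ∷ length l ∷ # W ∷ cin Useless l ∷ # (Useless ∩ Zs) ∷ # (Zs ∖ J) ∷ # U ∷ # lonely ∷ # ((Zs ∖ J) ∪ U) ∷ # (Q ∖ Zs) ∷ # F₀ ∷ # ((Q ∖ Zs) ∪ F₀) ∷ f ∷ [])
          (λ M s l w e z j u k ju q F qF f → M :* con 50 ≼ l ∷ l ≼ con 2 :* (w :+ e) :+ con 1 ∷ 2 ⊠ e ≼ z ∷ 2 ⊠ z ≼ ju :+ k ∷ 2 ⊠ ju ≼ j :+ u ∷ 2 ⊠ j ≼ M :+ M ∷ 2 ⊠ u ≼ con 2 :* s ∷ 2 ⊠ k ≺ s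
            ∷ 2 ⊠ w ≼ qF ∷ 2 ⊠ qF ≼ q :+ F ∷ 2 ⊠ q ≼ f ∷ 2 ⊠ F :+ f ≼ M ∷ s :* con 200 ≼ M ∷ 194 ⊠ con 1 ≼ s ∷ [] ⊢ l ≺ l)
          (hl , count , cin-≤∩ Useless l u sub , #-⊆+ _ _ _ split , #-∪ _ _ , missed-J , hU , lonely-small ,
           #-mono W⊆ , #-∪ _ _ , rest , F₀+f≤M , s≤M , s-pos , tt)))
        where
        lonely : FSet N
        lonely = Zs ∖ nb (∁ Zs)
        split : ∀ x → x ∈ Useless ∩ Zs → x ∈ (Zs ∖ J) ∪ U ⊎ x ∈ lonely
        split x p with ∪⁻ (∩ˡ p)
        ... | inj₂ q = inj₂ (∖⁺ (∩ʳ p) (∁⁻ q))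
        ... | inj₁ q with ∪⁻ q
        ... | inj₁ r = inj₁ (∪ˡ (∖⁺ (∩ʳ p) (∁⁻ r)))
        ... | inj₂ r = inj₁ (∪ʳ r)
        lonely-small : # lonely < s
        lonely-small with ≤? s (# lonely)
        ... | inj₂ h = h
        ... | inj₁ h = ⊥-elim (<⇒≱ m<n (≤-trans (expand lonely h) (≤-trans (#-mono inside) #Zs≤m)))
          where
          inside : N[ lonely ] ⊆ Zs
          inside x p with ∪⁻ p
          ... | inj₁ q = ∖ˡ q
          ... | inj₂ q with nb⁻ q | ∈? {x = x} Zs
          ... | _ | inj₁ i = i
          ... | y , yl , e | inj₂ i = ⊥-elim (∖ʳ yl (nb⁺ (∁⁺ i) (~-sym e)))

    Inserted : Set
    Inserted = Σ[ Z′ ∈ Cycle (suc m) ] Zs ⊆ ⟪ Cycle.verts Z′ ⟫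

    -- zs = as a c ms a′ c′ cs Z₂ Z₃ closes up; with the new vertex w between a and a′ it opens to the path
    -- from c through a′ w a back to Z₃, and on through Z₂ to c′. Its two ends are rotated within Z₃ and Z₂.
    module Opened (U : FSet N) (as ms cs Z₂ Z₃′ : List V) (a c a′ c′ w z : V)
      (whole : verts ≡ as ++ a ∷ (c ∷ ms) ++ a′ ∷ (c′ ∷ cs) ++ Z₂ ++ z ∷ Z₃′)
      (w∉ : w ∉ Zs) (a~w : a ~ w) (a′~w : a′ ~ w) (cJ : c ∈ J) (c∉U : c ∉ U) (c′J : c′ ∈ J) (c′∉U : c′ ∉ U)
      (bad₃ : ∀ v → BadHead (reverse (z ∷ Z₃′)) v → v ∈ U) (bad₂ : ∀ v → BadHead Z₂ v → v ∈ U)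
      (long₃ : M * 15 ≤ length (z ∷ Z₃′)) (long₂ : M * 15 ≤ length Z₂) where

      P₁ X₀ Y₀ tail : List V
      P₁ = (c ∷ ms ++ a′ ∷ []) ++ w ∷ reverse (as ++ a ∷ [])
      X₀ = P₁ ++ reverse (z ∷ Z₃′)
      Y₀ = (c′ ∷ cs) ++ Z₂
      tail = (c′ ∷ cs) ++ Z₂ ++ z ∷ Z₃′

      full-path : Path first (as ++ a ∷ (c ∷ ms) ++ a′ ∷ tail) end
      full-path = subst (λ l → Path first l end) whole path

      path-A : Path first (as ++ a ∷ []) a
      path-A = path-prefix as _ full-path

      path-C : Path c ((c ∷ ms) ++ a′ ∷ tail) end
      path-C = path-suffix (as ++ a ∷ []) _ (subst (λ l → Path first l end) (sym (++-assoc as (a ∷ []) _)) full-path)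

      path-M : Path c ((c ∷ ms) ++ a′ ∷ []) a′
      path-M = path-prefix (c ∷ ms) tail path-C

      path-tail : Path c′ tail end
      path-tail = path-suffix ((c ∷ ms) ++ a′ ∷ []) (cs ++ Z₂ ++ z ∷ Z₃′) (subst (λ l → Path c l end) (sym (++-assoc (c ∷ ms) (a′ ∷ []) tail)) path-C)

      cut : Σ[ ℓ ∈ V ] Path c′ Y₀ ℓ × ℓ ~ z × Path z (z ∷ Z₃′) end
      cut = path-split c′ (cs ++ Z₂) Z₃′ (subst (λ l → Path c′ l end) (cong (c′ ∷_) (sym (++-assoc cs Z₂ (z ∷ Z₃′)))) path-tail)

      ℓ : V
      ℓ = proj₁ cut

      path-X : Path c X₀ z
      path-X = join (join path-M a′~w (~-sym a~w ◂ path-reverse path-A)) (~-sym closing) (path-reverse (proj₂ (proj₂ (proj₂ cut))))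

      cin-total : ∀ T → cin T X₀ + cin T Y₀ ≡ cin T (w ∷ verts)
      cin-total T = trans (cong₂ _+_ eqX eqY) (trans arith (cong (bit (T w) +_) (sym eqV)))
        where
        eqX : cin T X₀ ≡ bit (T c) + (cin T ms + (bit (T a′) + 0)) + (bit (T w) + (cin T as + (bit (T a) + 0))) + cin T (z ∷ Z₃′)
        eqX rewrite cin-++ T P₁ (reverse (z ∷ Z₃′)) | cin-reverse T (z ∷ Z₃′) | cin-++ T (c ∷ ms ++ a′ ∷ []) (w ∷ reverse (as ++ a ∷ []))
          | cin-++ T ms (a′ ∷ []) | cin-reverse T (as ++ a ∷ []) | cin-++ T as (a ∷ []) = refl
        eqY : cin T Y₀ ≡ bit (T c′) + (cin T cs + cin T Z₂)
        eqY rewrite cin-++ T cs Z₂ = refl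
        eqV : cin T verts ≡ cin T as + (bit (T a) + (bit (T c) + (cin T ms + (bit (T a′) + (bit (T c′) + (cin T cs + (cin T Z₂ + cin T (z ∷ Z₃′))))))))
        eqV rewrite cong (cin T) whole | cin-++ T as (a ∷ (c ∷ ms) ++ a′ ∷ tail) | cin-++ T ms (a′ ∷ tail) | cin-++ T cs (Z₂ ++ z ∷ Z₃′) | cin-++ T Z₂ (z ∷ Z₃′) = refl
        ρ : Vec ℕ 10
        ρ = cin T as ∷ bit (T a) ∷ bit (T c) ∷ cin T ms ∷ bit (T a′) ∷ bit (T c′) ∷ cin T cs ∷ cin T Z₂ ∷ cin T (z ∷ Z₃′) ∷ bit (T w) ∷ []
        lhs rhs : (as a c ms a′ c′ cs Z₂ Z₃ w : Expr) → Expr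
        lhs as a c ms a′ c′ cs Z₂ Z₃ w = c :+ (ms :+ (a′ :+ con 0)) :+ (w :+ (as :+ (a :+ con 0))) :+ Z₃ :+ (c′ :+ (cs :+ Z₂))
        rhs as a c ms a′ c′ cs Z₂ Z₃ w = w :+ (as :+ (a :+ (c :+ (ms :+ (a′ :+ (c′ :+ (cs :+ (Z₂ :+ Z₃))))))))
        arith : bit (T c) + (cin T ms + (bit (T a′) + 0)) + (bit (T w) + (cin T as + (bit (T a) + 0))) + cin T (z ∷ Z₃′) + (bit (T c′) + (cin T cs + cin T Z₂))
          ≡ bit (T w) + (cin T as + (bit (T a) + (bit (T c) + (cin T ms + (bit (T a′) + (bit (T c′) + (cin T cs + (cin T Z₂ + cin T (z ∷ Z₃′)))))))))
        arith = ℕP.≤-antisym (lin ρ (λ as a c ms a′ c′ cs Z₂ Z₃ w → [] ⊢ lhs as a c ms a′ c′ cs Z₂ Z₃ w ≼ rhs as a c ms a′ c′ cs Z₂ Z₃ w) tt)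
                             (lin ρ (λ as a c ms a′ c′ cs Z₂ Z₃ w → [] ⊢ rhs as a c ms a′ c′ cs Z₂ Z₃ w ≼ lhs as a c ms a′ c′ cs Z₂ Z₃ w) tt)

      cnt-total : ∀ x → cnt x X₀ + cnt x Y₀ ≡ cnt x (w ∷ verts)
      cnt-total x = trans (cong₂ _+_ (cnt≡cin x X₀) (cnt≡cin x Y₀)) (trans (cin-total (λ y → does (y ≟ x))) (sym (cnt≡cin x (w ∷ verts))))

      uniq-w : Uniq (w ∷ verts)
      uniq-w = uniq-∷ w verts w∉ uniq

      both≤1 : ∀ x → cnt x X₀ + cnt x Y₀ ≤ 1
      both≤1 x = ≤-trans (≤-reflexive (cnt-total x)) (uniq-w x)

      Y₀⊆Zs : ⟪ Y₀ ⟫ ⊆ Zs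
      Y₀⊆Zs x p = subst (λ l → x ∈ ⟪ l ⟫) (sym whole) (∈-++ʳ as (∈-tail (∈-++ʳ (c ∷ ms) (∈-tail (sub (∈-++⁻ (c′ ∷ cs) p))))))
        where
        sub : x ∈ ⟪ c′ ∷ cs ⟫ ⊎ x ∈ ⟪ Z₂ ⟫ → x ∈ ⟪ tail ⟫
        sub (inj₁ k) = ∈-++ˡ (c′ ∷ cs) k
        sub (inj₂ k) = ∈-++ʳ (c′ ∷ cs) (∈-++ˡ Z₂ k)

      Z₃⊆Zs : ⟪ reverse (z ∷ Z₃′) ⟫ ⊆ Zs
      Z₃⊆Zs x p = subst (λ l → x ∈ ⟪ l ⟫) (sym whole) (∈-++ʳ as (∈-tail (∈-++ʳ (c ∷ ms) (∈-tail (∈-++ʳ (c′ ∷ cs) (∈-++ʳ Z₂ (∈-reverse⁻ (z ∷ Z₃′) p)))))))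

      insert-vertex : ∥ Inserted ∥
      insert-vertex = do
        R ← reachable P₁ (reverse (z ∷ Z₃′)) U path-X (λ x → ≤-trans (m≤m+n _ _) (both≤1 x)) cJ c∉U bad₃ Z₃⊆Zs (≤-trans long₃ (≤-reflexive (sym (length-reverse (z ∷ Z₃′)))))
        R′ ← reachable (c′ ∷ cs) Z₂ U (proj₁ (proj₂ cut)) (λ x → ≤-trans (m≤n+m _ (cnt x X₀)) (both≤1 x)) c′J c′∉U bad₂ (λ x p → Y₀⊆Zs x (∈-++ʳ (c′ ∷ cs) p)) long₂
        return (closeUp R R′)
        where
        closeUp : Reachable c z X₀ → Reachable c′ ℓ Y₀ → Inserted
        closeUp R R′ = done (#-pick R′.heads (Zs ∖ N[ R.heads ]) (≤-<-trans (missed-N R.heads R.heads⊆J s≤heads) R′.many))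
          where
          module R = Reachable R
          module R′ = Reachable R′
          s≤heads : s ≤ # R.heads
          s≤heads = lin (s ∷ M ∷ # R.heads ∷ []) (λ s M h → s :* con 200 ≼ M ∷ M ≺ h ∷ [] ⊢ s ≼ h) (s≤M , R.many , tt)
          done : (Σ[ y ∈ V ] y ∈ R′.heads × y ∉ Zs ∖ N[ R.heads ]) → Inserted
          done (y , yH , yn) with R′.reach y yH
          ... | Y , pY , cinY = byNeighbour (∈? N[ R.heads ])
            where
            y∈Y : 1 ≤ cnt y Y₀
            y∈Y = ≤-trans (∈⟪⟫⇒cnt Y (start∈ pY)) (≤-reflexive (trans (cnt≡cin y Y) (trans (cinY (λ v → does (v ≟ y))) (sym (cnt≡cin y Y₀)))))
            byNeighbour : y ∈ N[ R.heads ] ⊎ y ∉ N[ R.heads ] → Inserted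
            byNeighbour (inj₂ k) = ⊥-elim (yn (∖⁺ (Y₀⊆Zs y (cnt⇒∈⟪⟫ Y₀ y∈Y)) k))
            byNeighbour (inj₁ k) with ∪⁻ k
            ... | inj₁ yX with R.reach y yX
            ... | X , pX , cinX = ⊥-elim (<⇒≱ (s≤s (s≤s z≤n)) (≤-trans (+-mono-≤ (≤-trans (∈⟪⟫⇒cnt X (start∈ pX))
                    (≤-reflexive (trans (cnt≡cin y X) (trans (cinX (λ v → does (v ≟ y))) (sym (cnt≡cin y X₀)))))) y∈Y) (both≤1 y)))
            byNeighbour (inj₁ k) | inj₂ yN with nb⁻ yN
            ... | x , xH , x~y with R.reach x xH
            ... | X , pX , cinX = record { verts = X ++ reverse Y ; first = x ; end = y ; path = join pX (~-sym (proj₁ (proj₂ (proj₂ cut)))) (path-reverse pY) ; closing = ~-sym x~y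
                  ; uniq = λ v → ≤-trans (≤-reflexive (new-cnt v)) (uniq-w v)
                  ; size = trans (sym (cin-full (X ++ reverse Y))) (trans (new-cin full) (trans (cin-full (w ∷ verts)) (cong suc size))) } ,
                λ v p → cnt⇒∈⟪⟫ (X ++ reverse Y) (≤-trans (∈⟪⟫⇒cnt (w ∷ verts) (∈-tail p)) (≤-reflexive (sym (new-cnt v))))
              where
              new-cin : ∀ T → cin T (X ++ reverse Y) ≡ cin T (w ∷ verts)
              new-cin T = trans (cin-++ T X (reverse Y)) (trans (cong₂ _+_ (cinX T) (trans (cin-reverse T Y) (cinY T))) (cin-total T))
              new-cnt : ∀ v → cnt v (X ++ reverse Y) ≡ cnt v (w ∷ verts)
              new-cnt v = trans (cnt≡cin v (X ++ reverse Y)) (trans (new-cin (λ y → does (y ≟ v))) (sym (cnt≡cin v (w ∷ verts))))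

    insert-one : ∥ Inserted ∥
    insert-one = go (split-at (M * 50) verts (≤-trans (*-monoʳ-≤ M (ℕP.m≤m+n 50 149)) (≤-trans long (≤-reflexive (sym size)))))
      where
      go : (Σ[ Z₁ ∈ List V ] Σ[ R ∈ List V ] verts ≡ Z₁ ++ R × length Z₁ ≡ M * 50) → ∥ Inserted ∥
      go (Z₁ , R , e₁ , l₁) = go₂ (split-at (M * 15) R (lin (M ∷ length R ∷ m ∷ length Z₁ ∷ []) (λ M r m z → M :* con 199 ≼ m ∷ m ≼ z :+ r ∷ z ≼ M :* con 50 ∷ [] ⊢ M :* con 15 ≼ r) (long , total , ≤-reflexive l₁ , tt)))
        where
        total : m ≤ length Z₁ + length R
        total = ≤-reflexive (trans (sym size) (trans (cong length e₁) (length-++ Z₁)))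
        go₂ : (Σ[ Z₂ ∈ List V ] Σ[ Z₃ ∈ List V ] R ≡ Z₂ ++ Z₃ × length Z₂ ≡ M * 15) → ∥ Inserted ∥
        go₂ (Z₂ , Z₃ , e₂ , l₂) = go₃ Z₃ refl
          where
          e₃ : verts ≡ Z₁ ++ Z₂ ++ Z₃
          e₃ = trans e₁ (cong (Z₁ ++_) e₂)
          l₃ : M * 15 ≤ length Z₃
          l₃ = lin (M ∷ length R ∷ m ∷ length Z₁ ∷ length Z₂ ∷ length Z₃ ∷ []) (λ M r m z y x → M :* con 199 ≼ m ∷ m ≼ z :+ r ∷ z ≼ M :* con 50 ∷ r ≼ y :+ x ∷ y ≼ M :* con 15 ∷ [] ⊢ M :* con 15 ≼ x)
            (long , total , ≤-reflexive l₁ , ≤-reflexive (trans (cong length e₂) (length-++ Z₂)) , ≤-reflexive l₂ , tt)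
          u₁ : Uniq (Z₁ ++ Z₂ ++ Z₃)
          u₁ = subst Uniq e₃ uniq
          sub : ∀ {x} → x ∈ ⟪ Z₁ ++ Z₂ ++ Z₃ ⟫ → x ∈ Zs
          sub {x} = subst (λ l → x ∈ ⟪ l ⟫) (sym e₃)
          u₂ : Uniq Z₂
          u₂ = uniq-++ˡ Z₂ Z₃ (uniq-++ʳ Z₁ (Z₂ ++ Z₃) u₁)
          u₃ : Uniq Z₃
          u₃ = uniq-++ʳ Z₂ Z₃ (uniq-++ʳ Z₁ (Z₂ ++ Z₃) u₁)
          go₃ : ∀ Z → Z ≡ Z₃ → ∥ Inserted ∥
          go₃ [] refl = ⊥-elim (ℕP.<-irrefl refl (lin (M ∷ s ∷ []) (λ M s → M :* con 15 ≼ con 0 ∷ s :* con 200 ≼ M ∷ 200 ⊠ con 1 ≼ s ∷ [] ⊢ M ≺ M) (l₃ , s≤M , s-pos , tt)))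
          go₃ (z ∷ Z₃′) refl = do
            U₃ , h₃ , bad₃ ← bad-heads (reverse Z₃) (uniq-reverse Z₃ u₃) (λ x p → sub (∈-++ʳ Z₁ (∈-++ʳ Z₂ (∈-reverse⁻ Z₃ p)))) (≤-trans l₃ (≤-reflexive (sym (length-reverse Z₃))))
            U₂ , h₂ , bad₂ ← bad-heads Z₂ u₂ (λ x p → sub (∈-++ʳ Z₁ (∈-++ˡ Z₂ p))) (≤-reflexive (sym l₂))
            open-up (U₃ ∪ U₂) (λ v b → ∪ˡ (bad₃ v b)) (λ v b → ∪ʳ (bad₂ v b))
              (Twins.twin (U₃ ∪ U₂) Z₁ (uniq-++ˡ Z₁ (Z₂ ++ Z₃) u₁) (λ x p → sub (∈-++ˡ Z₁ p))
                (lin (# (U₃ ∪ U₂) ∷ # U₃ ∷ # U₂ ∷ s ∷ []) (λ u a b s → u ≼ a :+ b ∷ a ≺ s ∷ b ≺ s ∷ [] ⊢ u ≼ con 2 :* s) (#-∪ U₃ U₂ , h₃ , h₂ , tt)) (≤-reflexive (sym l₁)))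
            where
            open-up : ∀ U → (∀ v → BadHead (reverse (z ∷ Z₃′)) v → v ∈ U) → (∀ v → BadHead Z₂ v → v ∈ U) → Twins.Twin U Z₁ → ∥ Inserted ∥
            open-up U bad₃ bad₂ T = Opened.insert-vertex U T.as P.ms P.cs Z₂ Z₃′ T.a T.c P.a P.c T.w z whole T.w∉Zs T.a~w P.a~w T.c∈J T.c∉U P.c∈J P.c∉U bad₃ bad₂ l₃ (≤-reflexive (sym l₂))
              where
              module T = Twins.Twin T
              module P = Twins.Pair T.partner
              whole : verts ≡ T.as ++ T.a ∷ (T.c ∷ P.ms) ++ P.a ∷ (P.c ∷ P.cs) ++ Z₂ ++ z ∷ Z₃′
              whole = trans e₃ (trans (cong (_++ Z₂ ++ Z₃) (trans T.split (cong (λ l → T.as ++ T.a ∷ T.c ∷ l) P.split)))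
                (trans (++-assoc T.as (T.a ∷ T.c ∷ P.ms ++ P.a ∷ P.c ∷ P.cs) (Z₂ ++ Z₃)) (cong (λ l → T.as ++ T.a ∷ T.c ∷ l) (++-assoc P.ms (P.a ∷ P.c ∷ P.cs) (Z₂ ++ Z₃)))))

  fill : ∀ k {m} (Z : Cycle m) → m + k ≡ n → # (Q ∖ ⟪ Cycle.verts Z ⟫) ≤ f → ∥ Cycle n ∥
  fill zero {m} Z e h = return (subst Cycle (trans (sym (+-identityʳ m)) e) Z)
  fill (suc k) {m} Z e h = do
    Z′ , sub ← insert-one Z (≤-trans (s≤s (m≤m+n m k)) (≤-reflexive (trans (sym (ℕP.+-suc m k)) e))) h
    fill k Z′ (trans (sym (ℕP.+-suc m k)) e) (≤-trans (#-mono (λ x p → ∖⁺ (∖ˡ p) λ i → ∖ʳ p (sub x i))) h)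

  cycle-n : ∥ Cycle n ∥
  cycle-n = do
    inj₂ (m , Z , m<n , h) ← start
      where inj₁ Z → return Z
    fill (n ∸ m) Z (m+[n∸m]≡n (<⇒≤ m<n)) h

-- Induction on the number of parts

module _ {N : ℕ} where

  elements : (W : FSet N) → ∀ k → k ≤ # W → Σ[ l ∈ List (Fin N) ] Uniq l × length l ≡ k × ⟪ l ⟫ ⊆ W
  elements W zero h = [] , uniq-[] , refl , λ x p → ⊥-elim (∉[] p)
  elements W (suc k) h with elements W k (<⇒≤ h)
  ... | l , u , refl , sub with #-pick W ⟪ l ⟫ (≤-<-trans (#⟪⟫ l) h)
  ... | x , xW , x∉ = x ∷ l , uniq-∷ x l x∉ u , refl , λ y p → case ∈-∷⁻ p of λ { (inj₁ refl) → xW ; (inj₂ q) → sub y q }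

  lookup-∈ : ∀ (l : List (Fin N)) i → lookup l i ∈ ⟪ l ⟫
  lookup-∈ (x ∷ l) zero = ∈-head
  lookup-∈ (x ∷ l) (suc i) = ∈-tail (lookup-∈ l i)

  lookup-injective : ∀ (l : List (Fin N)) → Uniq l → ∀ i j → lookup l i ≡ lookup l j → i ≡ j
  lookup-injective (x ∷ l) u zero zero e = refl
  lookup-injective (x ∷ l) u zero (suc j) refl = ⊥-elim (uniq-head x l u (lookup-∈ l j))
  lookup-injective (x ∷ l) u (suc i) zero refl = ⊥-elim (uniq-head x l u (lookup-∈ l i))
  lookup-injective (x ∷ l) u (suc i) (suc j) e = cong suc (lookup-injective l (uniq-tail x l u) i j e)

module _ {M N : ℕ} (e : Fin M → Fin N) (e-inj : ∀ i j → e i ≡ e j → i ≡ j) where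

  ∈-map⁻ : ∀ {y} l → y ∈ ⟪ map e l ⟫ → Σ[ x ∈ Fin M ] x ∈ ⟪ l ⟫ × y ≡ e x
  ∈-map⁻ [] p = ⊥-elim (∉[] p)
  ∈-map⁻ (x ∷ l) p with ∈-∷⁻ p
  ... | inj₁ refl = x , ∈-head , refl
  ... | inj₂ q with ∈-map⁻ l q
  ... | x′ , m , eq = x′ , ∈-tail m , eq

  uniq-map : ∀ l → Uniq l → Uniq (map e l)
  uniq-map [] u = uniq-[]
  uniq-map (x ∷ l) u = uniq-∷ (e x) (map e l) (λ p → clash (∈-map⁻ l p)) (uniq-map l (uniq-tail x l u))
    where
    clash : (Σ[ y ∈ Fin M ] y ∈ ⟪ l ⟫ × e x ≡ e y) → ⊥
    clash (y , m , eq) = uniq-head x l u (subst (_∈ ⟪ l ⟫) (sym (e-inj x y eq)) m)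

record SimpleGraph (N : ℕ) : Set where
  field
    adj : Fin N → Fin N → Bool
    adj-sym : ∀ x y → adj x y ≡ adj y x
    adj-irr : ∀ x → adj x x ≡ false
  open Graph adj adj-sym adj-irr public

module _ {N : ℕ} (G : SimpleGraph N) where
  open SimpleGraph G

  Apart : List V → List V → Set
  Apart l l′ = ∀ x y → x ∈ ⟪ l ⟫ → y ∈ ⟪ l′ ⟫ → x ≢ y × ¬ x ~ y

  module Induced (l : List V) (u : Uniq l) where

    sub : SimpleGraph (length l)
    sub = record { adj = λ i j → adj (lookup l i) (lookup l j) ; adj-sym = λ i j → adj-sym (lookup l i) (lookup l j) ; adj-irr = λ i → adj-irr (lookup l i) }

    module Sub = SimpleGraph sub

    ~-up : ∀ {i j} → i Sub.~ j → lookup l i ~ lookup l j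
    ~-up (Sub.edge p) = edge p

    path-up : ∀ {i xs j} → Sub.Path i xs j → Path (lookup l i) (map (lookup l) xs) (lookup l j)
    path-up Sub.stop = stop
    path-up (d Sub.◂ p) = ~-up d ◂ path-up p

    cycle-up : ∀ {m} → Sub.Cycle m → Cycle m
    cycle-up Z = record { verts = map (lookup l) verts ; first = lookup l first ; end = lookup l end ; path = path-up path ; closing = ~-up closing
      ; uniq = uniq-map (lookup l) (lookup-injective l u) verts uniq ; size = trans (length-map (lookup l) verts) size }
      where open Sub.Cycle Z

module Parts {K : ℕ} (sz : Fin K → ℕ) where

  total : List (Fin K) → ℕ
  total [] = 0
  total (j ∷ js) = sz j + total js

  total-++ : ∀ as bs → total (as ++ bs) ≡ total as + total bs
  total-++ [] bs = refl
  total-++ (j ∷ as) bs = trans (cong (sz j +_) (total-++ as bs)) (sym (+-assoc (sz j) _ _))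

  record Family {N : ℕ} (G : SimpleGraph N) (js : List (Fin K)) : Set where
    field
      members : Fin K → List (Fin N)
      uniq : ∀ j → j ∈ ⟪ js ⟫ → Uniq (members j)
      enough : ∀ j → j ∈ ⟪ js ⟫ → sz j ≤ length (members j)
      apart : ∀ i j → i ∈ ⟪ js ⟫ → j ∈ ⟪ js ⟫ → i ≢ j → Apart G (members i) (members j)

  update : {A : Set} → Fin K → A → (Fin K → A) → Fin K → A
  update j a g i = if does (j ≟ i) then a else g i

  update-same : ∀ {A : Set} j {a : A} g → update j a g j ≡ a
  update-same j g with j ≟ j
  ... | yes _ = refl
  ... | no n = ⊥-elim (n refl)

  update-other : ∀ {A : Set} j {a : A} g {i} → j ≢ i → update j a g i ≡ g i
  update-other j g {i} n with j ≟ i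
  ... | yes e = ⊥-elim (n e)
  ... | no _ = refl

  module _ {N : ℕ} (G : SimpleGraph N) where
    open SimpleGraph G

    apart-sym : ∀ {l l′} → Apart G l l′ → Apart G l′ l
    apart-sym a x y p q with a y x q p
    ... | n , e = (λ k → n (sym k)) , λ k → e (~-sym k)

    family-∷ : ∀ {j js} (F : Family G js) l → j ∉ ⟪ js ⟫ → Uniq l → sz j ≤ length l → (∀ i → i ∈ ⟪ js ⟫ → Apart G l (Family.members F i)) → Family G (j ∷ js)
    family-∷ {j} {js} F l j∉ u h ap = record { members = mem′ ; uniq = λ i p → byCase i p (∈-∷⁻ p)
        ; enough = λ i p → byCase′ i (∈-∷⁻ p) ; apart = λ i i′ p p′ → ap′ i i′ (∈-∷⁻ p) (∈-∷⁻ p′) }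
      where
      open Family F
      mem′ : Fin K → List (Fin N)
      mem′ = update j l members
      other : ∀ {i} → i ∈ ⟪ js ⟫ → mem′ i ≡ members i
      other p = update-other j members λ { refl → j∉ p }
      byCase : ∀ i → i ∈ ⟪ j ∷ js ⟫ → j ≡ i ⊎ i ∈ ⟪ js ⟫ → Uniq (mem′ i)
      byCase i _ (inj₁ refl) = subst Uniq (sym (update-same j members)) u
      byCase i _ (inj₂ p) = subst Uniq (sym (other p)) (uniq i p)
      byCase′ : ∀ i → j ≡ i ⊎ i ∈ ⟪ js ⟫ → sz i ≤ length (mem′ i)
      byCase′ i (inj₁ refl) = subst (λ m → sz j ≤ length m) (sym (update-same j members)) h
      byCase′ i (inj₂ p) = subst (λ m → sz i ≤ length m) (sym (other p)) (enough i p)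
      ap′ : ∀ i i′ → j ≡ i ⊎ i ∈ ⟪ js ⟫ → j ≡ i′ ⊎ i′ ∈ ⟪ js ⟫ → i ≢ i′ → Apart G (mem′ i) (mem′ i′)
      ap′ i i′ (inj₁ refl) (inj₁ refl) n = ⊥-elim (n refl)
      ap′ i i′ (inj₁ refl) (inj₂ p) n = subst₂ (Apart G) (sym (update-same j members)) (sym (other p)) (ap i′ p)
      ap′ i i′ (inj₂ p) (inj₁ refl) n = subst₂ (Apart G) (sym (other p)) (sym (update-same j members)) (apart-sym (ap i p))
      ap′ i i′ (inj₂ p) (inj₂ p′) n = subst₂ (Apart G) (sym (other p)) (sym (other p′)) (apart i i′ p p′ n)

    family-[] : Family G []
    family-[] = record { members = λ _ → [] ; uniq = λ j p → ⊥-elim (∉[] p) ; enough = λ j p → ⊥-elim (∉[] p) ; apart = λ i j p → ⊥-elim (∉[] p) }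

    module Greedy (U : FSet N) (s : ℕ)
      (small : ∀ v → v ∈ U → ∀ D → (∀ y → y ∈ D → Σ[ r ∈ ℕ ] y ∈ ball (∁ U) v r) → # D ≤ s) where

      Closed : FSet N → Set
      Closed R = R ⊆ U × (∀ x y → x ∈ R → y ∈ U → x ~ y → y ∈ R)

      Group : FSet N → ℕ → Set
      Group R c = Σ[ A ∈ FSet N ] Closed A × A ⊆ R × c ≤ # A × # A ≤ c + s

      grab : ∀ R c → Closed R → c + s ≤ # R → ∀ k A → Closed A → A ⊆ R → # A ≤ c + s → c ≤ # A + k → ∥ Group R c ∥
      grab R c cR hR zero A cA sub up h = return (A , cA , sub , ≤-trans h (≤-reflexive (+-identityʳ _)) , up)
      grab R c cR hR (suc k) A cA sub up h = go (≤? c (# A))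
        where
        go : c ≤ # A ⊎ # A < c → ∥ Group R c ∥
        go (inj₁ h′) = return (A , cA , sub , h′ , up)
        go (inj₂ h′) = add (#-pick R A (<-≤-trans h′ (≤-trans (m≤m+n c s) hR)))
          where
          add : (Σ[ v ∈ V ] v ∈ R × v ∉ A) → ∥ Group R c ∥
          add (v , vR , v∉) = do
            D , comp ← comprehension (λ y → Σ[ r ∈ ℕ ] y ∈ ball (∁ U) v r)
            grab R c cR hR k (A ∪ D) (closed D comp) (∪-least sub (inR D comp))
              (lin (# (A ∪ D) ∷ # A ∷ # D ∷ c ∷ s ∷ []) (λ u a d c s → u ≼ a :+ d ∷ a ≺ c ∷ d ≼ s ∷ [] ⊢ u ≼ c :+ s) (#-∪ A D , h′ , small v vU D (λ y → proj₁ (comp y)) , tt))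
              (lin (# (A ∪ D) ∷ # A ∷ # ⁅ v ⁆ ∷ c ∷ k ∷ []) (λ u a o c k → c ≼ a :+ (con 1 :+ k) ∷ a :+ o ≼ u ∷ con 1 ≼ o ∷ [] ⊢ c ≼ u :+ k)
                (h , #-disjoint A ⁅ v ⁆ (A ∪ D) (λ x p q → v∉ (subst (_∈ A) (sym (∈⁅⁆⁻ q)) p)) (λ x → ∪ˡ) (λ x p → ∪ʳ (subst (_∈ D) (∈⁅⁆⁻ p) (proj₂ (comp v) (0 , ball-zero⁺)))) , #-pos {x = v} ∈⁅⁆ , tt))
            where
            vU : v ∈ U
            vU = proj₁ cR v vR
            inU : ∀ {x} → x ∉ ∁ U → x ∈ U
            inU {x} n with ∈? U
            ... | inj₁ m = m
            ... | inj₂ m = ⊥-elim (n (∁⁺ m))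
            ball⊆R : ∀ r → ball (∁ U) v r ⊆ R
            ball⊆R zero x p = subst (_∈ R) (ball-zero p) vR
            ball⊆R (suc r) x p with ball-pred r p
            ... | inj₁ q = ball⊆R r x q
            ... | inj₂ (n , y , q , e) = proj₂ cR y x (ball⊆R r y q) (inU n) e
            inR : ∀ D → Comprehends D (λ y → Σ[ r ∈ ℕ ] y ∈ ball (∁ U) v r) → D ⊆ R
            inR D comp x p with proj₁ (comp x) p
            ... | r , q = ball⊆R r x q
            closed : ∀ D → Comprehends D (λ y → Σ[ r ∈ ℕ ] y ∈ ball (∁ U) v r) → Closed (A ∪ D)
            closed D comp = ∪-least (proj₁ cA) (λ x p → proj₁ cR x (inR D comp x p)) , λ x y p yU e → case ∪⁻ p of λ
              { (inj₁ q) → ∪ˡ (proj₂ cA x y q yU e) ; (inj₂ q) → ∪ʳ (step x y (proj₁ (comp x) q) yU e) }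
              where
              step : ∀ x y → (Σ[ r ∈ ℕ ] x ∈ ball (∁ U) v r) → y ∈ U → x ~ y → y ∈ D
              step x y (r , q) yU e = proj₂ (comp y) (suc r , ball-step r q e λ k → ∁⁻ k yU)

      Within : FSet N → List (Fin K) → Set
      Within R js = Σ[ F ∈ Family G js ] (∀ j → j ∈ ⟪ js ⟫ → ⟪ Family.members F j ⟫ ⊆ R)

      distribute : ∀ js → Uniq js → ∀ R → Closed R → total js + length js * s ≤ # R → ∥ Within R js ∥
      distribute [] u R cR h = return (family-[] , λ j p → ⊥-elim (∉[] p))
      distribute (j ∷ js) u R cR h = do
        A , cA , A⊆R , lo , hi ← grab R (sz j) cR (≤-trans fits h) (sz j) ∅ ((λ x p → ⊥-elim (∉∅ p)) , λ x y p → ⊥-elim (∉∅ p)) (λ x p → ⊥-elim (∉∅ p))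
          (≤-trans (≤-reflexive (#-∅ {N})) z≤n) (m≤n+m (sz j) _)
        F , within ← distribute js (uniq-tail j js u) (R ∖ A) (closed A cA) (room A hi)
        return (combine A cA A⊆R lo F within)
        where
        fits : sz j + s ≤ sz j + total js + (s + length js * s)
        fits = +-mono-≤ (m≤m+n (sz j) _) (m≤m+n s _)
        closed : ∀ A → Closed A → Closed (R ∖ A)
        closed A (A⊆U , cl) = (λ x p → proj₁ cR x (∖ˡ p)) , λ x y p yU e → ∖⁺ (proj₂ cR x y (∖ˡ p) yU e) λ yA → ∖ʳ p (cl y x yA (proj₁ cR x (∖ˡ p)) (~-sym e))
        room : ∀ A → # A ≤ sz j + s → total js + length js * s ≤ # (R ∖ A)
        room A hi = lin (total js ∷ length js * s ∷ # R ∷ # A ∷ # (R ∖ A) ∷ sz j ∷ s ∷ []) (λ t l r a d z s → z :+ t :+ (s :+ l) ≼ r ∷ r ≼ a :+ d ∷ a ≼ z :+ s ∷ [] ⊢ t :+ l ≼ d) (h , #-≤+∖ R A , hi , tt)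
        combine : ∀ A → Closed A → A ⊆ R → sz j ≤ # A → (F : Family G js) → (∀ i → i ∈ ⟪ js ⟫ → ⟪ Family.members F i ⟫ ⊆ R ∖ A) → Within R (j ∷ js)
        combine A cA A⊆R lo F within with elements A (sz j) lo
        ... | l , ul , len , sub = family-∷ F l (uniq-head j js u) ul (≤-reflexive (sym len)) ap , inside
          where
          ap : ∀ i → i ∈ ⟪ js ⟫ → Apart G l (Family.members F i)
          ap i p x y xl ym = (λ { refl → ∖ʳ (within i p y ym) (sub x xl) }) , λ e → ∖ʳ (within i p y ym) (proj₂ cA x y (sub x xl) (proj₁ cR y (∖ˡ (within i p y ym))) e)
          inside : ∀ i → i ∈ ⟪ j ∷ js ⟫ → ⟪ update j l (Family.members F) i ⟫ ⊆ R
          inside i p with ∈-∷⁻ p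
          ... | inj₁ refl = λ x q → A⊆R x (sub x (subst (λ m → x ∈ ⟪ m ⟫) (update-same j (Family.members F)) q))
          ... | inj₂ q = λ x r → ∖ˡ (within i q x (subst (λ m → x ∈ ⟪ m ⟫) (update-other j (Family.members F) λ { refl → uniq-head j js u q }) r))

module Goodness {K : ℕ} (sz : Fin K → ℕ) (sz-pos : ∀ j → 1 ≤ sz j) (n all lam kap f : ℕ) (n-pos : 1 ≤ n)
  (B<2^lam : 3 * all < 2 ^ lam) (kap-connect : lam * (lam + 2) * 2 + 10 ≤ kap) (kap-unit : lam * 2 + 10 ≤ kap)
  (f-big : 3 * all * kap * 20 ≤ f) (n-big : lam * f * 200 + f * 200 ≤ n) where
  open Parts sz

  B : ℕ
  B = 3 * all

  smallest : ∀ j js → Σ[ as ∈ List (Fin K) ] Σ[ i ∈ Fin K ] Σ[ bs ∈ List (Fin K) ] j ∷ js ≡ as ++ i ∷ bs × (∀ i′ → i′ ∈ ⟪ j ∷ js ⟫ → sz i ≤ sz i′)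
  smallest j [] = [] , j , [] , refl , λ i p → case ∈-∷⁻ p of λ { (inj₁ refl) → ≤-refl ; (inj₂ q) → ⊥-elim (∉[] q) }
  smallest j (j′ ∷ js) with smallest j′ js
  ... | as , i , bs , e , min with ≤? (sz j) (sz i)
  ... | inj₁ h = [] , j , j′ ∷ js , refl , λ i′ p → case ∈-∷⁻ p of λ { (inj₁ refl) → ≤-refl ; (inj₂ q) → ≤-trans h (min i′ q) }
  ... | inj₂ h = j ∷ as , i , bs , cong (j ∷_) e , λ i′ p → case ∈-∷⁻ p of λ { (inj₁ refl) → <⇒≤ h ; (inj₂ q) → min i′ q }

  length*≤total : ∀ s js → (∀ i → i ∈ ⟪ js ⟫ → s ≤ sz i) → length js * s ≤ total js
  length*≤total s [] h = z≤n
  length*≤total s (j ∷ js) h = +-mono-≤ (h j ∈-head) (length*≤total s js λ i p → h i (∈-tail p))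

  family-⊆ : ∀ {N js js′} {G : SimpleGraph N} → (∀ j → j ∈ ⟪ js′ ⟫ → j ∈ ⟪ js ⟫) → Family G js → Family G js′
  family-⊆ sub F = record { members = members ; uniq = λ j p → uniq j (sub j p) ; enough = λ j p → enough j (sub j p) ; apart = λ i j p q → apart i j (sub i p) (sub j q) }
    where open Family F

  Outcome : ∀ {N} → SimpleGraph N → List (Fin K) → Set
  Outcome G js = SimpleGraph.Cycle G n ⊎ Family G js

  module Step {N : ℕ} (G : SimpleGraph N) (j₁ j₂ : Fin K) (js : List (Fin K)) (u : Uniq (j₁ ∷ js)) (j₂∈ : j₂ ∈ ⟪ js ⟫)
    (min : ∀ i → i ∈ ⟪ js ⟫ → sz j₂ ≤ sz i) (small : sz j₁ + total js ≤ all) where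
    open SimpleGraph G

    s : ℕ
    s = sz j₂

    SmallComponents : FSet N → Set
    SmallComponents U = ∀ v → v ∈ U → ∀ D → (∀ y → y ∈ D → Σ[ r ∈ ℕ ] y ∈ ball (∁ U) v r) → # D ≤ s

    s≤total : ∀ js → j₂ ∈ ⟪ js ⟫ → s ≤ total js
    s≤total [] p = ⊥-elim (∉[] p)
    s≤total (j ∷ js) p with ∈-∷⁻ p
    ... | inj₁ refl = m≤m+n s _
    ... | inj₂ q = ≤-trans (s≤total js q) (m≤n+m _ (sz j))

    scattered : ∀ U → B ≤ # U → SmallComponents U → ∥ Family G (j₁ ∷ js) ∥
    scattered U hU comps = do
      F , _ ← Greedy.distribute G U s comps (j₁ ∷ js) u U ((λ x p → p) , λ x y _ p _ → p)
        (lin (sz j₁ ∷ total js ∷ length js * s ∷ s ∷ all ∷ # U ∷ []) (λ z t l s a U → z :+ t ≼ a ∷ z :+ t ≼ a ∷ z :+ t ≼ a ∷ l ≼ t ∷ s ≼ t ∷ con 3 :* a ≼ U ∷ [] ⊢ z :+ t :+ (s :+ l) ≼ U)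
          (small , small , small , length*≤total s js min , s≤total js j₂∈ , hU , tt))
      return F

    expanding : n ≤ N → (∀ A → s ≤ # A → n ≤ # N[ A ]) → ¬ (Σ[ U ∈ FSet N ] B ≤ # U × SmallComponents U) → ∥ Cycle n ∥
    expanding n≤N expand noSmall = Alive.critical S >>= Tight.cycle-n S
      where
      component : ∀ U → B ≤ # U → ∥ Σ[ v ∈ V ] v ∈ U × Σ[ D ∈ FSet N ] s < # D × (∀ y → y ∈ D → Σ[ r ∈ ℕ ] y ∈ ball (∁ U) v r) ∥
      component U h = byContra λ none → return (noSmall (U , h , λ v vU D reach → case ≤? (# D) s of λ { (inj₁ le) → le ; (inj₂ gt) → ⊥-elim (none (v , vU , D , gt , reach)) }))
      indep-small : ∀ I → (∀ x y → x ∈ I → y ∈ I → ¬ x ~ y) → # I < B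
      indep-small I ind with ≤? B (# I)
      ... | inj₂ h = h
      ... | inj₁ h = ⊥-elim (component I h λ (v , vI , D , gt , reach) →
              <⇒≱ gt (≤-trans (#-mono {B = ⁅ v ⁆} λ y p → subst (_∈ ⁅ v ⁆) (single v vI (proj₁ (reach y p)) (proj₂ (reach y p))) ∈⁅⁆) (≤-trans (#-⁅⁆ v) (sz-pos j₂))))
        where
        single : ∀ v → v ∈ I → ∀ r {y} → y ∈ ball (∁ I) v r → v ≡ y
        single v vI zero p = ball-zero p
        single v vI (suc r) {y} p with ball-pred r p
        ... | inj₁ q = single v vI r q
        ... | inj₂ (y∉ , x , q , e) with single v vI r q | ∈? {x = y} I
        ... | refl | inj₁ yI = ⊥-elim (ind v y vI yI e)
        ... | refl | inj₂ n = ⊥-elim (y∉ (∁⁺ n))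
      S : Setting
      S = record { adj = adj ; adj-sym = adj-sym ; adj-irr = adj-irr ; n = n ; s = s ; B = B ; lam = lam ; kap = kap ; f = f ; s-pos = sz-pos j₂
        ; s≤B = lin (sz j₁ ∷ total js ∷ s ∷ all ∷ []) (λ z t s a → s ≼ t ∷ z :+ t ≼ a ∷ [] ⊢ s ≼ con 3 :* a) (s≤total js j₂∈ , small , tt)
        ; B<2^lam = B<2^lam ; kap-connect = kap-connect ; kap-unit = kap-unit ; f-big = f-big ; n-big = n-big ; n≤N = n≤N
        ; expand = expand ; indep-small = indep-small ; component = component }

  pred-n : suc (n ∸ 1) ≡ n
  pred-n = m+[n∸m]≡n n-pos

  induct : ∀ k js → length js ≡ k → ∀ {N} (G : SimpleGraph N) j₁ → Uniq (j₁ ∷ js) → sz j₁ + total js ≤ all → k * (n ∸ 1) + sz j₁ ≤ N → ∥ Outcome G (j₁ ∷ js) ∥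
  induct zero [] refl {N} G j₁ u _ hN with elements full (sz j₁) (≤-trans hN (≤-reflexive (sym (#-full {N}))))
  ... | l , ul , len , _ = return (inj₂ (family-∷ G (family-[] G) l ∉[] ul (≤-reflexive (sym len)) λ i p → ⊥-elim (∉[] p)))
  induct (suc k) (j ∷ js) lenjs {N} G j₁ u small hN with smallest j js
  ... | as , j₂ , bs , e , min = lem (Σ[ A ∈ FSet N ] s ≤ # A × # N[ A ] < n) >>= byExpansion
    where
    open SimpleGraph G
    j₂∈ : j₂ ∈ ⟪ j ∷ js ⟫
    j₂∈ = subst (λ l → j₂ ∈ ⟪ l ⟫) (sym e) (∈-++ʳ as ∈-head)
    open Step G j₁ j₂ (j ∷ js) u j₂∈ min small
    js′ : List (Fin K)
    js′ = as ++ bs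
    cnt-js : ∀ x → cnt x (j₁ ∷ j ∷ js) ≡ cnt x (j₂ ∷ j₁ ∷ js′)
    cnt-js x = trans (cong (bit (does (j₁ ≟ x)) +_) (trans (cong (cnt x) e) (cnt-++ x as (j₂ ∷ bs))))
      (trans (ℕP.≤-antisym (lin ρ (λ a b c d → [] ⊢ lhs a b c d ≼ rhs a b c d) tt) (lin ρ (λ a b c d → [] ⊢ rhs a b c d ≼ lhs a b c d) tt))
        (cong (λ t → bit (does (j₂ ≟ x)) + (bit (does (j₁ ≟ x)) + t)) (sym (cnt-++ x as bs))))
      where
      ρ : Vec ℕ 4
      ρ = bit (does (j₁ ≟ x)) ∷ cnt x as ∷ bit (does (j₂ ≟ x)) ∷ cnt x bs ∷ []
      lhs rhs : (a b c d : Expr) → Expr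
      lhs a b c d = a :+ (b :+ (c :+ d))
      rhs a b c d = c :+ (a :+ (b :+ d))
    uniq-js : Uniq (j₂ ∷ j₁ ∷ js′)
    uniq-js x = ≤-trans (≤-reflexive (sym (cnt-js x))) (u x)
    length-js′ : length js′ ≡ k
    length-js′ = suc-injective (trans (cong suc (length-++ as)) (trans (sym (ℕP.+-suc (length as) (length bs))) (trans (sym (length-++ as)) (trans (cong length (sym e)) lenjs))))
    small′ : sz j₁ + total js′ ≤ all
    small′ = ≤-trans (+-monoʳ-≤ (sz j₁) (≤-trans (≤-reflexive (total-++ as bs)) (≤-trans (+-monoʳ-≤ (total as) (m≤n+m (total bs) (sz j₂))) (≤-reflexive (trans (sym (total-++ as (j₂ ∷ bs))) (cong total (sym e))))))) small
    n≤N : n ≤ N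
    n≤N = lin (n ∷ n ∸ 1 ∷ k * (n ∸ 1) ∷ sz j₁ ∷ N ∷ []) (λ n p q z N → n ≼ con 1 :+ p ∷ con 1 ≼ z ∷ p :+ q :+ z ≼ N ∷ [] ⊢ n ≼ N) (≤-reflexive (sym pred-n) , sz-pos j₁ , hN , tt)

    remove : (A : FSet N) → s ≤ # A → # N[ A ] < n → ∥ Outcome G (j₁ ∷ j ∷ js) ∥
    remove A hA few = go (elements (∁ N[ A ]) (k * (n ∸ 1) + sz j₁) room) (elements A s hA)
      where
      room : k * (n ∸ 1) + sz j₁ ≤ # (∁ N[ A ])
      room = lin (n ∷ n ∸ 1 ∷ k * (n ∸ 1) ∷ sz j₁ ∷ N ∷ # N[ A ] ∷ # (∁ N[ A ]) ∷ # (full {N}) ∷ []) (λ n p q z N a c F → p :+ q :+ z ≼ N ∷ N ≼ F ∷ F ≼ a :+ c ∷ a ≺ n ∷ n ≼ con 1 :+ p ∷ [] ⊢ q :+ z ≼ c)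
        (hN , ≤-reflexive (sym (#-full {N})) , #-⊆+ _ _ _ (λ x _ → split x (∈? N[ A ])) , few , ≤-reflexive (sym pred-n) , tt)
        where
        split : ∀ x → x ∈ N[ A ] ⊎ x ∉ N[ A ] → x ∈ N[ A ] ⊎ x ∈ ∁ N[ A ]
        split x (inj₁ p) = inj₁ p
        split x (inj₂ p) = inj₂ (∁⁺ p)
      go : (Σ[ l ∈ List V ] Uniq l × length l ≡ k * (n ∸ 1) + sz j₁ × ⟪ l ⟫ ⊆ ∁ N[ A ]) → (Σ[ l ∈ List V ] Uniq l × length l ≡ s × ⟪ l ⟫ ⊆ A) → ∥ Outcome G (j₁ ∷ j ∷ js) ∥
      go (l , ul , len , l⊆) (lA , uA , lenA , lA⊆) = induct k js′ length-js′ sub j₁ (uniq-tail j₂ (j₁ ∷ js′) uniq-js) small′ (≤-reflexive (sym len)) >>= λ o → return (lift o)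
        where
        open Induced G l ul
        lift : Outcome sub (j₁ ∷ js′) → Outcome G (j₁ ∷ j ∷ js)
        lift (inj₁ Z) = inj₁ (cycle-up Z)
        lift (inj₂ F) = inj₂ (family-⊆ (λ i p → cnt⇒∈⟪⟫ (j₂ ∷ j₁ ∷ js′) (≤-trans (∈⟪⟫⇒cnt (j₁ ∷ j ∷ js) p) (≤-reflexive (cnt-js i))))
            (family-∷ G up lA (uniq-head j₂ (j₁ ∷ js′) uniq-js) uA (≤-reflexive (sym lenA)) away))
          where
          open Family F
          inj : ∀ i i′ → lookup l i ≡ lookup l i′ → i ≡ i′
          inj = lookup-injective l ul
          up : Family G (j₁ ∷ js′)
          up = record { members = λ i → map (lookup l) (members i) ; uniq = λ i p → uniq-map (lookup l) inj (members i) (uniq i p)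
            ; enough = λ i p → ≤-trans (enough i p) (≤-reflexive (sym (length-map (lookup l) (members i))))
            ; apart = λ i i′ p p′ n x y xm ym → pull n p p′ (∈-map⁻ (lookup l) inj (members i) xm) (∈-map⁻ (lookup l) inj (members i′) ym) }
            where
            pull : ∀ {i i′ x y} → i ≢ i′ → i ∈ ⟪ j₁ ∷ js′ ⟫ → i′ ∈ ⟪ j₁ ∷ js′ ⟫ → (Σ[ a ∈ Fin (length l) ] a ∈ ⟪ members i ⟫ × x ≡ lookup l a) → (Σ[ a ∈ Fin (length l) ] a ∈ ⟪ members i′ ⟫ × y ≡ lookup l a) → x ≢ y × ¬ x ~ y
            pull {i} {i′} n p p′ (a , am , refl) (b , bm , refl) with apart i i′ p p′ n a b am bm
            ... | a≢b , far = (λ q → a≢b (inj a b q)) , λ { (edge q) → far (Sub.edge q) }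
          away : ∀ i → i ∈ ⟪ j₁ ∷ js′ ⟫ → Apart G lA (map (lookup l) (members i))
          away i p x y xA ym with ∈-map⁻ (lookup l) inj (members i) ym
          ... | a , am , refl = (λ { refl → out (∪ˡ (lA⊆ x xA)) }) , λ q → out (∪ʳ (nb⁺ (lA⊆ x xA) q))
            where
            out : lookup l a ∉ N[ A ]
            out = ∁⁻ (l⊆ (lookup l a) (lookup-∈ l a))

    byExpansion : (Σ[ A ∈ FSet N ] s ≤ # A × # N[ A ] < n) ⊎ ¬ (Σ[ A ∈ FSet N ] s ≤ # A × # N[ A ] < n) → ∥ Outcome G (j₁ ∷ j ∷ js) ∥
    byExpansion (inj₁ (A , hA , few)) = remove A hA few
    byExpansion (inj₂ none) = lem (Σ[ U ∈ FSet N ] B ≤ # U × SmallComponents U) >>= byComponents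
      where
      expand : ∀ A → s ≤ # A → n ≤ # N[ A ]
      expand A h with ≤? n (# N[ A ])
      ... | inj₁ p = p
      ... | inj₂ p = ⊥-elim (none (A , h , p))
      byComponents : (Σ[ U ∈ FSet N ] B ≤ # U × SmallComponents U) ⊎ ¬ (Σ[ U ∈ FSet N ] B ≤ # U × SmallComponents U) → ∥ Outcome G (j₁ ∷ j ∷ js) ∥
      byComponents (inj₁ (U , hU , comps)) = scattered U hU comps >>= λ F → return (inj₂ F)
      byComponents (inj₂ noSmall) = expanding n≤N expand noSmall >>= λ Z → return (inj₁ Z)

-- From cycles and families back to subgraphs

cons : ∀ {a} {B : Set} → B → (Fin a → B) → Fin (suc a) → B
cons x f zero = x
cons x f (suc i) = f i

search : ∀ a {b} (P : (Fin a → Fin b) → Set) → (∀ {f g} → (∀ i → f i ≡ g i) → P f → P g) → (∀ f → Dec (P f)) → Dec (Σ (Fin a → Fin b) P)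
search zero P resp dec with dec (λ ())
... | yes p = yes ((λ ()) , p)
... | no n = no λ (f , p) → n (resp (λ ()) p)
search (suc a) {b} P resp dec with FinP.any? (λ x → search a (λ f → P (cons x f)) (λ e → resp λ { zero → refl ; (suc i) → e i }) (λ f → dec (cons x f)))
... | yes (x , f , p) = yes (_ , p)
... | no n = no λ (f , p) → n (f zero , f ∘ suc , resp (λ { zero → refl ; (suc i) → refl }) p)

contains? : ∀ {a b} (G : RawGraph b) (F : RawGraph a) → Dec (Contains G F)
contains? G F = search _ _
  (λ e (inj , edges) → (λ {x} {y} p → inj (trans (e x) (trans p (sym (e y))))) , λ x y p → trans (cong₂ G (sym (e x)) (sym (e y))) (edges x y p))
  λ f → injective? f ×-dec FinP.all? λ x → FinP.all? λ y → (F x y ≟ᵇ true) →-dec (G (f x) (f y) ≟ᵇ true)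
  where
  injective? : ∀ {a b} (f : Fin a → Fin b) → Dec (∀ {x y} → f x ≡ f y → x ≡ y)
  injective? f with FinP.all? (λ x → FinP.all? λ y → (f x ≟ f y) →-dec (x ≟ y))
  ... | yes p = yes λ {x} {y} → p x y
  ... | no n = no λ p → n λ x y → p

module _ {N : ℕ} (G : SimpleGraph N) where
  open SimpleGraph G

  path-first : ∀ {u xs v} → Path u xs v → ∀ i → toℕ i ≡ 0 → lookup xs i ≡ u
  path-first stop zero _ = refl
  path-first (d ◂ p) zero _ = refl

  path-final : ∀ {u xs v} → Path u xs v → ∀ i → suc (toℕ i) ≡ length xs → lookup xs i ≡ v
  path-final stop zero _ = refl
  path-final (d ◂ stop) zero ()
  path-final (d ◂ _ ◂ p) zero ()
  path-final (d ◂ p) (suc i) e = path-final p i (suc-injective e)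

  path-next : ∀ {u xs v} → Path u xs v → ∀ i j → suc (toℕ i) ≡ toℕ j → lookup xs i ~ lookup xs j
  path-next stop zero zero ()
  path-next (_◂_ {u = u} d p) zero (suc j) e = subst (u ~_) (sym (path-first p j (sym (suc-injective e)))) d
  path-next (d ◂ p) (suc i) (suc j) e = path-next p i j (suc-injective e)

  cycle-contains : ∀ {m} → Cycle m → Contains adj (cycleGraph m)
  cycle-contains record { verts = xs ; path = p ; closing = e ; uniq = u ; size = refl } = lookup xs , (λ {i} {j} → lookup-injective xs u i j) , λ i j h → isEdge (both i j h)
    where
    next : ∀ i j → cycSucc (length xs) i j ≡ true → lookup xs i ~ lookup xs j
    next i j h with suc (toℕ i) ≡ᵇ toℕ j in e₁
    ... | true = path-next p i j (≡ᵇ⇒≡ _ _ (Equivalence.from T-≡ e₁))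
    ... | false with suc (toℕ i) ≡ᵇ length xs in e₂
    ... | true = subst₂ _~_ (sym (path-final p i (≡ᵇ⇒≡ _ _ (Equivalence.from T-≡ e₂)))) (sym (path-first p j (≡ᵇ⇒≡ _ _ (Equivalence.from T-≡ h)))) e
    both : ∀ i j → cycleGraph (length xs) i j ≡ true → lookup xs i ~ lookup xs j
    both i j h with cycSucc (length xs) i j in e₁
    ... | true = next i j e₁
    ... | false = ~-sym (next j i h)

all-elements : ∀ {N} {A : FSet N} l → Uniq l → ⟪ l ⟫ ⊆ A → # A ≤ length l → A ⊆ ⟪ l ⟫
all-elements {A = A} l u sub h x p with ∈? ⟪ l ⟫
... | inj₁ m = m
... | inj₂ n = ⊥-elim (<⇒≱ (length-≤# (x ∷ l) (uniq-∷ x l n u) λ y q → case ∈-∷⁻ q of λ { (inj₁ refl) → p ; (inj₂ r) → sub y r }) h)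

position : ∀ {N} {x : Fin N} l → x ∈ ⟪ l ⟫ → Σ[ i ∈ Fin (length l) ] lookup l i ≡ x
position [] p = ⊥-elim (∉[] p)
position (y ∷ l) p with ∈-∷⁻ p
... | inj₁ e = zero , e
... | inj₂ q with position l q
... | i , e = suc i , e

module Place {v N : ℕ} (A : FSet v) (l : List (Fin N)) (u : Uniq l) (h : # A ≤ length l) where

  private
    listing : Σ[ xs ∈ List (Fin v) ] Uniq xs × length xs ≡ # A × ⟪ xs ⟫ ⊆ A
    listing = elements A (# A) ≤-refl

    xs : List (Fin v)
    xs = proj₁ listing

    len : length xs ≡ # A
    len = proj₁ (proj₂ (proj₂ listing))

    index : ∀ x → x ∈ A → Σ[ i ∈ Fin (length xs) ] lookup xs i ≡ x
    index x p = position xs (all-elements xs (proj₁ (proj₂ listing)) (proj₂ (proj₂ (proj₂ listing))) (≤-reflexive (sym len)) x p)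

    fits : length xs ≤ length l
    fits = ≤-trans (≤-reflexive len) h

  place : ∀ x → x ∈ A → Fin N
  place x p = lookup l (inject≤ (proj₁ (index x p)) fits)

  place∈ : ∀ x p → place x p ∈ ⟪ l ⟫
  place∈ x p = lookup-∈ l _

  place-injective : ∀ x y p q → place x p ≡ place y q → x ≡ y
  place-injective x y p q e = trans (sym (proj₂ (index x p))) (trans (cong (lookup xs) same) (proj₂ (index y q)))
    where
    same : proj₁ (index x p) ≡ proj₁ (index y q)
    same = FinP.inject≤-injective fits fits _ _ (lookup-injective l u _ _ e)

colourClass : ∀ {v r} → (Fin v → Fin r) → Fin r → FSet v
colourClass c i x = does (c x ≟ i)

colourClass⁺ : ∀ {v r} (c : Fin v → Fin r) {i x} → c x ≡ i → x ∈ colourClass c i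
colourClass⁺ c {x = x} refl with c x ≟ c x in e
... | yes _ = mem (cong does e)
... | no n = ⊥-elim (n refl)

colourClass⁻ : ∀ {v r} (c : Fin v → Fin r) {i x} → x ∈ colourClass c i → c x ≡ i
colourClass⁻ c {i} {x} (mem p) with c x ≟ i
... | yes e = e

opaque
  unfolding #

  length-filter : ∀ {A : Set} {P : A → Set} (P? : ∀ x → Dec (P x)) {v} (g : Fin v → A) → length (filter P? (tabulate g)) ≡ # (λ x → does (P? (g x)))
  length-filter P? {zero} g = refl
  length-filter P? {suc v} g with does (P? (g zero))
  ... | true = cong suc (length-filter P? (g ∘ suc))
  ... | false = length-filter P? (g ∘ suc)

classSize≡# : ∀ {v r} (c : Fin v → Fin r) i → classSize c i ≡ # (colourClass c i)
classSize≡# c i = length-filter (λ x → c x ≟ i) id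

module Multipartite {v k : ℕ} (H : RawGraph v) (p : Fin v → Fin k) (onto : ∀ i → ∃ λ x → p x ≡ i) (H≡ : ∀ x y → H x y ≡ not ⌊ p x ≟ p y ⌋) where

  part-size : Fin k → ℕ
  part-size j = # (colourClass p j)

  part-pos : ∀ j → 1 ≤ part-size j
  part-pos j = #-pos (colourClass⁺ p (proj₂ (onto j)))

  H-edge⁺ : ∀ {x y} → p x ≢ p y → H x y ≡ true
  H-edge⁺ {x} {y} n rewrite H≡ x y with p x ≟ p y
  ... | yes e = ⊥-elim (n e)
  ... | no _ = refl

  H-edge⁻ : ∀ {x y} → H x y ≡ true → p x ≢ p y
  H-edge⁻ {x} {y} h with p x ≟ p y | trans (sym (H≡ x y)) h
  ... | yes e | ()
  ... | no n | _ = n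

  open Parts part-size

  total≤v : ∀ js → Uniq js → total js ≤ v
  total≤v js u = ≤-trans (go js u) (≤-trans (#-mono {B = full} λ x _ → ∈-full) (≤-reflexive (#-full {v})))
    where
    covered : List (Fin k) → FSet v
    covered js x = ⟪ js ⟫ (p x)
    go : ∀ js → Uniq js → total js ≤ # (covered js)
    go [] u = z≤n
    go (j ∷ js) u = ≤-trans (+-monoʳ-≤ (part-size j) (go js (uniq-tail j js u))) (#-disjoint (colourClass p j) (covered js) (covered (j ∷ js))
      (λ x a b → uniq-head j js u (subst (_∈ ⟪ js ⟫) (colourClass⁻ p a) (mem (holds b))))
      (λ x a → mem (holds (subst (_∈ ⟪ j ∷ js ⟫) (sym (colourClass⁻ p a)) ∈-head)))
      (λ x b → mem (holds (∈-tail {y = j} {js} (mem {A = ⟪ js ⟫} (holds b))))))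

  family-contains : ∀ {N} (G : SimpleGraph N) js → (∀ j → j ∈ ⟪ js ⟫) → Family G js → Contains (complement (SimpleGraph.adj G)) H
  family-contains {N} G js allj F = f , (λ {x} {y} → injective x y) , λ x y h → nonadjacent x y (H-edge⁻ h)
    where
    open SimpleGraph G
    open Family F
    module P (j : Fin k) = Place (colourClass p j) (members j) (uniq j (allj j)) (enough j (allj j))
    f : Fin v → Fin N
    f x = P.place (p x) x (colourClass⁺ p refl)
    f∈ : ∀ x → f x ∈ ⟪ members (p x) ⟫
    f∈ x = P.place∈ (p x) x _
    at : ∀ j x (e : p x ≡ j) → f x ≡ P.place j x (colourClass⁺ p e)
    at j x refl = refl
    injective : ∀ x y → f x ≡ f y → x ≡ y
    injective x y e with p x ≟ p y
    ... | yes q = P.place-injective (p y) x y _ _ (trans (sym (at (p y) x q)) e)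
    ... | no n = ⊥-elim (proj₁ (apart (p x) (p y) (allj _) (allj _) n (f x) (f y) (f∈ x) (f∈ y)) e)
    nonadjacent : ∀ x y → p x ≢ p y → complement adj (f x) (f y) ≡ true
    nonadjacent x y n with apart (p x) (p y) (allj _) (allj _) n (f x) (f y) (f∈ x) (f∈ y)
    ... | f≢ , far with adj (f x) (f y) in e | f x ≟ f y
    ... | true | _ = ⊥-elim (far (edge e))
    ... | false | yes q = ⊥-elim (f≢ q)
    ... | false | no _ = refl

  rep : Fin k → Fin v
  rep j = proj₁ (onto j)

  rep-distinct : ∀ {r} (c : Fin v → Fin r) → ProperColouring H r c → ∀ i j → c (rep i) ≡ c (rep j) → i ≡ j
  rep-distinct c proper i j e with i ≟ j
  ... | yes q = q
  ... | no n = ⊥-elim (proper (rep i) (rep j) (H-edge⁺ λ q → n (trans (sym (proj₂ (onto i))) (trans q (proj₂ (onto j))))) e)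

  chromatic : ∀ {χ} → IsChromaticNumber H χ → χ ≡ k
  chromatic {χ} ((c , proper) , least) with <-cmp χ k
  ... | tri≈ _ e _ = e
  ... | tri> _ _ k<χ = ⊥-elim (least k k<χ (p , λ x y h → H-edge⁻ h))
  ... | tri< χ<k _ _ with FinP.pigeonhole χ<k (c ∘ rep)
  ... | i , j , i<j , e = ⊥-elim (<-irrefl (cong toℕ (rep-distinct c proper i j e)) i<j)

  small-part : ∀ {σ} → IsSigma H k σ → Σ[ j ∈ Fin k ] part-size j ≤ σ
  small-part {σ} ((c , proper , i , size) , _) = j , ≤-trans (#-mono λ x xp → colourClass⁺ c (constant x (colourClass⁻ p xp))) (≤-reflexive (trans (sym (classSize≡# c i)) size))
    where
    attained : ∀ {k} (g : Fin k → Fin k) → (∀ a b → g a ≡ g b → a ≡ b) → ∀ i → ∃ λ a → g a ≡ i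
    attained {suc k} g inj i with FinP.any? (λ a → g a ≟ i)
    ... | yes found = found
    ... | no n with FinP.pigeonhole (n<1+n k) (λ a → punchOut {i = i} {g a} λ e → n (a , sym e))
    ... | a , b , a<b , e = ⊥-elim (<-irrefl (cong toℕ (inj a b (FinP.punchOut-injective {i = i} {g a} {g b} (λ q → n (a , sym q)) (λ q → n (b , sym q)) e))) a<b)
    colourOf : ∀ i → ∃ λ j → c (rep j) ≡ i
    colourOf = attained (c ∘ rep) (rep-distinct c proper)
    j : Fin k
    j = proj₁ (colourOf i)
    constant : ∀ x → p x ≡ j → c x ≡ i
    constant x px with colourOf (c x)
    ... | j′ , e with j′ ≟ j
    ... | yes refl = trans (sym e) (proj₂ (colourOf i))
    ... | no n = ⊥-elim (proper (rep j′) x (H-edge⁺ λ q → n (trans (sym (proj₂ (onto j′))) (trans q px))) e)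

-- The lower bound

cycle-next : ∀ n (x y : Fin n) → suc (toℕ x) ≡ toℕ y → cycleGraph n x y ≡ true
cycle-next n x y e rewrite Equivalence.to T-≡ (≡⇒≡ᵇ (suc (toℕ x)) (toℕ y) e) = refl

module Blocks (q : ℕ) {{_ : NonZero q}} {N : ℕ} where

  block : Fin N → ℕ
  block x = toℕ x / q

  cliques : RawGraph N
  cliques x y = (block x ≡ᵇ block y) ∧ not (does (x ≟ y))

  ∧-true : ∀ {a b} → a ∧ b ≡ true → a ≡ true × b ≡ true
  ∧-true {true} {true} _ = refl , refl

  same-block : ∀ {x y} → cliques x y ≡ true → block x ≡ block y
  same-block {x} {y} h = ≡ᵇ⇒≡ _ _ (Equivalence.from T-≡ (proj₁ (∧-true h)))

  cliques-simple : IsSimple cliques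
  cliques-simple = (λ x y → cong₂ (λ a b → a ∧ not b) (≡ᵇ-sym (block x) (block y)) (≟-sym x y)) , irr
    where
    ≡ᵇ-sym : ∀ m n → (m ≡ᵇ n) ≡ (n ≡ᵇ m)
    ≡ᵇ-sym zero zero = refl
    ≡ᵇ-sym zero (suc n) = refl
    ≡ᵇ-sym (suc m) zero = refl
    ≡ᵇ-sym (suc m) (suc n) = ≡ᵇ-sym m n
    ≟-sym : ∀ (x y : Fin N) → does (x ≟ y) ≡ does (y ≟ x)
    ≟-sym x y with x ≟ y | y ≟ x
    ... | yes _ | yes _ = refl
    ... | no _ | no _ = refl
    ... | yes e | no n = ⊥-elim (n (sym e))
    ... | no n | yes e = ⊥-elim (n (sym e))
    irr : ∀ x → cliques x x ≡ false
    irr x with x ≟ x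
    ... | yes _ = ∧-zeroʳ _
    ... | no n = ⊥-elim (n refl)

  block-injective : ∀ x y → block x ≡ block y → toℕ x % q ≡ toℕ y % q → x ≡ y
  block-injective x y e e′ = FinP.toℕ-injective (trans (m≡m%n+[m/n]*n (toℕ x) q) (trans (cong₂ (λ a b → a + b * q) e′ e) (sym (m≡m%n+[m/n]*n (toℕ y) q))))

  no-cycle : ¬ Contains cliques (cycleGraph (suc q))
  no-cycle (f , inj , edges) with FinP.pigeonhole (n<1+n q) (λ i → fromℕ< (m%n<n (toℕ (f i)) q))
  ... | i , j , i<j , e = <-irrefl (cong toℕ (inj (block-injective (f i) (f j) (trans (constant i) (sym (constant j)))
          (trans (sym (FinP.toℕ-fromℕ< (m%n<n (toℕ (f i)) q))) (trans (cong toℕ e) (FinP.toℕ-fromℕ< (m%n<n (toℕ (f j)) q))))))) i<j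
    where
    upTo : ∀ t (h : t < suc q) → block (f (fromℕ< h)) ≡ block (f zero)
    upTo zero h = refl
    upTo (suc t) h = trans (sym (same-block (edges (fromℕ< (<⇒≤ h)) (fromℕ< h) adjacent))) (upTo t (<⇒≤ h))
      where
      adjacent : cycleGraph (suc q) (fromℕ< (<⇒≤ h)) (fromℕ< h) ≡ true
      adjacent = cycle-next (suc q) _ _ (trans (cong suc (FinP.toℕ-fromℕ< (<⇒≤ h))) (sym (FinP.toℕ-fromℕ< h)))
    constant : ∀ i → block (f i) ≡ block (f zero)
    constant i = trans (cong (λ j → block (f j)) (sym (FinP.fromℕ<-toℕ i (FinP.toℕ<n i)))) (upTo (toℕ i) (FinP.toℕ<n i))

  no-multipartite : ∀ {v} (H : RawGraph v) r σ → IsSigma H (suc r) σ → 1 ≤ σ → σ ≤ q → N < r * q + σ → ¬ Contains (complement cliques) H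
  no-multipartite {v} H r σ (_ , least) σ-pos σ≤q N< (f , inj , edges) = clash
    where
    bound : ∀ x → toℕ (f x) / q < suc r
    bound x = m<n*o⇒m/o<n (<-≤-trans (ℕP.<-trans (FinP.toℕ<n (f x)) N<) (≤-trans (+-monoʳ-≤ (r * q) σ≤q) (≤-reflexive (+-comm (r * q) q))))
    c : Fin v → Fin (suc r)
    c x = fromℕ< (bound x)
    c-block : ∀ x → toℕ (c x) ≡ block (f x)
    c-block x = FinP.toℕ-fromℕ< (bound x)
    proper : ProperColouring H (suc r) c
    proper x y h e = differ (f x) (f y) (edges x y h) (trans (sym (c-block x)) (trans (cong toℕ e) (c-block y)))
      where
      differ : ∀ a b → complement cliques a b ≡ true → block a ≢ block b
      differ a b h e rewrite e | Equivalence.to T-≡ (≡⇒≡ᵇ (block b) (block b) refl) with a ≟ b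
      differ a b () e | yes _
      differ a b () e | no _
    top : Fin (suc r)
    top = fromℕ< {r} ≤-refl
    σ≤class : σ ≤ # (colourClass c top)
    σ≤class = ≤-trans (least c proper top) (≤-reflexive (classSize≡# c top))
    rest : ℕ
    rest = N ∸ r * q
    high : ∀ {x} → x ∈ colourClass c top → r * q ≤ toℕ (f x)
    high {x} m = ≤-trans (≤-reflexive (cong (_* q) (trans (sym (FinP.toℕ-fromℕ< {r} ≤-refl)) (trans (cong toℕ (sym (colourClass⁻ c m))) (c-block x))))) (m/n*n≤m (toℕ (f x)) q)
    clash : ⊥
    clash with elements (colourClass c top) σ σ≤class
    ... | l , u , len , sub = collide (FinP.pigeonhole rest<l offset)
      where
      r*q≤ : ∀ i → r * q ≤ toℕ (f (lookup l i))
      r*q≤ i = high (sub _ (lookup-∈ l i))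
      rest<l : rest < length l
      rest<l with ≤? (r * q) N
      ... | inj₁ h = ℕP.+-cancelˡ-< (r * q) rest (length l) (≤-<-trans (≤-reflexive (m+[n∸m]≡n h)) (<-≤-trans N< (≤-reflexive (cong (r * q +_) (sym len)))))
      ... | inj₂ h = ≤-trans (s≤s (≤-reflexive (ℕP.m≤n⇒m∸n≡0 (<⇒≤ h)))) (≤-trans σ-pos (≤-reflexive (sym len)))
      offset : Fin (length l) → Fin rest
      offset i = fromℕ< (ℕP.∸-monoˡ-< (FinP.toℕ<n (f (lookup l i))) (r*q≤ i))
      toℕ-offset : ∀ i → toℕ (offset i) ≡ toℕ (f (lookup l i)) ∸ r * q
      toℕ-offset i = FinP.toℕ-fromℕ< _
      collide : (∃ λ i → ∃ λ j → toℕ i < toℕ j × offset i ≡ offset j) → ⊥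
      collide (i , j , i<j , e) = <-irrefl (cong toℕ (lookup-injective l u i j (inj (FinP.toℕ-injective
        (ℕP.∸-cancelʳ-≡ (r*q≤ i) (r*q≤ j) (trans (sym (toℕ-offset i)) (trans (cong toℕ e) (toℕ-offset j)))))))) i<j

-- Extracting a bound on n from the logarithm

ι-unnormalised : ∀ k → ℚ.toℚᵘ (ℕtoℚ k) ℚᵘ.≃ ℚᵘ.mkℚᵘ (ℤ.+ k) 0
ι-unnormalised k = ℚP.toℚᵘ-fromℚᵘ (ℚᵘ.mkℚᵘ (ℤ.+ k) 0)

ι-* : ∀ m n → ℕtoℚ (m * n) ≡ ℕtoℚ m ℚ.* ℕtoℚ n
ι-* m n = ℚP.toℚᵘ-injective (ℚᵘP.≃-trans (ι-unnormalised (m * n)) (ℚᵘP.≃-trans (ℚᵘ.*≡* (cong (ℤ._* (ℤ.+ 1)) (ℤP.pos-* m n)))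
  (ℚᵘP.≃-trans (ℚᵘP.≃-sym (ℚᵘP.*-cong (ι-unnormalised m) (ι-unnormalised n))) (ℚᵘP.≃-sym (ℚP.toℚᵘ-homo-* (ℕtoℚ m) (ℕtoℚ n))))))

ι-+ : ∀ m n → ℕtoℚ (m + n) ≡ ℕtoℚ m ℚ.+ ℕtoℚ n
ι-+ m n = ℚP.toℚᵘ-injective (ℚᵘP.≃-trans (ι-unnormalised (m + n)) (ℚᵘP.≃-trans (ℚᵘ.*≡* (cong (ℤ._* (ℤ.+ 1)) (sym (cong₂ ℤ._+_ (ℤP.*-identityʳ (ℤ.+ m)) (ℤP.*-identityʳ (ℤ.+ n))))))
  (ℚᵘP.≃-trans (ℚᵘP.≃-sym (ℚᵘP.+-cong (ι-unnormalised m) (ι-unnormalised n))) (ℚᵘP.≃-sym (ℚP.toℚᵘ-homo-+ (ℕtoℚ m) (ℕtoℚ n))))))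

ι-mono : ∀ {m n} → m ≤ n → ℕtoℚ m ℚ.≤ ℕtoℚ n
ι-mono {m} {n} h = ℚP.toℚᵘ-cancel-≤ (ℚᵘP.≤-trans (ℚᵘP.≤-reflexive (ι-unnormalised m))
  (ℚᵘP.≤-trans (ℚᵘ.*≤* (ℤP.*-monoʳ-≤-nonNeg (ℤ.+ 1) (ℤ.+≤+ h))) (ℚᵘP.≤-reflexive (ℚᵘP.≃-sym (ι-unnormalised n)))))

ι-cancel : ∀ {m n} → ℕtoℚ m ℚ.≤ ℕtoℚ n → m ≤ n
ι-cancel {m} {n} h = cancel (ℚᵘP.≤-trans (ℚᵘP.≤-reflexive (ℚᵘP.≃-sym (ι-unnormalised m))) (ℚᵘP.≤-trans (ℚP.toℚᵘ-mono-≤ h) (ℚᵘP.≤-reflexive (ι-unnormalised n))))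
  where
  cancel : ℚᵘ.mkℚᵘ (ℤ.+ m) 0 ℚᵘ.≤ ℚᵘ.mkℚᵘ (ℤ.+ n) 0 → m ≤ n
  cancel (ℚᵘ.*≤* p) = ℤP.drop‿+≤+ (subst₂ ℤ._≤_ (ℤP.*-identityʳ (ℤ.+ m)) (ℤP.*-identityʳ (ℤ.+ n)) p)

ι-inverse : ∀ d .{{_ : NonZero d}} → ℕtoℚ d ℚ.* (ℤ.+ 1 ℚ./ d) ≡ 1ℚ
ι-inverse (suc d) = ℚP.toℚᵘ-injective (ℚᵘP.≃-trans (ℚP.toℚᵘ-homo-* (ℕtoℚ (suc d)) (ℤ.+ 1 ℚ./ suc d))
  (ℚᵘP.≃-trans (ℚᵘP.*-cong (ι-unnormalised (suc d)) (ℚP.toℚᵘ-fromℚᵘ (ℚᵘ.mkℚᵘ (ℤ.+ 1) d))) (ℚᵘP.*-inverseʳ (ℚᵘ.mkℚᵘ (ℤ.+ suc d) 0))))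

0≤ι : ∀ k → 0ℚ ℚ.≤ ℕtoℚ k
0≤ι k = ι-mono {0} {k} z≤n

*-mono-0 : ∀ {p q} r → 0ℚ ℚ.≤ r → p ℚ.≤ q → p ℚ.* r ℚ.≤ q ℚ.* r
*-mono-0 r h = ℚP.*-monoʳ-≤-nonNeg r {{ℚ.nonNegative h}}

0≤* : ∀ {p q} → 0ℚ ℚ.≤ p → 0ℚ ℚ.≤ q → 0ℚ ℚ.≤ p ℚ.* q
0≤* {p} {q} hp hq = ℚP.≤-trans (ℚP.≤-reflexive (sym (ℚP.*-zeroˡ q))) (*-mono-0 q hq hp)

binomial : ℕ → ℕ → ℕ
binomial zero i = 1
binomial (suc a) zero = 1
binomial (suc a) (suc i) = binomial a (suc i) + binomial (suc a) i

binomial≤2^ : ∀ a i → binomial a i ≤ 2 ^ (a + i)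
binomial≤2^ zero i = m^n>0 2 i
binomial≤2^ (suc a) zero = m^n>0 2 (suc a + 0)
binomial≤2^ (suc a) (suc i) = ≤-trans (+-mono-≤ (binomial≤2^ a (suc i)) (binomial≤2^ (suc a) i))
  (≤-reflexive (cong (λ z → 2 ^ (a + suc i) + z) (trans (cong (2 ^_) (sym (ℕP.+-suc a i))) (sym (+-identityʳ _)))))

factorial-+ : ∀ a i → (a + i) ! ≡ a ! * i ! * binomial a i
factorial-+ zero i = sym (trans (*-identityʳ _) (+-identityʳ (i !)))
factorial-+ (suc a) zero = trans (cong (_!) (+-identityʳ (suc a))) (sym (trans (*-identityʳ _) (*-identityʳ _)))
factorial-+ (suc a) (suc i) = trans (split (a + suc i)) (trans (cong₂ _+_ first second) (combine (suc a) (suc i) (a !) (i !) (binomial a (suc i)) (binomial (suc a) i)))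
  where
  split : ∀ m → suc (a + suc i) * m ! ≡ suc a * m ! + suc i * m !
  split m = *-distribʳ-+ (m !) (suc a) (suc i)
  first : suc a * (a + suc i) ! ≡ suc a * (a ! * (suc i * i !) * binomial a (suc i))
  first = cong (suc a *_) (factorial-+ a (suc i))
  second : suc i * (a + suc i) ! ≡ suc i * (suc a * a ! * i ! * binomial (suc a) i)
  second = cong (suc i *_) (trans (cong (_!) (ℕP.+-suc a i)) (factorial-+ (suc a) i))
  combine : ∀ A I x y b c → A * (x * (I * y) * b) + I * (A * x * y * c) ≡ A * x * (I * y) * (b + c)
  combine A I x y b c = ℕP.≤-antisym
    (lin (A ∷ I ∷ x ∷ y ∷ b ∷ c ∷ []) (λ A I x y b c → [] ⊢ A :* (x :* (I :* y) :* b) :+ I :* (A :* x :* y :* c) ≼ A :* x :* (I :* y) :* (b :+ c)) tt)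
    (lin (A ∷ I ∷ x ∷ y ∷ b ∷ c ∷ []) (λ A I x y b c → [] ⊢ A :* x :* (I :* y) :* (b :+ c) ≼ A :* (x :* (I :* y) :* b) :+ I :* (A :* x :* y :* c)) tt)

power*factorial : ∀ a i → a ^ i * a ! ≤ (a + i) !
power*factorial a zero = ≤-reflexive (trans (+-identityʳ _) (cong (_!) (sym (+-identityʳ a))))
power*factorial a (suc i) = ≤-trans (≤-reflexive (*-assoc a (a ^ i) (a !))) (≤-trans (*-mono-≤ {a} {suc (a + i)} (≤-trans (m≤m+n a i) (n≤1+n _)) (power*factorial a i))
  (≤-reflexive (cong (_!) (sym (ℕP.+-suc a i)))))

power≤ : ∀ a i → a ^ i ≤ i ! * 2 ^ (a + i)
power≤ a i = ℕP.*-cancelʳ-≤ (a ^ i) (i ! * 2 ^ (a + i)) (a !) {{a !≢0}} (≤-trans (power*factorial a i)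
  (≤-trans (≤-reflexive (factorial-+ a i)) (≤-trans (*-monoʳ-≤ (a ! * i !) (binomial≤2^ a i))
    (≤-reflexive (trans (*-assoc (a !) (i !) _) (*-comm (a !) _))))))

module _ (a : ℕ) where

  quarter : ℚ
  quarter = ℕtoℚ a ℚ.* (½ ℚ.* ½)

  0≤½ : 0ℚ ℚ.≤ ½
  0≤½ = ℚP.nonNegative⁻¹ ½

  0≤½^ : ∀ i → 0ℚ ℚ.≤ ½ ^ℚ i
  0≤½^ zero = ℚP.nonNegative⁻¹ 1ℚ
  0≤½^ (suc i) = 0≤* 0≤½ (0≤½^ i)

  quarter-^ : ∀ i → quarter ^ℚ i ≡ ℕtoℚ (a ^ i) ℚ.* (½ ^ℚ i ℚ.* ½ ^ℚ i)
  quarter-^ zero = refl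
  quarter-^ (suc i) = trans (cong (quarter ℚ.*_) (quarter-^ i)) (trans (rearrange (ℕtoℚ a) ½ (ℕtoℚ (a ^ i)) (½ ^ℚ i))
    (cong (ℚ._* (½ ℚ.* ½ ^ℚ i ℚ.* (½ ℚ.* ½ ^ℚ i))) (sym (ι-* a (a ^ i)))))
    where
    open +-*-Solver using (solve; _:=_) renaming (_:*_ to _⊛_)
    rearrange : ∀ x h y g → x ℚ.* (h ℚ.* h) ℚ.* (y ℚ.* (g ℚ.* g)) ≡ x ℚ.* y ℚ.* (h ℚ.* g ℚ.* (h ℚ.* g))
    rearrange = solve 4 (λ x h y g → x ⊛ (h ⊛ h) ⊛ (y ⊛ (g ⊛ g)) := x ⊛ y ⊛ (h ⊛ g ⊛ (h ⊛ g))) refl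

  2^*½^ : ∀ i → ℕtoℚ (2 ^ i) ℚ.* ½ ^ℚ i ≡ 1ℚ
  2^*½^ zero = refl
  2^*½^ (suc i) = trans (cong (ℚ._* (½ ℚ.* ½ ^ℚ i)) (ι-* 2 (2 ^ i))) (trans (rearrange (ℕtoℚ 2) (ℕtoℚ (2 ^ i)) ½ (½ ^ℚ i)) (cong (1ℚ ℚ.*_) (2^*½^ i)))
    where
    open +-*-Solver using (solve; _:=_) renaming (_:*_ to _⊛_)
    rearrange : ∀ t x h g → t ℚ.* x ℚ.* (h ℚ.* g) ≡ t ℚ.* h ℚ.* (x ℚ.* g)
    rearrange = solve 4 (λ t x h g → t ⊛ x ⊛ (h ⊛ g) := t ⊛ h ⊛ (x ⊛ g)) refl

  weight : ℕ → ℚ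
  weight i = ℕtoℚ (2 ^ a) ℚ.* ½ ^ℚ i

  term≤weight : ∀ i → (quarter ^ℚ i) ℚ.* (ℤ.+ 1 ℚ./ (i !)) {{i !≢0}} ℚ.≤ weight i
  term≤weight i = ℚP.≤-trans (ℚP.≤-reflexive (trans (cong (ℚ._* inv) (quarter-^ i)) (swap (ℕtoℚ (a ^ i)) (½ ^ℚ i) inv)))
    (ℚP.≤-trans (*-mono-0 (½ ^ℚ i ℚ.* ½ ^ℚ i) (0≤* (0≤½^ i) (0≤½^ i)) step) (ℚP.≤-reflexive final))
    where
    open +-*-Solver using (solve; _:=_) renaming (_:*_ to _⊛_)
    inv : ℚ
    inv = (ℤ.+ 1 ℚ./ (i !)) {{i !≢0}}
    0≤inv : 0ℚ ℚ.≤ inv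
    0≤inv = ℚP.nonNegative⁻¹ inv {{ℚP.normalize-nonNeg 1 (i !) {{i !≢0}}}}
    swap : ∀ x g v → x ℚ.* (g ℚ.* g) ℚ.* v ≡ x ℚ.* v ℚ.* (g ℚ.* g)
    swap = solve 3 (λ x g v → x ⊛ (g ⊛ g) ⊛ v := x ⊛ v ⊛ (g ⊛ g)) refl
    cancelled : ℕtoℚ (i ! * 2 ^ (a + i)) ℚ.* inv ≡ ℕtoℚ (2 ^ a) ℚ.* ℕtoℚ (2 ^ i)
    cancelled = trans (cong (ℚ._* inv) (ι-* (i !) (2 ^ (a + i)))) (trans (move (ℕtoℚ (i !)) (ℕtoℚ (2 ^ (a + i))) inv)
      (trans (cong (ℚ._* ℕtoℚ (2 ^ (a + i))) (ι-inverse (i !) {{i !≢0}})) (trans (ℚP.*-identityˡ _) (trans (cong ℕtoℚ (ℕP.^-distribˡ-+-* 2 a i)) (ι-* (2 ^ a) (2 ^ i))))))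
      where
      move : ∀ x y v → x ℚ.* y ℚ.* v ≡ x ℚ.* v ℚ.* y
      move = solve 3 (λ x y v → x ⊛ y ⊛ v := x ⊛ v ⊛ y) refl
    step : ℕtoℚ (a ^ i) ℚ.* inv ℚ.≤ ℕtoℚ (2 ^ a) ℚ.* ℕtoℚ (2 ^ i)
    step = ℚP.≤-trans (*-mono-0 inv 0≤inv (ι-mono (power≤ a i))) (ℚP.≤-reflexive cancelled)
    final : ℕtoℚ (2 ^ a) ℚ.* ℕtoℚ (2 ^ i) ℚ.* (½ ^ℚ i ℚ.* ½ ^ℚ i) ≡ weight i
    final = trans (move (ℕtoℚ (2 ^ a)) (ℕtoℚ (2 ^ i)) (½ ^ℚ i)) (trans (cong (weight i ℚ.*_) (2^*½^ i)) (ℚP.*-identityʳ (weight i)))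
      where
      move : ∀ x y g → x ℚ.* y ℚ.* (g ℚ.* g) ≡ x ℚ.* g ℚ.* (y ℚ.* g)
      move = solve 3 (λ x y g → x ⊛ y ⊛ (g ⊛ g) := x ⊛ g ⊛ (y ⊛ g)) refl

  weight-double : ∀ i → weight (suc i) ℚ.+ weight (suc i) ≡ weight i
  weight-double i = trans (halves (ℕtoℚ (2 ^ a)) (½ ^ℚ i) ½) (ℚP.*-identityˡ (weight i))
    where
    open +-*-Solver using (solve; _:=_) renaming (_:*_ to _⊛_; _:+_ to _⊕_)
    halves : ∀ x g h → x ℚ.* (h ℚ.* g) ℚ.+ x ℚ.* (h ℚ.* g) ≡ (h ℚ.+ h) ℚ.* (x ℚ.* g)
    halves = solve 3 (λ x g h → x ⊛ (h ⊛ g) ⊕ x ⊛ (h ⊛ g) := (h ⊕ h) ⊛ (x ⊛ g)) refl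

  exp≤ : ∀ i → expPartial quarter i ℚ.+ weight i ℚ.≤ ℕtoℚ (2 ^ suc a)
  exp≤ zero = ℚP.≤-trans (ℚP.≤-reflexive (trans (cong (1ℚ ℚ.+_) (ℚP.*-identityʳ (ℕtoℚ (2 ^ a)))) (sym (ι-+ 1 (2 ^ a)))))
    (ι-mono (≤-trans (+-monoˡ-≤ (2 ^ a) (m^n>0 2 a)) (≤-reflexive (cong (λ z → 2 ^ a + z) (sym (+-identityʳ _))))))
  exp≤ (suc i) = ℚP.≤-trans (ℚP.≤-reflexive (ℚP.+-assoc (expPartial quarter i) _ (weight (suc i))))
    (ℚP.≤-trans (ℚP.+-mono-≤ (ℚP.≤-refl {expPartial quarter i}) (ℚP.≤-trans (ℚP.+-mono-≤ (term≤weight (suc i)) ℚP.≤-refl) (ℚP.≤-reflexive (weight-double i)))) (exp≤ i))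

  below : ∀ k → 2 ^ suc a ≤ k → BelowLog quarter k
  below k h = 0≤* (0≤ι a) (0≤* 0≤½ 0≤½) , λ i → ℚP.≤-trans (ℚP.≤-reflexive (sym (ℚP.+-identityʳ _)))
    (ℚP.≤-trans (ℚP.+-mono-≤ (ℚP.≤-refl {expPartial quarter i}) (0≤* (0≤ι (2 ^ a)) (0≤½^ i))) (ℚP.≤-trans (exp≤ i) (ι-mono h)))

  log-bound : ∀ c k n → 2 ^ suc a ≤ k → LogBound c k n → c * a ^ 4 ≤ n * 256
  log-bound c k n h L = ι-cancel (ℚP.≤-trans (ℚP.≤-reflexive eq)
      (ℚP.≤-trans (*-mono-0 (ℕtoℚ 256) (0≤ι 256) (L quarter (below k h))) (ℚP.≤-reflexive (sym (ι-* n 256)))))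
    where
    open +-*-Solver using (solve; _:=_) renaming (_:*_ to _⊛_)
    move : ∀ c x g t → c ℚ.* (x ℚ.* (g ℚ.* g)) ℚ.* t ≡ c ℚ.* x ℚ.* (g ℚ.* g ℚ.* t)
    move = solve 4 (λ c x g t → c ⊛ (x ⊛ (g ⊛ g)) ⊛ t := c ⊛ x ⊛ (g ⊛ g ⊛ t)) refl
    eq : ℕtoℚ (c * a ^ 4) ≡ ℕtoℚ c ℚ.* (quarter ^ℚ 4) ℚ.* ℕtoℚ 256
    eq = trans (ι-* c (a ^ 4)) (sym (trans (cong (λ z → ℕtoℚ c ℚ.* z ℚ.* ℕtoℚ 256) (quarter-^ 4)) (trans (move (ℕtoℚ c) (ℕtoℚ (a ^ 4)) (½ ^ℚ 4) (ℕtoℚ 256))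
      (ℚP.*-identityʳ (ℕtoℚ c ℚ.* ℕtoℚ (a ^ 4))))))

log₂ : ∀ k → 1 ≤ k → Σ[ b ∈ ℕ ] 2 ^ b ≤ k × k < 2 ^ suc b
log₂ (suc zero) _ = 0 , ≤-refl , ≤-refl
log₂ (suc (suc k)) _ with log₂ (suc k) (s≤s z≤n)
... | b , lo , hi with ≤? (2 ^ suc b) (suc (suc k))
... | inj₁ h = suc b , h , lin (k ∷ 2 ^ b ∷ []) (λ k p → con 2 :+ k ≼ con 2 :* p ∷ con 1 ≼ p ∷ [] ⊢ con 2 :+ k ≺ con 2 :* (con 2 :* p)) (hi , m^n>0 2 b , tt)
... | inj₂ h = b , ≤-trans lo (n≤1+n _) , h

power-bound : ∀ k m e → m ≤ k ^ 22 → k ≤ 2 ^ e → m * k ≤ 2 ^ (e * 23)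
power-bound k m e hm hk = ≤-trans (*-monoˡ-≤ k hm) (≤-trans (≤-reflexive (*-comm (k ^ 22) k)) (≤-trans (ℕP.^-monoˡ-≤ 23 hk) (≤-reflexive (ℕP.^-*-assoc 2 e 23))))

exponent-bound : ∀ k m e l → l ≡ 2 + e * 23 → m ≤ k ^ 22 → k < 2 ^ e → 3 * (m * k) < 2 ^ l
exponent-bound k m e _ refl hm hk = lin (m * k ∷ 2 ^ (e * 23) ∷ []) (λ v P → 3 ⊠ v ≼ P ∷ con 1 ≼ P ∷ [] ⊢ con 3 :* v ≺ con 2 :* (con 2 :* P))
  (power-bound k m e hm (<⇒≤ hk) , m^n>0 2 (e * 23) , tt)

module Numbers (a v : ℕ) (a-pos : 1 ≤ a) where

  opaque

    lam : ℕ
    lam = 2 + (2 + a) * 23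

    lam≡ : lam ≡ 2 + (2 + a) * 23
    lam≡ = refl

  kap f : ℕ
  kap = lam * (lam + 2) * 2 + 10 + lam * 2
  f = 3 * v * kap * 20

  kap-unit : lam * 2 + 10 ≤ kap
  kap-unit = lin (lam ∷ lam * (lam + 2) * 2 ∷ []) (λ l p → [] ⊢ l :* con 2 :+ con 10 ≼ p :+ con 10 :+ l :* con 2) tt

  opaque
    unfolding lam

    n-bound : ∀ T n → 100000000000000 ≤ T → T * v * a ^ 4 ≤ n * 256 → lam * f * 200 + f * 200 ≤ n
    n-bound T n hT h = ℕP.*-cancelʳ-≤ _ n 256 (≤-trans poly h)
      where
      a² a³ a⁴ : ℕ
      a² = a * a
      a³ = a * a²
      a⁴ = a ^ 4
      a≤a² : a ≤ a²
      a≤a² = ≤-trans (≤-reflexive (sym (+-identityʳ a))) (*-monoˡ-≤ a a-pos)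
      step : ∀ x → x ≤ a * x
      step x = ≤-trans (≤-reflexive (sym (+-identityʳ x))) (*-monoˡ-≤ x a-pos)
      4≡ : a * a³ ≤ a⁴
      4≡ = lin (a ∷ []) (λ a → [] ⊢ a :* (a :* (a :* a)) ≼ a :* (a :* (a :* (a :* con 1)))) tt
      3≤ : v * a³ ≤ v * a⁴
      3≤ = *-monoʳ-≤ v (≤-trans (step a³) 4≡)
      2≤ : v * a² ≤ v * a⁴
      2≤ = ≤-trans (*-monoʳ-≤ v (step a²)) 3≤
      1≤ : v * a ≤ v * a⁴
      1≤ = ≤-trans (*-monoʳ-≤ v a≤a²) 2≤
      0≤ : v ≤ v * a⁴
      0≤ = ≤-trans (≤-reflexive (sym (*-identityʳ v))) (≤-trans (*-monoʳ-≤ v a-pos) 1≤)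
      poly : (lam * f * 200 + f * 200) * 256 ≤ T * v * a⁴
      poly = lin (a ∷ v ∷ T ∷ v * a⁴ ∷ T * v * a⁴ ∷ [])
        (λ a v T va⁴ top → let lam = con 2 :+ (con 2 :+ a) :* con 23 ; kap = lam :* (lam :+ con 2) :* con 2 :+ con 10 :+ lam :* con 2 ; f = con 3 :* v :* kap :* con 20 in
          va⁴ :* con 100000000000000 ≼ top ∷ 10000000000000 ⊠ v ≼ va⁴ ∷ 10000000000000 ⊠ v :* a ≼ va⁴ ∷ 10000000000000 ⊠ v :* (a :* a) ≼ va⁴ ∷ 10000000000000 ⊠ v :* (a :* (a :* a)) ≼ va⁴ ∷ []
          ⊢ (lam :* f :* con 200 :+ f :* con 200) :* con 256 ≼ top)
        (≤-trans (*-monoʳ-≤ (v * a⁴) hT) (≤-reflexive (trans (*-comm (v * a⁴) T) (sym (*-assoc T v a⁴)))) , 0≤ , 1≤ , 2≤ , 3≤ , tt)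

module Good {v k′ : ℕ} (H : RawGraph v) (p : Fin v → Fin (suc k′)) (onto : ∀ i → ∃ λ x → p x ≡ i) (H≡ : ∀ x y → H x y ≡ not ⌊ p x ≟ p y ⌋)
  (q lam kap f σ : ℕ) (hσ : IsSigma H (suc k′) σ)
  (B<2^lam : 3 * v < 2 ^ lam) (kap-connect : lam * (lam + 2) * 2 + 10 ≤ kap) (kap-unit : lam * 2 + 10 ≤ kap)
  (f-big : 3 * v * kap * 20 ≤ f) (n-big : lam * f * 200 + f * 200 ≤ suc (suc q)) (v<n : v ≤ suc q) where
  open Multipartite H p onto H≡
  open Parts part-size
  open Goodness part-size part-pos (suc (suc q)) v lam kap f (s≤s z≤n) B<2^lam kap-connect kap-unit f-big n-big

  j₁ : Fin (suc k′)
  j₁ = proj₁ (small-part hσ)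

  others : Σ[ js ∈ List (Fin (suc k′)) ] Uniq js × length js ≡ k′ × ⟪ js ⟫ ⊆ full ∖ ⁅ j₁ ⁆
  others = elements (full ∖ ⁅ j₁ ⁆) k′ (ℕP.≤-pred (lin (k′ ∷ # (full {suc k′}) ∷ # ⁅ j₁ ⁆ ∷ # (full ∖ ⁅ j₁ ⁆) ∷ []) (λ k f o r → con 1 :+ k ≼ f ∷ f ≼ o :+ r ∷ o ≼ con 1 ∷ [] ⊢ con 1 :+ k ≼ con 1 :+ r)
    (≤-reflexive (sym (#-full {suc k′})) , #-≤+∖ full ⁅ j₁ ⁆ , #-⁅⁆ j₁ , tt)))

  js : List (Fin (suc k′))
  js = proj₁ others

  uniq-parts : Uniq (j₁ ∷ js)
  uniq-parts = uniq-∷ j₁ js (λ m → ∖ʳ (proj₂ (proj₂ (proj₂ others)) j₁ m) ∈⁅⁆) (proj₁ (proj₂ others))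

  all-parts : ∀ j → j ∈ ⟪ j₁ ∷ js ⟫
  all-parts j = all-elements {A = full} (j₁ ∷ js) uniq-parts (λ _ _ → ∈-full) (≤-reflexive (trans (#-full {suc k′}) (cong suc (sym (proj₁ (proj₂ (proj₂ others))))))) j ∈-full

  upper : RamseyArrow (cycleGraph (suc (suc q))) H (k′ * suc q + σ)
  upper G (G-sym , G-irr) = decide (contains? G (cycleGraph (suc (suc q)))) (contains? (complement G) H)
    where
    SG : SimpleGraph (k′ * suc q + σ)
    SG = record { adj = G ; adj-sym = G-sym ; adj-irr = G-irr }
    outcome : ∥ Outcome SG (j₁ ∷ js) ∥
    outcome = induct k′ js (proj₁ (proj₂ (proj₂ others))) SG j₁ uniq-parts (total≤v (j₁ ∷ js) uniq-parts) (+-monoʳ-≤ (k′ * suc q) (proj₂ (small-part hσ)))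
    decide : Dec (Contains G (cycleGraph (suc (suc q)))) → Dec (Contains (complement G) H) → Contains G (cycleGraph (suc (suc q))) ⊎ Contains (complement G) H
    decide (yes c) _ = inj₁ c
    decide (no _) (yes c) = inj₂ c
    decide (no n₁) (no n₂) = ⊥-elim (outcome λ { (inj₁ Z) → n₁ (cycle-contains SG Z) ; (inj₂ F) → n₂ (family-contains SG (j₁ ∷ js) all-parts F) })

  lower : ∀ N′ → N′ < k′ * suc q + σ → ¬ RamseyArrow (cycleGraph (suc (suc q))) H N′
  lower N′ h arrow with arrow (Blocks.cliques (suc q)) (Blocks.cliques-simple (suc q))
  ... | inj₁ c = Blocks.no-cycle (suc q) c
  ... | inj₂ c = Blocks.no-multipartite (suc q) H k′ σ hσ (≤-trans (part-pos j₁) (proj₂ (small-part hσ))) σ≤ h c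
    where
    σ≤ : σ ≤ suc q
    σ≤ = ≤-trans (proj₂ hσ p (λ x y e → H-edge⁻ e) j₁) (≤-trans (≤-reflexive (classSize≡# p j₁)) (≤-trans (#-mono {B = full} λ _ _ → ∈-full) (≤-trans (≤-reflexive (#-full {v})) v<n)))

  ramsey : IsRamseyNumber (cycleGraph (suc (suc q))) H (k′ * suc q + σ)
  ramsey = upper , lower

ramsey-number : ∀ k v (H : RawGraph v) → IsCompleteMultipartite k H → ∀ n lam kap f σ → IsSigma H k σ → 1 ≤ k →
  3 * v < 2 ^ lam → lam * (lam + 2) * 2 + 10 ≤ kap → lam * 2 + 10 ≤ kap → 3 * v * kap * 20 ≤ f → lam * f * 200 + f * 200 ≤ n → v + 2 ≤ n →
  IsRamseyNumber (cycleGraph n) H ((k ∸ 1) * (n ∸ 1) + σ)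
ramsey-number (suc k′) v H (p , onto , H≡) zero lam kap f σ hσ _ h₁ h₂ h₃ h₄ h₅ h₆ = ⊥-elim (<⇒≱ (≤-trans (m≤n+m 1 _) (≤-reflexive (+-assoc v 1 1))) h₆)
ramsey-number (suc k′) v H (p , onto , H≡) (suc zero) lam kap f σ hσ _ h₁ h₂ h₃ h₄ h₅ h₆ = ⊥-elim (<⇒≱ (m≤n+m 2 v) h₆)
ramsey-number (suc k′) v H (p , onto , H≡) (suc (suc q)) lam kap f σ hσ _ h₁ h₂ h₃ h₄ h₅ h₆ = Good.ramsey H p onto H≡ q lam kap f σ hσ h₁ h₂ h₃ h₄ h₅
  (ℕP.≤-pred (≤-trans (≤-trans (≤-reflexive (+-comm 1 v)) (+-monoʳ-≤ v (s≤s z≤n))) h₆))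

-- Stated for variable T and C because conversion checking would unfold the numerals 10 ^ 60 and 3 ^ 22.
good : ∀ T C → 100000000000000 ≤ T → (∀ k → k ≤ 3 → k ^ 22 < C) → 2 ≤ C →
  ∀ (k m : ℕ) (H : RawGraph (m * k)) → IsCompleteMultipartite k H → C ≤ m → m ≤ k ^ 22 →
  ∀ (n : ℕ) → LogBound (T * m * k) k n → ∀ (χ σ : ℕ) → IsChromaticNumber H χ → IsSigma H χ σ →
  IsRamseyNumber (cycleGraph n) H ((χ ∸ 1) * (n ∸ 1) + σ)
good T C T-big C-big C-pos k m H (p , onto , H≡) m-big m≤ n L χ σ hχ hσ with Multipartite.chromatic H p onto H≡ hχ
... | refl = withLog (log₂ k (≤-trans (s≤s z≤n) k>3))
  where
  k>3 : 3 < k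
  k>3 with ≤? k 3
  ... | inj₁ h = ⊥-elim (<⇒≱ (<-≤-trans (C-big k h) m-big) m≤)
  ... | inj₂ h = h
  withLog : (Σ[ b ∈ ℕ ] 2 ^ b ≤ k × k < 2 ^ suc b) → IsRamseyNumber (cycleGraph n) H ((k ∸ 1) * (n ∸ 1) + σ)
  withLog (zero , _ , hi) = ⊥-elim (<⇒≱ hi (≤-trans (s≤s (s≤s z≤n)) k>3))
  withLog (suc zero , _ , hi) = ⊥-elim (<⇒≱ hi k>3)
  withLog (suc (suc b) , lo , hi) = ramsey-number k (m * k) H (p , onto , H≡) n lam kap f σ hσ (≤-trans (s≤s z≤n) k>3)
      (exponent-bound k m (suc (suc (suc b))) lam lam≡ m≤ hi) (m≤m+n _ _) kap-unit ≤-refl big v+2≤n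
    where
    v : ℕ
    v = m * k
    open Numbers (suc b) v (s≤s z≤n)
    big : lam * f * 200 + f * 200 ≤ n
    big = n-bound T n T-big (≤-trans (≤-reflexive (cong (_* (suc b) ^ 4) (sym (*-assoc T m k)))) (log-bound (suc b) (T * m * k) k n lo L))
    v+2≤n : v + 2 ≤ n
    v+2≤n = ≤-trans (lin (v ∷ f ∷ kap ∷ v * kap ∷ lam * f ∷ []) (λ v f k vk lf → 2 ⊠ v ≼ vk ∷ 60 ⊠ vk ≼ v :* k ∷ con 3 :* v :* k :* con 20 ≼ f ∷ con 2 ≼ v ∷ [] ⊢ v :+ con 2 ≼ lf :* con 200 :+ f :* con 200)
        (≤-trans (≤-reflexive (sym (*-identityʳ v))) (*-monoʳ-≤ v (≤-trans (m≤n+m 1 9) (≤-trans (m≤n+m 10 (lam * 2)) kap-unit))) , ≤-refl , ≤-refl , 2≤v , tt)) big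
      where
      2≤v : 2 ≤ v
      2≤v = *-mono-≤ (≤-trans C-pos m-big) (≤-trans (s≤s z≤n) k>3)

theorem6p1 : Σ ℕ λ C' → 0 < C' ×
    (∀ (k m : ℕ) (H : RawGraph (m * k)) → IsCompleteMultipartite k H →
    C' ≤ m → m ≤ k ^ 22 →
    ∀ (n : ℕ) → LogBound (10 ^ 60 * m * k) k n →
    ∀ (χ σ : ℕ) → IsChromaticNumber H χ → IsSigma H χ σ →
    IsRamseyNumber (cycleGraph n) H ((χ ∸ 1) * (n ∸ 1) + σ))
theorem6p1 = suc (3 ^ 22) , s≤s z≤n , good (10 ^ 60) (suc (3 ^ 22)) (≤ᵇ⇒≤ 100000000000000 (10 ^ 60) tt) (λ k h → s≤s (ℕP.^-monoˡ-≤ 22 h)) (s≤s (m^n>0 3 22))
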